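{- Let $m,l,t$ be positive integers with $m\ge tl$, let $\mathcal G\subset\binom{[m]}l$ be a family, and let $\alpha:=|\mathcal G|/\binom ml$. Let $\mathcal B$ be chosen uniformly at random among all $t$-tuples of pairwise disjoint $l$-element subsets of $[m]$, and let $\eta:=|\mathcal G\cap\mathcal B|$ be the number of sets in $\mathcal B$ that belong to $\mathcal G$. Then for any positive $\beta$, $$\Pr\big[|\eta-\alpha t|\ge2\beta\sqrt t\big]\le2e^{ -\beta^2/2}.$$
   Context: $[m]=\{1,\dots,m\}$ and $\binom{[m]}l$ is the family of all $l$-element subsets of $[m]$. -}

module Defs where

open import Data.Fin.Subset using (Subset; inside; outside; _∩_; Empty; ∣_∣; ⊥)
open import Data.Fin.Subset.Properties using (nonempty?; x∈p∩q⁻; ∉⊥; ∣⊥∣≡0)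
open import Data.Integer.Base as ℤ using (+_)
open import Data.List.Base as List using (List; []; _∷_; length; filter; cartesianProductWith)
open import Data.List.Membership.Propositional using (_∈_)
open import Data.List.Membership.Propositional.Properties
  using (∈-filter⁺; ∈-filter⁻; ∈-cartesianProductWith⁺; ∈-length)
open import Data.List.Relation.Unary.Any using (here; there)
import Data.List.Relation.Unary.All as ListAll
open import Data.List.Relation.Unary.Unique.Propositional using (Unique)
import Data.List.Relation.Unary.AllPairs as ListPairs
import Data.List.Relation.Unary.Unique.Propositional.Properties as Uniqueₚ
open import Data.Nat.Base as ℕ using (ℕ; zero; suc; s≤s; z≤n; _!)
open import Data.Nat.Combinatorics using (_C_; nCk≡n!/k![n-k]!; k![n∸k]!∣n!)
import Data.Nat.DivMod as ℕ
import Data.Nat.Divisibility as ℕ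
import Data.Nat.Properties as ℕ
import Data.Integer.Properties as ℤ
open import Data.Nat.Solver using () renaming (module +-*-Solver to ℕ-Solver)
open import Data.Product.Base using (∃; _×_; _,_; proj₁; proj₂)
open import Data.Rational.Base as ℚ using (ℚ; 0ℚ; 1ℚ; ½)
import Data.Rational.Base as ℚ-Base
import Data.Rational.Properties as ℚ
open import Data.Rational.Solver using (module +-*-Solver)
import Data.Rational.Unnormalised.Base as ℚᵘ
import Data.Rational.Unnormalised.Properties as ℚᵘ
open import Algebra.Definitions.RawSemiring ℚ.+-*-rawSemiring using (_^_)
open import Data.Vec.Base as Vec using (Vec; []; _∷_; count)
open import Data.Vec.Properties using (∷-injective)
import Data.Vec.Relation.Unary.All as VecAll
import Data.Vec.Relation.Unary.All.Properties as VecAllₚ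
import Data.Vec.Relation.Unary.AllPairs.Properties as VecPairsₚ
import Data.Vec.Relation.Unary.AllPairs as VecPairs
open VecAll using (All; []; _∷_)
open VecPairs using (AllPairs; []; _∷_)
open import Data.Sum.Base using (inj₁; inj₂)
open import Level as ℓ using (Level; 0ℓ; _⊔_)
open import Relation.Binary.PropositionalEquality hiding (J; [_])
open import Relation.Nullary using (yes; no; ¬?; contradiction)
open import Relation.Nullary.Decidable using (_×-dec_)
open import Relation.Unary using (Pred; Decidable; _⊆_)

private
  variable
    a p : Level
    A : Set a

private
  open ℚ-Base using () renaming (_+_ to _+q_; _*_ to _*q_; _-_ to _-q_; -_ to -q_; ∣_∣ to ∣_∣q)

  infix 4 _≲_
  _≲_ : ℚ → ℚ → Set
  _≲_ = ℚ._≤_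

  dist : ℚ → ℚ → ℚ
  dist x y = ∣ x -q y ∣q

  +-nn : ∀ {x y} → 0ℚ ≲ x → 0ℚ ≲ y → 0ℚ ≲ x +q y
  +-nn h k = ℚ.+-mono-≤ h k

  *-nn : ∀ {x y} → 0ℚ ≲ x → 0ℚ ≲ y → 0ℚ ≲ x *q y
  *-nn {x} {y} h k = ℚ.nonNegative⁻¹ (x *q y) {{ℚ.nonNeg*nonNeg⇒nonNeg x {{ℚ.nonNegative h}} y {{ℚ.nonNegative k}}}}

  *-pos : ∀ {x y} → 0ℚ ℚ.< x → 0ℚ ℚ.< y → 0ℚ ℚ.< x *q y
  *-pos {x} {y} h k = ℚ.positive⁻¹ (x *q y) {{ℚ.pos*pos⇒pos x {{ℚ.positive h}} y {{ℚ.positive k}}}}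

  *-mono : ∀ {x y u v} → 0ℚ ≲ u → 0ℚ ≲ y → x ≲ y → u ≲ v → x *q u ≲ y *q v
  *-mono {x} {y} {u} {v} u≥0 y≥0 h k =
    ℚ.≤-trans (ℚ.*-monoʳ-≤-nonNeg u {{ℚ.nonNegative u≥0}} h)
              (ℚ.*-monoˡ-≤-nonNeg y {{ℚ.nonNegative y≥0}} k)

  0<1 : 0ℚ ℚ.< 1ℚ
  0<1 = ℚ.positive⁻¹ 1ℚ

  0<½ : 0ℚ ℚ.< ½
  0<½ = ℚ.positive⁻¹ ½

  half+half : ∀ ε → ε *q ½ +q ε *q ½ ≡ ε
  half+half ε = trans (sym (ℚ.*-distribˡ-+ ε ½ ½)) (ℚ.*-identityʳ ε)

  dist-sym : ∀ x y → dist x y ≡ dist y x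
  dist-sym x y = trans (cong ∣_∣q lem) (ℚ.∣-p∣≡∣p∣ (y -q x))
    where
    open +-*-Solver
    lem : x -q y ≡ -q (y -q x)
    lem = solve 2 (λ x y → x :- y := :- (y :- x)) refl x y

  triangle : ∀ x y z → dist x z ≲ dist x y +q dist y z
  triangle x y z = subst (_≲ dist x y +q dist y z) (cong ∣_∣q lem) (ℚ.∣p+q∣≤∣p∣+∣q∣ (x -q y) (y -q z))
    where
    open +-*-Solver
    lem : (x -q y) +q (y -q z) ≡ x -q z
    lem = solve 3 (λ x y z → (x :- y) :+ (y :- z) := x :- z) refl x y z

  ≤∣∣ : ∀ x → x ≲ ∣ x ∣q
  ≤∣∣ x with ℚ.≤-total 0ℚ x
  ... | inj₁ h = ℚ.≤-reflexive (sym (ℚ.0≤p⇒∣p∣≡p h))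
  ... | inj₂ h = ℚ.≤-trans h (ℚ.0≤∣p∣ x)

  ∣∣-lub : ∀ {x e} → x ≲ e → -q x ≲ e → ∣ x ∣q ≲ e
  ∣∣-lub {x} h k with ℚ.∣p∣≡p∨∣p∣≡-p x
  ... | inj₁ eq = subst (_≲ _) (sym eq) h
  ... | inj₂ eq = subst (_≲ _) (sym eq) k

  x≤y+e⇒x-y≤e : ∀ {x y e} → x ≲ y +q e → x -q y ≲ e
  x≤y+e⇒x-y≤e {x} {y} {e} h = subst (x -q y ≲_) lem (ℚ.+-monoˡ-≤ (-q y) h)
    where
    open +-*-Solver
    lem : (y +q e) -q y ≡ e
    lem = solve 2 (λ y e → (y :+ e) :- y := e) refl y e

  dist-lub : ∀ {x y e} → x ≲ y +q e → y ≲ x +q e → dist x y ≲ e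
  dist-lub {x} {y} {e} h k = ∣∣-lub (x≤y+e⇒x-y≤e h) (subst (_≲ e) lem (x≤y+e⇒x-y≤e k))
    where
    open +-*-Solver
    lem : y -q x ≡ -q (x -q y)
    lem = solve 2 (λ x y → y :- x := :- (x :- y)) refl x y

  dist-abs : ∀ x y → dist ∣ x ∣q ∣ y ∣q ≲ dist x y
  dist-abs x y = dist-lub (one x y) (subst (λ d → ∣ y ∣q ≲ ∣ x ∣q +q d) (dist-sym y x) (one y x))
    where
    open +-*-Solver
    one : ∀ x y → ∣ x ∣q ≲ ∣ y ∣q +q dist x y
    one x y = subst (λ z → ∣ z ∣q ≲ ∣ y ∣q +q dist x y)
      (solve 2 (λ x y → y :+ (x :- y) := x) refl x y) (ℚ.∣p+q∣≤∣p∣+∣q∣ y (x -q y))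

  dist-* : ∀ x y u v → dist (x *q u) (y *q v) ≲ ∣ u ∣q *q dist x y +q ∣ y ∣q *q dist u v
  dist-* x y u v = subst₂ _≲_ (cong ∣_∣q lem)
      (cong₂ _+q_ (ℚ.∣p*q∣≡∣p∣*∣q∣ u (x -q y)) (ℚ.∣p*q∣≡∣p∣*∣q∣ y (u -q v)))
      (ℚ.∣p+q∣≤∣p∣+∣q∣ (u *q (x -q y)) (y *q (u -q v)))
    where
    open +-*-Solver
    lem : u *q (x -q y) +q y *q (u -q v) ≡ x *q u -q y *q v
    lem = solve 4 (λ x y u v → u :* (x :- y) :+ y :* (u :- v) := x :* u :- y :* v) refl x y u v

  shrink : ∀ c ε → 0ℚ ℚ.< ε → ∃ λ δ → 0ℚ ℚ.< δ × c *q δ ≲ ε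
  shrink c ε 0<ε = δ , 0<δ , bound
    where
    d : ℚ
    d = 1ℚ +q ∣ c ∣q
    0<d : 0ℚ ℚ.< d
    0<d = ℚ.+-mono-<-≤ 0<1 (ℚ.0≤∣p∣ c)
    instance
      d-pos : ℚ.Positive d
      d-pos = ℚ.positive 0<d
      d≢0 : ℚ.NonZero d
      d≢0 = ℚ.pos⇒nonZero d
    δ : ℚ
    δ = ε *q (ℚ.1/ d)
    0<δ : 0ℚ ℚ.< δ
    0<δ = *-pos 0<ε (ℚ.positive⁻¹ (ℚ.1/ d) {{ℚ.1/pos⇒pos d}})
    c≤d : c ≲ d
    c≤d = ℚ.≤-trans (≤∣∣ c) (subst (_≲ d) (ℚ.+-identityˡ ∣ c ∣q) (ℚ.+-monoˡ-≤ ∣ c ∣q (ℚ.<⇒≤ 0<1)))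
    bound : c *q δ ≲ ε
    bound = ℚ.≤-trans (ℚ.*-monoʳ-≤-nonNeg δ {{ℚ.nonNegative (ℚ.<⇒≤ 0<δ)}} c≤d) (ℚ.≤-reflexive eq)
      where
      open ≡-Reasoning
      open +-*-Solver
      eq : d *q δ ≡ ε
      eq = begin
        d *q (ε *q (ℚ.1/ d)) ≡⟨ solve 3 (λ d e i → d :* (e :* i) := e :* (d :* i)) refl d ε (ℚ.1/ d) ⟩
        ε *q (d *q (ℚ.1/ d)) ≡⟨ cong (ε *q_) (ℚ.*-inverseʳ d) ⟩
        ε *q 1ℚ              ≡⟨ ℚ.*-identityʳ ε ⟩
        ε                    ∎

-- Real numbers as Cauchy sequences of rationals.  No quotient is taken:
-- equality of reals is mutual _≤ᴿ_.

IsCauchy : (ℕ → ℚ) → Set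
IsCauchy x = ∀ ε → 0ℚ ℚ.< ε → ∃ λ N → ∀ m n → N ℕ.≤ m → N ℕ.≤ n → ℚ.∣ x m ℚ.- x n ∣ ℚ.≤ ε

record ℝ : Set where
  constructor mkℝ
  field
    seq    : ℕ → ℚ
    cauchy : IsCauchy seq

open ℝ public

infix 4 _≤ᴿ_ _<ᴿ_

_≤ᴿ_ : ℝ → ℝ → Set
x ≤ᴿ y = ∀ ε → 0ℚ ℚ.< ε → ∃ λ N → ∀ n → N ℕ.≤ n → seq x n ℚ.≤ seq y n ℚ.+ ε

_<ᴿ_ : ℝ → ℝ → Set
x <ᴿ y = ∃ λ ε → 0ℚ ℚ.< ε × ∃ λ N → ∀ n → N ℕ.≤ n → seq x n ℚ.+ ε ℚ.≤ seq y n

fromℚ : ℚ → ℝ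
fromℚ q = mkℝ (λ _ → q) λ ε 0<ε → 0 , λ _ _ _ _ →
  subst (ℚ._≤ ε) (sym (cong ℚ.∣_∣ (ℚ.+-inverseʳ q))) (ℚ.<⇒≤ 0<ε)

fromℕ : ℕ → ℝ
fromℕ n = fromℚ (+ n ℚ./ 1)

0ᴿ : ℝ
0ᴿ = fromℕ 0

private
  max-l : ∀ {M N n} → M ℕ.⊔ N ℕ.≤ n → M ℕ.≤ n
  max-l {M} {N} = ℕ.≤-trans (ℕ.m≤m⊔n M N)
  max-r : ∀ {M N n} → M ℕ.⊔ N ℕ.≤ n → N ℕ.≤ n
  max-r {M} {N} = ℕ.≤-trans (ℕ.m≤n⊔m M N)

  lipschitz : ∀ {x : ℕ → ℚ} (f : ℚ → ℚ) → (∀ u v → dist (f u) (f v) ≲ dist u v) → IsCauchy x → IsCauchy (λ n → f (x n))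
  lipschitz f h c ε 0<ε with c ε 0<ε
  ... | N , k = N , λ m n p q → ℚ.≤-trans (h _ _) (k m n p q)

  +-cauchy : ∀ {x y} → IsCauchy x → IsCauchy y → IsCauchy (λ n → x n ℚ.+ y n)
  +-cauchy {x} {y} cx cy ε 0<ε with cx (ε *q ½) (*-pos 0<ε 0<½) | cy (ε *q ½) (*-pos 0<ε 0<½)
  ... | M , f | N , g = M ℕ.⊔ N , λ m n p q →
    subst₂ _≲_ (cong ∣_∣q (lem (x m) (x n) (y m) (y n))) (half+half ε)
      (ℚ.≤-trans (ℚ.∣p+q∣≤∣p∣+∣q∣ (x m -q x n) (y m -q y n))
        (ℚ.+-mono-≤ (f m n (max-l {M} p) (max-l {M} q)) (g m n (max-r {M} p) (max-r {M} q))))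
    where
    open +-*-Solver
    lem : ∀ a b c d → (a -q b) +q (c -q d) ≡ (a +q c) -q (b +q d)
    lem = solve 4 (λ a b c d → (a :- b) :+ (c :- d) := (a :+ c) :- (b :+ d)) refl

  bounded : ∀ {x} → IsCauchy x → ∃ λ b → 0ℚ ≲ b × ∃ λ N → ∀ n → N ℕ.≤ n → ∣ x n ∣q ≲ b
  bounded {x} c with c 1ℚ 0<1
  ... | N , f = ∣ x N ∣q +q 1ℚ , +-nn (ℚ.0≤∣p∣ (x N)) (ℚ.<⇒≤ 0<1) , N , λ n p →
    ℚ.≤-trans (subst (λ z → ∣ z ∣q ≲ ∣ x N ∣q +q dist (x n) (x N)) (lem (x n) (x N)) (ℚ.∣p+q∣≤∣p∣+∣q∣ (x N) (x n -q x N)))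
      (ℚ.+-monoʳ-≤ ∣ x N ∣q (f n N p ℕ.≤-refl))
    where
    open +-*-Solver
    lem : ∀ a b → b +q (a -q b) ≡ a
    lem = solve 2 (λ a b → b :+ (a :- b) := a) refl

  *-cauchy : ∀ {x y} → IsCauchy x → IsCauchy y → IsCauchy (λ n → x n ℚ.* y n)
  *-cauchy {x} {y} cx cy ε 0<ε =
    let b  , b≥0  , K  , bd  = bounded {x} cx
        b′ , b′≥0 , K′ , bd′ = bounded {y} cy
        0<ε/2                = *-pos 0<ε 0<½
        δ  , 0<δ  , bδ       = shrink b (ε *q ½) 0<ε/2
        δ′ , 0<δ′ , bδ′      = shrink b′ (ε *q ½) 0<ε/2
        M , f                = cx δ′ 0<δ′
        N , g                = cy δ 0<δ
        L                    = K ℕ.⊔ K′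
    in L ℕ.⊔ (M ℕ.⊔ N) , λ m n p q →
      ℚ.≤-trans (dist-* (x m) (x n) (y m) (y n)) (subst (_ ≲_) (half+half ε) (ℚ.+-mono-≤
        (ℚ.≤-trans (*-mono (ℚ.0≤∣p∣ (x m -q x n)) b′≥0 (bd′ m (max-r {K} (max-l {L} p)))
          (f m n (max-l {M} (max-r {L} p)) (max-l {M} (max-r {L} q)))) bδ′)
        (ℚ.≤-trans (*-mono (ℚ.0≤∣p∣ (y m -q y n)) b≥0 (bd n (max-l {K} (max-l {L} q)))
          (g m n (max-r {M} (max-r {L} p)) (max-r {M} (max-r {L} q)))) bδ)))

infix  8 -ᴿ_
infixl 7 _*ᴿ_
infixl 6 _+ᴿ_ _-ᴿ_

_+ᴿ_ : ℝ → ℝ → ℝ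
x +ᴿ y = mkℝ (λ n → seq x n ℚ.+ seq y n) (+-cauchy {seq x} {seq y} (cauchy x) (cauchy y))

-ᴿ_ : ℝ → ℝ
-ᴿ x = mkℝ (λ n → ℚ.- seq x n) (lipschitz {seq x} ℚ.-_ (λ u v → ℚ.≤-reflexive (eq u v)) (cauchy x))
  where
  open +-*-Solver
  eq : ∀ u v → dist (ℚ.- u) (ℚ.- v) ≡ dist u v
  eq u v = trans (cong ℚ.∣_∣ (solve 2 (λ u v → :- u :- :- v := v :- u) refl u v)) (dist-sym v u)

_-ᴿ_ : ℝ → ℝ → ℝ
x -ᴿ y = x +ᴿ (-ᴿ y)

_*ᴿ_ : ℝ → ℝ → ℝ
x *ᴿ y = mkℝ (λ n → seq x n ℚ.* seq y n) (*-cauchy {seq x} {seq y} (cauchy x) (cauchy y))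

∣_∣ᴿ : ℝ → ℝ
∣ x ∣ᴿ = mkℝ (λ n → ℚ.∣ seq x n ∣) (lipschitz {seq x} ℚ.∣_∣ dist-abs (cauchy x))

⌊√_⌋ : ℕ → ℕ
⌊√ zero ⌋ = 0
⌊√ suc n ⌋ with suc ⌊√ n ⌋ ℕ.* suc ⌊√ n ⌋ ℕ.≤? suc n
... | yes _ = suc ⌊√ n ⌋
... | no  _ = ⌊√ n ⌋

⌊√⌋-spec : ∀ n → ⌊√ n ⌋ ℕ.* ⌊√ n ⌋ ℕ.≤ n × n ℕ.< suc ⌊√ n ⌋ ℕ.* suc ⌊√ n ⌋
⌊√⌋-spec zero = z≤n , s≤s z≤n
⌊√⌋-spec (suc n) with suc ⌊√ n ⌋ ℕ.* suc ⌊√ n ⌋ ℕ.≤? suc n | ⌊√⌋-spec n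
... | yes h | _ , k = h , ℕ.<-≤-trans (s≤s k) (ℕ.*-mono-< (ℕ.n<1+n (suc ⌊√ n ⌋)) (ℕ.n<1+n (suc ⌊√ n ⌋)))
... | no  h | j , _ = ℕ.m≤n⇒m≤1+n j , ℕ.≰⇒> h

private
  /-mono : ∀ a b j k → a ℕ.* suc k ℕ.≤ b ℕ.* suc j → (+ a) ℚ./ suc j ≲ (+ b) ℚ./ suc k
  /-mono a b j k h = ℚ.toℚᵘ-cancel-≤
    (ℚᵘ.≤-respˡ-≃ (ℚᵘ.≃-sym (ℚ.toℚᵘ-fromℚᵘ (ℚᵘ.mkℚᵘ (+ a) j)))
    (ℚᵘ.≤-respʳ-≃ (ℚᵘ.≃-sym (ℚ.toℚᵘ-fromℚᵘ (ℚᵘ.mkℚᵘ (+ b) k)))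
    (ℚᵘ.*≤* (subst₂ ℤ._≤_ (ℤ.pos-* a (suc k)) (ℤ.pos-* b (suc j)) (ℤ.+≤+ h)))))

  /-suc : ∀ a k → (+ suc a) ℚ./ suc k ≡ (+ a) ℚ./ suc k +q (+ 1) ℚ./ suc k
  /-suc a k = ℚ.toℚᵘ-injective (ℚᵘ.≃-trans (ℚ.toℚᵘ-fromℚᵘ (ℚᵘ.mkℚᵘ (+ suc a) k)) (ℚᵘ.≃-trans main
     (ℚᵘ.≃-sym (ℚᵘ.≃-trans (ℚ.toℚᵘ-homo-+ ((+ a) ℚ./ suc k) ((+ 1) ℚ./ suc k))
        (ℚᵘ.+-cong (ℚ.toℚᵘ-fromℚᵘ (ℚᵘ.mkℚᵘ (+ a) k)) (ℚ.toℚᵘ-fromℚᵘ (ℚᵘ.mkℚᵘ (+ 1) k)))))))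
    where
    nat : suc a ℕ.* (suc k ℕ.* suc k) ≡ (a ℕ.* suc k ℕ.+ 1 ℕ.* suc k) ℕ.* suc k
    nat = solve 2 (λ a k → (con 1 :+ a) :* ((con 1 :+ k) :* (con 1 :+ k))
        := (a :* (con 1 :+ k) :+ con 1 :* (con 1 :+ k)) :* (con 1 :+ k)) refl a k
      where open ℕ-Solver
    open ≡-Reasoning
    main : ℚᵘ.mkℚᵘ (+ suc a) k ℚᵘ.≃ ℚᵘ.mkℚᵘ (+ a) k ℚᵘ.+ ℚᵘ.mkℚᵘ (+ 1) k
    main = ℚᵘ.*≡* (begin
      + suc a ℤ.* + (suc k ℕ.* suc k)                    ≡⟨ ℤ.pos-* (suc a) _ ⟨
      + (suc a ℕ.* (suc k ℕ.* suc k))                    ≡⟨ cong +_ nat ⟩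
      + ((a ℕ.* suc k ℕ.+ 1 ℕ.* suc k) ℕ.* suc k)        ≡⟨ ℤ.pos-* (a ℕ.* suc k ℕ.+ 1 ℕ.* suc k) (suc k) ⟩
      + (a ℕ.* suc k ℕ.+ 1 ℕ.* suc k) ℤ.* + suc k
        ≡⟨ cong (ℤ._* + suc k) (cong₂ ℤ._+_ (ℤ.pos-* a (suc k)) (ℤ.pos-* 1 (suc k))) ⟩
      (+ a ℤ.* + suc k ℤ.+ + 1 ℤ.* + suc k) ℤ.* + suc k  ∎)

  small : ∀ ε → 0ℚ ℚ.< ε → ∃ λ N → ∀ n → N ℕ.≤ n → (+ 1) ℚ./ suc n ≲ ε
  small ε 0<ε = ℚ.↧ₙ ε , λ n h → subst (_ ≲_) (ℚ.↥p/↧p≡p ε) (go ε (ℚ.positive 0<ε) n h)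
    where
    go : ∀ ε → ℚ.Positive ε → ∀ n → ℚ.↧ₙ ε ℕ.≤ n → (+ 1) ℚ./ suc n ≲ (ℚ.↥ ε) ℚ./ ℚ.↧ₙ ε
    go (ℚ.mkℚ (+ suc i) d _) _ n h = /-mono 1 (suc i) n d
      (ℕ.≤-trans (ℕ.≤-reflexive (ℕ.*-identityˡ (suc d)))
        (ℕ.≤-trans (ℕ.m≤n⇒m≤1+n h) (ℕ.m≤m+n (suc n) (i ℕ.* suc n))))

  square-cancel : ∀ {a b} → a ℕ.* a ℕ.≤ b ℕ.* b → a ℕ.≤ b
  square-cancel {a} {b} h with a ℕ.≤? b
  ... | yes p = p
  ... | no  p = contradiction h (ℕ.<⇒≱ (ℕ.*-mono-< (ℕ.≰⇒> p) (ℕ.≰⇒> p)))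

√-seq : ℕ → ℕ → ℚ
√-seq n k = + ⌊√ n ℕ.* (suc k ℕ.* suc k) ⌋ ℚ./ suc k

private
  √-step : ∀ n j k → √-seq n j ≲ √-seq n k +q (+ 1) ℚ./ suc k
  √-step n j k = subst (√-seq n j ≲_) (/-suc rk k) (/-mono rj (suc rk) j k (square-cancel sq))
    where
    rj = ⌊√ n ℕ.* (suc j ℕ.* suc j) ⌋
    rk = ⌊√ n ℕ.* (suc k ℕ.* suc k) ⌋
    sq₁ : ∀ a b → (a ℕ.* suc b) ℕ.* (a ℕ.* suc b) ≡ (a ℕ.* a) ℕ.* (suc b ℕ.* suc b)
    sq₁ = solve 2 (λ a b → (a :* (con 1 :+ b)) :* (a :* (con 1 :+ b))
        := (a :* a) :* ((con 1 :+ b) :* (con 1 :+ b))) refl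
      where open ℕ-Solver
    swap : ∀ n a b → (n ℕ.* (a ℕ.* a)) ℕ.* (b ℕ.* b) ≡ (n ℕ.* (b ℕ.* b)) ℕ.* (a ℕ.* a)
    swap = solve 3 (λ n a b → (n :* (a :* a)) :* (b :* b) := (n :* (b :* b)) :* (a :* a)) refl
      where open ℕ-Solver
    open ℕ.≤-Reasoning
    sq : (rj ℕ.* suc k) ℕ.* (rj ℕ.* suc k) ℕ.≤ (suc rk ℕ.* suc j) ℕ.* (suc rk ℕ.* suc j)
    sq = begin
      (rj ℕ.* suc k) ℕ.* (rj ℕ.* suc k)                ≡⟨ sq₁ rj k ⟩
      (rj ℕ.* rj) ℕ.* (suc k ℕ.* suc k)                ≤⟨ ℕ.*-monoˡ-≤ (suc k ℕ.* suc k) (proj₁ (⌊√⌋-spec (n ℕ.* (suc j ℕ.* suc j)))) ⟩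
      (n ℕ.* (suc j ℕ.* suc j)) ℕ.* (suc k ℕ.* suc k)  ≡⟨ swap n (suc j) (suc k) ⟩
      (n ℕ.* (suc k ℕ.* suc k)) ℕ.* (suc j ℕ.* suc j)  ≤⟨ ℕ.*-monoˡ-≤ (suc j ℕ.* suc j) (ℕ.<⇒≤ (proj₂ (⌊√⌋-spec (n ℕ.* (suc k ℕ.* suc k))))) ⟩
      (suc rk ℕ.* suc rk) ℕ.* (suc j ℕ.* suc j)        ≡⟨ sq₁ (suc rk) j ⟨
      (suc rk ℕ.* suc j) ℕ.* (suc rk ℕ.* suc j)        ∎

  √-cauchy : ∀ n → IsCauchy (√-seq n)
  √-cauchy n ε 0<ε with small ε 0<ε
  ... | N , f = N , λ j k p q → dist-lub
    (ℚ.≤-trans (√-step n j k) (ℚ.+-monoʳ-≤ (√-seq n k) (f k q)))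
    (ℚ.≤-trans (√-step n k j) (ℚ.+-monoʳ-≤ (√-seq n j) (f j p)))

-- ⌊√(n (k+1)²)⌋ / (k+1) approximates √n from below within 1/(k+1).
infix 9 √_
√_ : ℕ → ℝ
√ n = mkℝ (√-seq n) (√-cauchy n)

expTerm : ℕ → ℚ → ℚ
expTerm k q = q ^ k ℚ.* (+ 1 ℚ./ (k !)) {{k ℕ.!≢0}}

expSum : ℕ → ℚ → ℚ
expSum zero    q = 0ℚ
expSum (suc k) q = expSum k q ℚ.+ expTerm k q

private
  inv : ℕ → ℚ
  inv k = (+ 1) ℚ./ suc k

  inv! : ∀ k → ((+ 1) ℚ./ (suc k !)) {{suc k ℕ.!≢0}} ≡ ((+ 1) ℚ./ (k !)) {{k ℕ.!≢0}} *q inv k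
  inv! k = go (k !) {{k ℕ.!≢0}} {{suc k ℕ.!≢0}}
    where
    go : ∀ f .{{_ : ℕ.NonZero f}} .{{_ : ℕ.NonZero (suc k ℕ.* f)}} →
      (+ 1) ℚ./ (suc k ℕ.* f) ≡ ((+ 1) ℚ./ f) *q inv k
    go (suc f) = ℚ.toℚᵘ-injective (ℚᵘ.≃-trans (ℚ.toℚᵘ-fromℚᵘ (ℚᵘ.mkℚᵘ (+ 1) (f ℕ.+ k ℕ.* suc f)))
       (ℚᵘ.≃-trans (ℚᵘ.*≡* (cong (λ z → + 1 ℤ.* + z) (ℕ.*-comm (suc f) (suc k))))
       (ℚᵘ.≃-sym (ℚᵘ.≃-trans (ℚ.toℚᵘ-homo-* ((+ 1) ℚ./ suc f) (inv k))
         (ℚᵘ.*-cong (ℚ.toℚᵘ-fromℚᵘ (ℚᵘ.mkℚᵘ (+ 1) f)) (ℚ.toℚᵘ-fromℚᵘ (ℚᵘ.mkℚᵘ (+ 1) k)))))))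

  term-suc : ∀ k q → expTerm (suc k) q ≡ q *q expTerm k q *q inv k
  term-suc k q = trans (cong (q ^ suc k *q_) (inv! k))
    (solve 4 (λ q p i j → (q :* p) :* (i :* j) := q :* (p :* i) :* j) refl
      q (q ^ k) (((+ 1) ℚ./ (k !)) {{k ℕ.!≢0}}) (inv k))
    where open +-*-Solver

  inv≥0 : ∀ k → 0ℚ ≲ inv k
  inv≥0 k = ℚ.nonNegative⁻¹ (inv k) {{ℚ.normalize-nonNeg 1 (suc k)}}

  inv-cancel : ∀ k → ((+ suc k) ℚ./ 1) *q inv k ≡ 1ℚ
  inv-cancel k = ℚ.toℚᵘ-injective (ℚᵘ.≃-trans (ℚ.toℚᵘ-homo-* ((+ suc k) ℚ./ 1) (inv k))
    (ℚᵘ.≃-trans (ℚᵘ.*-cong (ℚ.toℚᵘ-fromℚᵘ (ℚᵘ.mkℚᵘ (+ suc k) 0)) (ℚ.toℚᵘ-fromℚᵘ (ℚᵘ.mkℚᵘ (+ 1) k)))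
      (ℚᵘ.*≡* (trans (ℤ.*-identityʳ (+ suc k ℤ.* + 1)) (trans (ℤ.*-identityʳ (+ suc k))
        (sym (trans (ℤ.*-identityˡ (+ (1 ℕ.* suc k))) (cong +_ (ℕ.*-identityˡ (suc k))))))))))

  module Bound (M : ℚ) (M≥0 : 0ℚ ≲ M) where

    τ : ℕ → ℚ
    τ k = expTerm k M

    τ≥0 : ∀ k → 0ℚ ≲ τ k
    τ≥0 zero    = ℚ.<⇒≤ 0<1
    τ≥0 (suc k) = subst (0ℚ ≲_) (sym (term-suc k M)) (*-nn (*-nn M≥0 (τ≥0 k)) (inv≥0 k))

    term-bound : ∀ k {q} → ∣ q ∣q ≲ M → ∣ expTerm k q ∣q ≲ τ k
    term-bound zero    h = ℚ.≤-refl
    term-bound (suc k) {q} h = subst₂ _≲_ (sym eq) (sym (term-suc k M))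
      (ℚ.*-monoʳ-≤-nonNeg (inv k) {{ℚ.nonNegative (inv≥0 k)}} (*-mono (ℚ.0≤∣p∣ _) M≥0 h (term-bound k h)))
      where
      eq : ∣ expTerm (suc k) q ∣q ≡ ∣ q ∣q *q ∣ expTerm k q ∣q *q inv k
      eq = trans (cong ∣_∣q (term-suc k q)) (trans (ℚ.∣p*q∣≡∣p∣*∣q∣ (q *q expTerm k q) (inv k))
        (cong₂ _*q_ (ℚ.∣p*q∣≡∣p∣*∣q∣ q (expTerm k q)) (ℚ.0≤p⇒∣p∣≡p (inv≥0 k))))

    -- τ (k - 1), with the convention τ (-1) = 0
    τ⁻ : ℕ → ℚ
    τ⁻ zero    = 0ℚ
    τ⁻ (suc k) = τ k

    kτ : ∀ k → M *q τ⁻ k ≡ ((+ k) ℚ./ 1) *q τ k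
    kτ zero    = trans (ℚ.*-zeroʳ M) (sym (ℚ.*-zeroˡ (τ 0)))
    kτ (suc k) = sym (trans (cong (K *q_) (term-suc k M))
        (trans (solve 4 (λ K M t i → K :* (M :* t :* i) := (K :* i) :* (M :* t)) refl K M (τ k) (inv k))
        (trans (cong (_*q (M *q τ k)) (inv-cancel k)) (ℚ.*-identityˡ _))))
      where
      open +-*-Solver
      K = (+ suc k) ℚ./ 1

    τ⁻≥0 : ∀ k → 0ℚ ≲ τ⁻ k
    τ⁻≥0 zero    = ℚ.≤-refl
    τ⁻≥0 (suc k) = τ≥0 k

    term-lip : ∀ k {u v} → ∣ u ∣q ≲ M → ∣ v ∣q ≲ M → dist (expTerm k u) (expTerm k v) ≲ dist u v *q τ⁻ k
    term-lip zero    {u} {v} hu hv = ℚ.≤-reflexive (sym (ℚ.*-zeroʳ (dist u v)))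
    term-lip (suc k) {u} {v} hu hv = begin
      dist (expTerm (suc k) u) (expTerm (suc k) v)
        ≡⟨ cong₂ dist (term-suc k u) (term-suc k v) ⟩
      dist (u *q α *q i) (v *q β *q i)
        ≡⟨ cong ∣_∣q (solve 3 (λ a b i → a :* i :- b :* i := (a :- b) :* i) refl (u *q α) (v *q β) i) ⟩
      ∣ (u *q α -q v *q β) *q i ∣q
        ≡⟨ trans (ℚ.∣p*q∣≡∣p∣*∣q∣ (u *q α -q v *q β) i) (cong (dist (u *q α) (v *q β) *q_) (ℚ.0≤p⇒∣p∣≡p (inv≥0 k))) ⟩
      dist (u *q α) (v *q β) *q i
        ≤⟨ mul-i (ℚ.≤-trans (dist-* u v α β) (ℚ.+-mono-≤
             (ℚ.*-monoʳ-≤-nonNeg d {{ℚ.nonNegative d≥0}} (term-bound k hu))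
             (*-mono (ℚ.0≤∣p∣ _) M≥0 hv (term-lip k hu hv)))) ⟩
      (τ k *q d +q M *q (d *q τ⁻ k)) *q i
        ≡⟨ solve 5 (λ t d M s i → (t :* d :+ M :* (d :* s)) :* i := d :* ((t :+ M :* s) :* i)) refl (τ k) d M (τ⁻ k) i ⟩
      d *q ((τ k +q M *q τ⁻ k) *q i)
        ≡⟨ cong (λ z → d *q ((τ k +q z) *q i)) (kτ k) ⟩
      d *q ((τ k +q K *q τ k) *q i)
        ≡⟨ cong (d *q_) (solve 3 (λ t K i → (t :+ K :* t) :* i := t :* ((K :+ con 1ℚ) :* i)) refl (τ k) K i) ⟩
      d *q (τ k *q ((K +q 1ℚ) *q i))
        ≡⟨ cong (λ z → d *q (τ k *q (z *q i))) (/-suc k 0) ⟨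
      d *q (τ k *q (((+ suc k) ℚ./ 1) *q i))
        ≡⟨ cong (λ z → d *q (τ k *q z)) (inv-cancel k) ⟩
      d *q (τ k *q 1ℚ)
        ≡⟨ cong (d *q_) (ℚ.*-identityʳ (τ k)) ⟩
      d *q τ k ∎
      where
      open ℚ.≤-Reasoning
      open +-*-Solver
      α = expTerm k u
      β = expTerm k v
      i = inv k
      d = dist u v
      K = (+ k) ℚ./ 1
      d≥0 : 0ℚ ≲ d
      d≥0 = ℚ.0≤∣p∣ _
      mul-i : ∀ {x y} → x ≲ y → x *q i ≲ y *q i
      mul-i = ℚ.*-monoʳ-≤-nonNeg i {{ℚ.nonNegative (inv≥0 k)}}

    Σ⁻ : ℕ → ℚ
    Σ⁻ zero    = 0ℚ
    Σ⁻ (suc k) = Σ⁻ k +q τ⁻ k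

    sum-lip : ∀ k {u v} → ∣ u ∣q ≲ M → ∣ v ∣q ≲ M → dist (expSum k u) (expSum k v) ≲ dist u v *q Σ⁻ k
    sum-lip zero    {u} {v} hu hv = ℚ.≤-reflexive (sym (ℚ.*-zeroʳ (dist u v)))
    sum-lip (suc k) {u} {v} hu hv = subst₂ _≲_
        (cong ∣_∣q (solve 4 (λ a b c d → (a :- b) :+ (c :- d) := (a :+ c) :- (b :+ d)) refl
          (expSum k u) (expSum k v) (expTerm k u) (expTerm k v)))
        (sym (ℚ.*-distribˡ-+ (dist u v) (Σ⁻ k) (τ⁻ k)))
        (ℚ.≤-trans (ℚ.∣p+q∣≤∣p∣+∣q∣ (expSum k u -q expSum k v) (expTerm k u -q expTerm k v)) (ℚ.+-mono-≤ (sum-lip k hu hv) (term-lip k hu hv)))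
      where open +-*-Solver

    -- From an index K ≥ 2M on, consecutive terms at least halve.
    module Tail (K : ℕ) (2M≤K : M +q M ≲ (+ K) ℚ./ 1) where

      halve : ∀ k → K ℕ.≤ k → τ (suc k) +q τ (suc k) ≲ τ k
      halve k h = begin
        τ (suc k) +q τ (suc k)
          ≡⟨ cong₂ _+q_ (term-suc k M) (term-suc k M) ⟩
        M *q τ k *q inv k +q M *q τ k *q inv k
          ≡⟨ solve 3 (λ M t i → M :* t :* i :+ M :* t :* i := ((M :+ M) :* i) :* t) refl M (τ k) (inv k) ⟩
        ((M +q M) *q inv k) *q τ k
          ≤⟨ ℚ.*-monoʳ-≤-nonNeg (τ k) {{ℚ.nonNegative (τ≥0 k)}}
               (ℚ.*-monoʳ-≤-nonNeg (inv k) {{ℚ.nonNegative (inv≥0 k)}}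
                 (ℚ.≤-trans 2M≤K (/-mono K (suc k) 0 0 (ℕ.*-monoˡ-≤ 1 (ℕ.m≤n⇒m≤1+n h))))) ⟩
        (((+ suc k) ℚ./ 1) *q inv k) *q τ k
          ≡⟨ trans (cong (_*q τ k) (inv-cancel k)) (ℚ.*-identityˡ (τ k)) ⟩
        τ k ∎
        where
        open ℚ.≤-Reasoning
        open +-*-Solver

      tail : ∀ k n {u} → K ℕ.≤ k → ∣ u ∣q ≲ M →
        dist (expSum (n ℕ.+ k) u) (expSum k u) +q (τ (n ℕ.+ k) +q τ (n ℕ.+ k)) ≲ τ k +q τ k
      tail k zero {u} hk hu = ℚ.≤-reflexive
        (trans (cong (_+q (τ k +q τ k)) (cong ∣_∣q (ℚ.+-inverseʳ (expSum k u)))) (ℚ.+-identityˡ _))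
      tail k (suc n) {u} hk hu = begin
        dist (s +q e) s₀ +q (t′ +q t′)
          ≤⟨ ℚ.+-monoˡ-≤ (t′ +q t′) (ℚ.≤-trans
               (subst (λ z → ∣ z ∣q ≲ dist s s₀ +q ∣ e ∣q)
                 (solve 3 (λ s e z → (s :- z) :+ e := (s :+ e) :- z) refl s e s₀)
                 (ℚ.∣p+q∣≤∣p∣+∣q∣ (s -q s₀) e))
               (ℚ.+-monoʳ-≤ (dist s s₀) (term-bound (n ℕ.+ k) hu))) ⟩
        dist s s₀ +q t +q (t′ +q t′)
          ≤⟨ ℚ.+-monoʳ-≤ (dist s s₀ +q t) (halve (n ℕ.+ k) (ℕ.≤-trans hk (ℕ.m≤n+m k n))) ⟩
        dist s s₀ +q t +q t
          ≡⟨ ℚ.+-assoc (dist s s₀) t t ⟩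
        dist s s₀ +q (t +q t)
          ≤⟨ tail k n hk hu ⟩
        τ k +q τ k ∎
        where
        open ℚ.≤-Reasoning
        open +-*-Solver
        s = expSum (n ℕ.+ k) u
        s₀ = expSum k u
        e = expTerm (n ℕ.+ k) u
        t = τ (n ℕ.+ k)
        t′ = τ (suc n ℕ.+ k)

      tail′ : ∀ k n {u} → K ℕ.≤ k → k ℕ.≤ n → ∣ u ∣q ≲ M → dist (expSum n u) (expSum k u) ≲ τ k +q τ k
      tail′ k n {u} hk hkn hu = subst (λ z → dist (expSum z u) (expSum k u) ≲ τ k +q τ k) (ℕ.m∸n+n≡m hkn)
        (ℚ.≤-trans (subst (_≲ D +q (T +q T)) (ℚ.+-identityʳ D) (ℚ.+-monoʳ-≤ D (+-nn (τ≥0 (n ℕ.∸ k ℕ.+ k)) (τ≥0 (n ℕ.∸ k ℕ.+ k)))))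
          (tail k (n ℕ.∸ k) hk hu))
        where
        D = dist (expSum (n ℕ.∸ k ℕ.+ k) u) (expSum k u)
        T = τ (n ℕ.∸ k ℕ.+ k)

      decay : ∀ j → ((+ suc j) ℚ./ 1) *q τ (j ℕ.+ K) ≲ τ K
      decay zero    = ℚ.≤-reflexive (ℚ.*-identityˡ (τ K))
      decay (suc j) = begin
        ((+ suc (suc j)) ℚ./ 1) *q t′
          ≤⟨ ℚ.*-monoʳ-≤-nonNeg t′ {{ℚ.nonNegative (τ≥0 (suc j ℕ.+ K))}}
               (subst (((+ suc (suc j)) ℚ./ 1) ≲_) (double (suc j))
                 (/-mono (suc (suc j)) (suc j ℕ.+ suc j) 0 0 (ℕ.*-monoˡ-≤ 1 (s≤s (ℕ.m≤n+m (suc j) j))))) ⟩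
        (J +q J) *q t′
          ≡⟨ solve 2 (λ J t → (J :+ J) :* t := J :* (t :+ t)) refl J t′ ⟩
        J *q (t′ +q t′)
          ≤⟨ ℚ.*-monoˡ-≤-nonNeg J {{ℚ.normalize-nonNeg (suc j) 1}} (halve (j ℕ.+ K) (ℕ.m≤n+m K j)) ⟩
        J *q τ (j ℕ.+ K)
          ≤⟨ decay j ⟩
        τ K ∎
        where
        open ℚ.≤-Reasoning
        open +-*-Solver
        J = (+ suc j) ℚ./ 1
        t′ = τ (suc j ℕ.+ K)
        double : ∀ a → (+ (a ℕ.+ a)) ℚ./ 1 ≡ ((+ a) ℚ./ 1) +q ((+ a) ℚ./ 1)
        double a = go a a
          where
          go : ∀ a b → (+ (a ℕ.+ b)) ℚ./ 1 ≡ ((+ a) ℚ./ 1) +q ((+ b) ℚ./ 1)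
          go zero    b = sym (ℚ.+-identityˡ _)
          go (suc a) b = trans (/-suc (a ℕ.+ b) 0) (trans (cong (_+q 1ℚ) (go a b))
            (trans (solve 3 (λ x y z → (x :+ y) :+ z := (x :+ z) :+ y) refl ((+ a) ℚ./ 1) ((+ b) ℚ./ 1) 1ℚ)
              (cong (_+q ((+ b) ℚ./ 1)) (sym (/-suc a 0)))))

      τ-small : ∀ ε → 0ℚ ℚ.< ε → ∃ λ k → K ℕ.≤ k × τ k ≲ ε
      τ-small ε 0<ε = let δ , 0<δ , h = shrink (τ K) ε 0<ε
                          j , f       = small δ 0<δ
        in j ℕ.+ K , ℕ.m≤n+m K j , (begin
        τ (j ℕ.+ K)                                  ≡⟨ ℚ.*-identityˡ _ ⟨
        1ℚ *q τ (j ℕ.+ K)                            ≡⟨ cong (_*q τ (j ℕ.+ K)) (inv-cancel j) ⟨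
        (((+ suc j) ℚ./ 1) *q inv j) *q τ (j ℕ.+ K)  ≡⟨ solve 3 (λ a b c → (a :* b) :* c := (a :* c) :* b) refl ((+ suc j) ℚ./ 1) (inv j) (τ (j ℕ.+ K)) ⟩
        (((+ suc j) ℚ./ 1) *q τ (j ℕ.+ K)) *q inv j  ≤⟨ *-mono (inv≥0 j) (τ≥0 K) (decay j) (f j ℕ.≤-refl) ⟩
        τ K *q δ                                     ≤⟨ h ⟩
        ε                                            ∎)
        where
        open ℚ.≤-Reasoning
        open +-*-Solver

  ceil : ∀ q → ∃ λ K → q ≲ (+ K) ℚ./ 1
  ceil q = ℤ.∣ ℚ.↥ q ∣ , go q
    where
    go : ∀ q → q ≲ (+ ℤ.∣ ℚ.↥ q ∣) ℚ./ 1
    go q@(ℚ.mkℚ i d c) = ℚ.≤-trans (≤∣∣ q) (subst (_≲ ((+ ℤ.∣ i ∣) ℚ./ 1)) (ℚ.↥p/↧p≡p ∣ q ∣q)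
      (/-mono ℤ.∣ i ∣ ℤ.∣ i ∣ d 0 (ℕ.*-monoʳ-≤ ℤ.∣ i ∣ (s≤s z≤n))))

  exp-cauchy : ∀ {x} → IsCauchy x → IsCauchy (λ n → expSum n (x n))
  exp-cauchy {x} cx ε 0<ε =
    let M , M≥0 , B , bd = bounded {x} cx
        K , 2M≤K         = ceil (M +q M)
        k , K≤k , τk     = Bound.Tail.τ-small M M≥0 K 2M≤K (ε *q ½ *q ½ *q ½) (*-pos (*-pos (*-pos 0<ε 0<½) 0<½) 0<½)
        δ , 0<δ , h      = shrink (Bound.Σ⁻ M M≥0 k) (ε *q ½) (*-pos 0<ε 0<½)
        N , f            = cx δ 0<δ
    in B ℕ.⊔ (k ℕ.⊔ N) , λ m n p q →
         estimate M M≥0 K 2M≤K k K≤k τk δ h m n (max-l {k} {N} (max-r {B} {k ℕ.⊔ N} p)) (max-l {k} {N} (max-r {B} {k ℕ.⊔ N} q))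
           (bd m (max-l {B} {k ℕ.⊔ N} p)) (bd n (max-l {B} {k ℕ.⊔ N} q)) (f m n (max-r {k} {N} (max-r {B} {k ℕ.⊔ N} p)) (max-r {k} {N} (max-r {B} {k ℕ.⊔ N} q)))
    where
    module _ (M : ℚ) (M≥0 : 0ℚ ≲ M) (K : ℕ) (2M≤K : M +q M ≲ (+ K) ℚ./ 1) where
      open Bound M M≥0
      open Tail K 2M≤K
      open ℚ.≤-Reasoning
      open +-*-Solver

      Σ⁻≥0 : ∀ k → 0ℚ ≲ Σ⁻ k
      Σ⁻≥0 zero    = ℚ.≤-refl
      Σ⁻≥0 (suc k) = +-nn (Σ⁻≥0 k) (τ⁻≥0 k)

      ε₁ ε₂ ε₃ : ℚ
      ε₁ = ε *q ½
      ε₂ = ε₁ *q ½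
      ε₃ = ε₂ *q ½

      estimate : ∀ k → K ℕ.≤ k → τ k ≲ ε₃ → ∀ δ → Σ⁻ k *q δ ≲ ε₁ → ∀ m n → k ℕ.≤ m → k ℕ.≤ n →
        ∣ x m ∣q ≲ M → ∣ x n ∣q ≲ M → dist (x m) (x n) ≲ δ → dist (expSum m (x m)) (expSum n (x n)) ≲ ε
      estimate k K≤k τk δ h m n k≤m k≤n bm bn d = begin
        dist (expSum m (x m)) (expSum n (x n))
          ≤⟨ triangle (expSum m (x m)) (expSum k (x m)) (expSum n (x n)) ⟩
        dist (expSum m (x m)) (expSum k (x m)) +q dist (expSum k (x m)) (expSum n (x n))
          ≤⟨ ℚ.+-mono-≤ (tl m k≤m bm)
               (ℚ.≤-trans (triangle (expSum k (x m)) (expSum k (x n)) (expSum n (x n)))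
                 (ℚ.+-mono-≤ mid (subst (_≲ (ε₃ +q ε₃)) (dist-sym (expSum n (x n)) (expSum k (x n))) (tl n k≤n bn)))) ⟩
        (ε₃ +q ε₃) +q (ε₁ +q (ε₃ +q ε₃))
          ≡⟨ cong (λ z → z +q (ε₁ +q z)) (half+half ε₂) ⟩
        ε₂ +q (ε₁ +q ε₂)
          ≡⟨ solve 2 (λ a b → a :+ (b :+ a) := (a :+ a) :+ b) refl ε₂ ε₁ ⟩
        (ε₂ +q ε₂) +q ε₁
          ≡⟨ cong (_+q ε₁) (half+half ε₁) ⟩
        ε₁ +q ε₁
          ≡⟨ half+half ε ⟩
        ε ∎
        where
        tl : ∀ m {u} → k ℕ.≤ m → ∣ u ∣q ≲ M → dist (expSum m u) (expSum k u) ≲ ε₃ +q ε₃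
        tl m k≤m hu = ℚ.≤-trans (tail′ k m K≤k k≤m hu) (ℚ.+-mono-≤ τk τk)
        mid : dist (expSum k (x m)) (expSum k (x n)) ≲ ε₁
        mid = ℚ.≤-trans (sum-lip k bm bn) (ℚ.≤-trans
          (ℚ.*-monoʳ-≤-nonNeg (Σ⁻ k) {{ℚ.nonNegative (Σ⁻≥0 k)}} d)
          (subst (_≲ ε₁) (ℚ.*-comm (Σ⁻ k) δ) h))

-- The n-th approximation truncates Σ qᵏ/k! after n terms and evaluates it
-- at the n-th approximation of the argument.
exp : ℝ → ℝ
exp x = mkℝ (λ n → expSum n (seq x n)) (exp-cauchy {seq x} (cauchy x))

allVecs : List A → ∀ n → List (Vec A n)
allVecs xs zero    = [] ∷ []
allVecs xs (suc n) = cartesianProductWith _∷_ xs (allVecs xs n)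

∈-allVecs : ∀ {xs : List A} → (∀ x → x ∈ xs) → ∀ {n} (v : Vec A n) → v ∈ allVecs xs n
∈-allVecs h []      = here refl
∈-allVecs h (x ∷ v) = ∈-cartesianProductWith⁺ _∷_ (h x) (∈-allVecs h v)

allVecs-unique : ∀ {xs : List A} → Unique xs → ∀ n → Unique (allVecs xs n)
allVecs-unique u zero    = ListAll.[] ListPairs.∷ ListPairs.[]
allVecs-unique u (suc n) = Uniqueₚ.cartesianProductWith⁺ _∷_ ∷-injective u (allVecs-unique u n)

subsets : ∀ m → List (Subset m)
subsets = allVecs (outside ∷ inside ∷ [])

∈-subsets : ∀ {m} (s : Subset m) → s ∈ subsets m
∈-subsets = ∈-allVecs λ { outside → here refl ; inside → there (here refl) }

subsets-unique : ∀ m → Unique (subsets m)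
subsets-unique = allVecs-unique
  (((λ ()) ListAll.∷ ListAll.[]) ListPairs.∷ ListAll.[] ListPairs.∷ ListPairs.[])

Disjoint : ∀ {m} → Subset m → Subset m → Set
Disjoint s u = Empty (s ∩ u)

IsMatching : ∀ {m t} → ℕ → Vec (Subset m) t → Set
IsMatching l B = All (λ s → ∣ s ∣ ≡ l) B × AllPairs Disjoint B

isMatching? : ∀ {m t} l → Decidable (IsMatching {m} {t} l)
isMatching? l B = VecAll.all? (λ s → ∣ s ∣ ℕ.≟ l) B
            ×-dec VecPairs.allPairs? (λ s u → ¬? (nonempty? (s ∩ u))) B

-- All (ordered) t-tuples of pairwise disjoint l-element subsets of Fin m.
matchings : ∀ m l t → List (Vec (Subset m) t)
matchings m l t = filter (isMatching? l) (allVecs (subsets m) t)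

∈-matchings⁺ : ∀ {m l t} {B : Vec (Subset m) t} → IsMatching l B → B ∈ matchings m l t
∈-matchings⁺ {l = l} {B = B} = ∈-filter⁺ (isMatching? l) (∈-allVecs ∈-subsets B)

∈-matchings⁻ : ∀ {m l t} {B : Vec (Subset m) t} → B ∈ matchings m l t → IsMatching l B
∈-matchings⁻ {m} {l} {t} B∈ = proj₂ (∈-filter⁻ (isMatching? l) {xs = allVecs (subsets m) t} B∈)

matchings-unique : ∀ m l t → Unique (matchings m l t)
matchings-unique m l t = Uniqueₚ.filter⁺ (isMatching? l) (allVecs-unique (subsets-unique m) t)

-- Ω enumerates the sample space without repetition.
ℙ : (Ω : List A) .{{_ : ℕ.NonZero (length Ω)}} {E : Pred A p} → Decidable E → ℚ
ℙ Ω E? = + length (filter E? Ω) ℚ./ length Ω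

-- The probability of E is at most r.  Membership in an event defined by an
-- inequality between reals need not be decidable, so that its outcomes
-- cannot be counted directly; the bound is required of every decidable
-- event contained in E, and of E itself if that is decidable.
infix 4 ℙ≤
ℙ≤ : {A : Set a} (Ω : List A) .{{_ : ℕ.NonZero (length Ω)}} → Pred A 0ℓ → ℝ → Set (a ⊔ ℓ.suc 0ℓ)
ℙ≤ {A = A} Ω E r = {D : Pred A 0ℓ} (D? : Decidable D) → D ⊆ E → fromℚ (ℙ Ω D?) ≤ᴿ r

syntax ℙ≤ Ω E r = ℙ[ E ∣ Ω ]≤ r

private
  filter-mono : {D E : Pred A 0ℓ} (D? : Decidable D) (E? : Decidable E) → D ⊆ E →
    ∀ xs → length (filter D? xs) ℕ.≤ length (filter E? xs)
  filter-mono D? E? D⊆E [] = z≤n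
  filter-mono D? E? D⊆E (x ∷ xs) with D? x | E? x
  ... | yes d | yes e = s≤s (filter-mono D? E? D⊆E xs)
  ... | yes d | no ¬e = contradiction (D⊆E d) ¬e
  ... | no ¬d | yes e = ℕ.m≤n⇒m≤1+n (filter-mono D? E? D⊆E xs)
  ... | no ¬d | no ¬e = filter-mono D? E? D⊆E xs

  /-monoˡ : ∀ {a b} n .{{_ : ℕ.NonZero n}} → a ℕ.≤ b → (+ a) ℚ./ n ≲ (+ b) ℚ./ n
  /-monoˡ {a} {b} (suc n) h = /-mono a b n n (ℕ.*-monoˡ-≤ (suc n) h)

-- For a decidable event ℙ≤ is the bound on its probability.
ℙ≤⁺ : {A : Set a} (Ω : List A) .{{_ : ℕ.NonZero (length Ω)}} {E : Pred A 0ℓ} (E? : Decidable E) {r : ℝ} →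
      fromℚ (ℙ Ω E?) ≤ᴿ r → ℙ≤ Ω E r
ℙ≤⁺ Ω E? h D? D⊆E ε 0<ε = let N , f = h ε 0<ε in
  N , λ n N≤n → ℚ.≤-trans (/-monoˡ (length Ω) (filter-mono D? E? D⊆E Ω)) (f n N≤n)

ℙ≤⁻ : {A : Set a} (Ω : List A) .{{_ : ℕ.NonZero (length Ω)}} {E : Pred A 0ℓ} (E? : Decidable E) {r : ℝ} →
      ℙ≤ Ω E r → fromℚ (ℙ Ω E?) ≤ᴿ r
ℙ≤⁻ Ω E? h = h E? (λ e → e)

density : ∀ {m} l .{{_ : ℕ.NonZero (m C l)}} {𝒢 : Pred (Subset m) p} → Decidable 𝒢 → ℚ
density {m = m} l 𝒢? = + length (filter 𝒢? (subsets m)) ℚ./ (m C l)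

-- For l > 0 the entries of a matching are distinct, so counting positions
-- is the same as counting the members of 𝒢 ∩ B.
hits : ∀ {m t} {𝒢 : Pred (Subset m) p} → Decidable 𝒢 → Vec (Subset m) t → ℕ
hits 𝒢? B = count 𝒢? B

binomial-nonZero : ∀ {m l t} .{{_ : ℕ.NonZero t}} → t ℕ.* l ℕ.≤ m → ℕ.NonZero (m C l)
binomial-nonZero {m} {l} {t} tl≤m = subst ℕ.NonZero (sym (nCk≡n!/k![n-k]! l≤m))
    (ℕ.>-nonZero (ℕ.m≥n⇒m/n>0 (ℕ.∣⇒≤ {{m ℕ.!≢0}} (k![n∸k]!∣n! l≤m))))
  where
  instance _ = l ℕ.!* (m ℕ.∸ l) !≢0
  l≤m : l ℕ.≤ m
  l≤m = ℕ.≤-trans (ℕ.m≤n*m l t) tl≤m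

private
  first : ∀ l {m} → Subset (l ℕ.+ m)
  first zero    = ⊥
  first (suc l) = inside ∷ first l

  shift : ∀ l {m} → Subset m → Subset (l ℕ.+ m)
  shift zero    s = s
  shift (suc l) s = outside ∷ shift l s

  ∣first∣ : ∀ l {m} → ∣ first l {m} ∣ ≡ l
  ∣first∣ zero {m} = ∣⊥∣≡0 m
  ∣first∣ (suc l)  = cong suc (∣first∣ l)

  ∣shift∣ : ∀ l {m} (s : Subset m) → ∣ shift l s ∣ ≡ ∣ s ∣
  ∣shift∣ zero    s = refl
  ∣shift∣ (suc l) s = ∣shift∣ l s

  empty-∷ : ∀ {m} {s : Subset m} → Empty s → Empty (outside ∷ s)
  empty-∷ h (_ , Vec.there x∈s) = h (_ , x∈s)

  first-shift : ∀ l {m} (s : Subset m) → Disjoint (first l) (shift l s)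
  first-shift zero    s (_ , x∈) = ∉⊥ (proj₁ (x∈p∩q⁻ ⊥ s x∈))
  first-shift (suc l) s          = empty-∷ (first-shift l s)

  shift-shift : ∀ l {m} {s u : Subset m} → Disjoint s u → Disjoint (shift l s) (shift l u)
  shift-shift zero    h = h
  shift-shift (suc l) h = empty-∷ (shift-shift l h)

  matching : ∀ l t r → ∃ λ (B : Vec (Subset (t ℕ.* l ℕ.+ r)) t) → IsMatching l B
  matching l zero    r = [] , [] , []
  matching l (suc t) r with matching l t r
  ... | B , sizes , disj = subst (λ n → ∃ λ (B : Vec (Subset n) (suc t)) → IsMatching l B)
    (sym (ℕ.+-assoc l (t ℕ.* l) r))
    ( first l ∷ Vec.map (shift l) B
    , ∣first∣ l ∷ VecAllₚ.map⁺ (VecAll.map (λ {s} → trans (∣shift∣ l s)) sizes)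
    , VecAllₚ.map⁺ (VecAll.universal (first-shift l) B) ∷ VecPairsₚ.map⁺ (VecPairs.map (shift-shift l) disj))

matchings-nonZero : ∀ {m l t} → t ℕ.* l ℕ.≤ m → ℕ.NonZero (length (matchings m l t))
matchings-nonZero {m} {l} {t} tl≤m = ℕ.>-nonZero (∈-length (∈-matchings⁺ (proj₂
  (subst (λ n → ∃ λ (B : Vec (Subset n) t) → IsMatching l B) (ℕ.m+[n∸m]≡n tl≤m) (matching l t (m ℕ.∸ t ℕ.* l))))))

module Submission where

-- Fix 0 ≤ μ ≤ 1/4 and write α(R) for the density of 𝒢 among the l-subsets of R.
-- For n disjoint l-subsets of a ground set R with |R| ≥ n l,
--   E ∏ᵢ (1 + μ [Bᵢ ∈ 𝒢]) ≤ (1 + μ α(R))ⁿ (1 + μ²)ⁿ;                     (∗)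
-- with μ = s / 4t Markov's inequality turns this into the one-sided bound
-- exp(−s² / 8t), and the lower tail is the upper tail of the complement of 𝒢.
-- To prove (∗) by induction on n, one exposes B₁ and needs
--   E (1 + μ [B₁ ∈ 𝒢]) (1 + μ α(R ─ B₁))ⁿ⁻¹ ≤ (1 + μ α(R))ⁿ (1 + μ²).
-- The density α(R ─ B₁) may drop drastically for an exceptional B₁, so that
-- bounded differences are of no use.  Instead the elements of B₁ are removed one
-- at a time.  When a single x is removed, α changes by at most l / |R| upwards,
-- and the changes d(x) satisfy Σ d(x)² ≤ l r / 4(r−l)(r−1) with r = |R|: this is
-- the weight of 𝒢 on the first eigenspace of the Johnson scheme.  Hence removing
-- all of B₁ multiplies the mean of (1 + μ α)²ⁿ by at most 1 + 7μ²/4, and the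
-- inequality between arithmetic and geometric means separates the two factors.

open import Defs
open import Data.Fin.Subset using (Subset; ∣_∣; inside; outside; ⊥; ⊤; _─_; _⊆_; _∈_; _∉_)
open import Data.Fin.Subset.Properties using (_⊆?_; ⊆⊤; s⊆s; drop-∷-⊆; out⊆; ∣⊤∣≡n; p─q⊆p; x∈p∧x∉q⇒x∈p─q; x∈p∩q⁺; x∈p∩q⁻)
open import Data.Bool.Base using (if_then_else_)
open import Data.Integer.Base as ℤ using () renaming (+_ to pos)
import Data.Integer.Properties as ℤ
open import Data.List.Base using (List; []; _∷_; _++_; map; length; filter; cartesianProductWith)
open import Data.List.Properties using (filter-none)
import Data.List.Membership.Propositional as List
open import Data.List.Relation.Unary.Any using (here; there)
import Data.List.Relation.Unary.All as ListAll
open import Data.Nat.Base as ℕ using (ℕ; zero; suc; NonZero; _*_; _≤_; _!)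
import Data.Nat.Combinatorics as ℕ
import Data.Nat.Properties as ℕ
open import Data.Nat.Solver using () renaming (module +-*-Solver to ℕ-Solver)
open import Data.Product.Base using (∃; _×_; _,_; proj₁; proj₂)
open import Data.Rational.Base as ℚ using (ℚ; 0ℚ; 1ℚ; ½; _+_; _-_; -_; _<_; _/_; 1/_; positive; nonNegative) renaming (_*_ to infixl 7 _·_; _≤_ to infix 4 _≲_)
import Data.Rational.Properties as ℚ
open import Data.Rational.Solver using (module +-*-Solver)
import Data.Rational.Unnormalised.Base as ℚᵘ
import Data.Rational.Unnormalised.Properties as ℚᵘ
open import Algebra.Definitions.RawSemiring ℚ.+-*-rawSemiring using (_^_)
open import Data.Sum.Base using (_⊎_; inj₁; inj₂)
open import Data.Vec.Base using (Vec; []; _∷_; count; here; there)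
open import Data.Vec.Relation.Unary.All as All using (All; []; _∷_)
open import Data.Vec.Relation.Unary.AllPairs using ([]; _∷_)
open import Level using (0ℓ)
open import Relation.Binary.PropositionalEquality hiding (J)
open import Relation.Nullary using (Dec; does; yes; no; ¬_; ¬?; contradiction; _×-dec_)
open import Relation.Unary using (Pred; Decidable)

open +-*-Solver using (solve; con; _:=_; _:+_; _:*_; _:-_; :-_)

-- The factor 1 + μ² in (∗) is a budget that the two sides of the arithmetic-geometric inequality
-- fill exactly: the squares of the weights 1 + μ [B ∈ 𝒢] contribute μ²/4, the powers of the density
-- 7μ²/4, and half the sum is μ². Weights 1 + μ f in place of e^(μ f) keep every moment polynomial,
-- so that (∗) is an inequality between rationals, stated with sums and counts instead of
-- expectations. The exponential enters through its partial sums, for all truncations at once, and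
-- real numbers only at the very end. The obstacle there is that the threshold 2β√t is real and
-- cannot be used in a rational argument. It is replaced by the least deviation s among the finitely
-- many outcomes of a decidable event D inside the given one: s is rational, it is at most t (hence
-- μ ≤ 1/4), and on D the deviation is at least s. As s is attained in D, 2β√t ≤ s, and so β²/2 ≤
-- s²/8t.

private
  variable
    m : ℕ

-- Rational arithmetic

-- Polynomial inequalities are proved by certificate: `z` is the explicit surplus, visibly
-- nonnegative through `_⊕_` and `_⊛_`, and the remaining identity is left to the ring solver.
≤-by : ∀ {x y} z → 0ℚ ≲ z → y ≡ x + z → x ≲ y
≤-by {x} z 0≤z refl = subst (_≲ x + z) (ℚ.+-identityʳ x) (ℚ.+-monoʳ-≤ x 0≤z)

x≤y⇒0≤y-x : ∀ {x y} → x ≲ y → 0ℚ ≲ y - x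
x≤y⇒0≤y-x {x} {y} x≤y = subst (_≲ y - x) (ℚ.+-inverseʳ x) (ℚ.+-monoˡ-≤ (- x) x≤y)

0≤y-x⇒x≤y : ∀ {x y} → 0ℚ ≲ y - x → x ≲ y
0≤y-x⇒x≤y {x} {y} h = ≤-by (y - x) h (solve 2 (λ x y → y := x :+ (y :- x)) refl x y)

infixl 6 _⊕_
infixl 7 _⊛_

_⊕_ : ∀ {x y} → 0ℚ ≲ x → 0ℚ ≲ y → 0ℚ ≲ x + y
_⊕_ = ℚ.+-mono-≤

_⊛_ : ∀ {x y} → 0ℚ ≲ x → 0ℚ ≲ y → 0ℚ ≲ x · y
_⊛_ {x} {y} h k = ℚ.nonNegative⁻¹ (x · y) {{ℚ.nonNeg*nonNeg⇒nonNeg x {{nonNegative h}} y {{nonNegative k}}}}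

*-pos : ∀ {x y} → 0ℚ < x → 0ℚ < y → 0ℚ < x · y
*-pos {x} {y} h k = ℚ.positive⁻¹ (x · y) {{ℚ.pos*pos⇒pos x {{positive h}} y {{positive k}}}}

*-monoʳ : ∀ {x y} z → 0ℚ ≲ z → x ≲ y → x · z ≲ y · z
*-monoʳ z 0≤z = ℚ.*-monoʳ-≤-nonNeg z {{nonNegative 0≤z}}

*-monoˡ : ∀ {x y} z → 0ℚ ≲ z → x ≲ y → z · x ≲ z · y
*-monoˡ z 0≤z = ℚ.*-monoˡ-≤-nonNeg z {{nonNegative 0≤z}}

*-mono : ∀ {x y u v} → 0ℚ ≲ u → 0ℚ ≲ y → x ≲ y → u ≲ v → x · u ≲ y · v
*-mono {x} {y} {u} {v} 0≤u 0≤y x≤y u≤v = ℚ.≤-trans (*-monoʳ u 0≤u x≤y) (*-monoˡ y 0≤y u≤v)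

*-cancelˡ : ∀ {x y} z → 0ℚ < z → z · x ≲ z · y → x ≲ y
*-cancelˡ z 0<z = ℚ.*-cancelˡ-≤-pos z {{positive 0<z}}

0≤sq : ∀ x → 0ℚ ≲ x · x
0≤sq x with ℚ.≤-total 0ℚ x
... | inj₁ h = h ⊛ h
... | inj₂ h = subst (0ℚ ≲_) (solve 1 (λ x → (:- x) :* (:- x) := x :* x) refl x)
                 (ℚ.neg-antimono-≤ h ⊛ ℚ.neg-antimono-≤ h)

x≤∣x∣ : ∀ x → x ≲ ℚ.∣ x ∣
x≤∣x∣ x with ℚ.≤-total 0ℚ x
... | inj₁ h = ℚ.≤-reflexive (sym (ℚ.0≤p⇒∣p∣≡p h))
... | inj₂ h = ℚ.≤-trans h (ℚ.0≤∣p∣ x)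

0<1 : 0ℚ < 1ℚ
0<1 = ℚ.positive⁻¹ 1ℚ

0≤1 : 0ℚ ≲ 1ℚ
0≤1 = ℚ.<⇒≤ 0<1

0≤½ : 0ℚ ≲ ½
0≤½ = ℚ.nonNegative⁻¹ ½

opaque
  -- Opaque, so that sizes and counts enter polynomial identities as atoms; even `ι 0` and `ι 1` are
  -- evaluated only through `ι≡/1`.
  ι : ℕ → ℚ
  ι n = pos n / 1

  ι≡/1 : ∀ n → ι n ≡ pos n / 1
  ι≡/1 n = refl

  toℚᵘ-/ : ∀ a k → ℚ.toℚᵘ (pos a / suc k) ℚᵘ.≃ ℚᵘ.mkℚᵘ (pos a) k
  toℚᵘ-/ a k = ℚ.toℚᵘ-fromℚᵘ (ℚᵘ.mkℚᵘ (pos a) k)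

  ι-+ : ∀ a b → ι (a ℕ.+ b) ≡ ι a + ι b
  ι-+ a b = ℚ.toℚᵘ-injective (ℚᵘ.≃-trans (toℚᵘ-/ (a ℕ.+ b) 0) (ℚᵘ.≃-trans main
      (ℚᵘ.≃-sym (ℚᵘ.≃-trans (ℚ.toℚᵘ-homo-+ (ι a) (ι b)) (ℚᵘ.+-cong (toℚᵘ-/ a 0) (toℚᵘ-/ b 0))))))
    where
    main : ℚᵘ.mkℚᵘ (pos (a ℕ.+ b)) 0 ℚᵘ.≃ ℚᵘ.mkℚᵘ (pos a) 0 ℚᵘ.+ ℚᵘ.mkℚᵘ (pos b) 0
    main = ℚᵘ.*≡* (cong (ℤ._* pos 1) (sym (cong₂ ℤ._+_ (ℤ.*-identityʳ (pos a)) (ℤ.*-identityʳ (pos b)))))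

  ι-* : ∀ a b → ι (a ℕ.* b) ≡ ι a · ι b
  ι-* a b = ℚ.toℚᵘ-injective (ℚᵘ.≃-trans (toℚᵘ-/ (a ℕ.* b) 0) (ℚᵘ.≃-trans main
      (ℚᵘ.≃-sym (ℚᵘ.≃-trans (ℚ.toℚᵘ-homo-* (ι a) (ι b)) (ℚᵘ.*-cong (toℚᵘ-/ a 0) (toℚᵘ-/ b 0))))))
    where
    main : ℚᵘ.mkℚᵘ (pos (a ℕ.* b)) 0 ℚᵘ.≃ ℚᵘ.mkℚᵘ (pos a) 0 ℚᵘ.* ℚᵘ.mkℚᵘ (pos b) 0
    main = ℚᵘ.*≡* (cong (ℤ._* pos 1) (ℤ.pos-* a b))

  0≤ι : ∀ n → 0ℚ ≲ ι n
  0≤ι n = ℚ.nonNegative⁻¹ (ι n) {{ℚ.normalize-nonNeg n 1}}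

  /-cancel : ∀ a n .{{_ : ℕ.NonZero n}} → (pos a / n) · ι n ≡ ι a
  /-cancel a (suc k) = ℚ.toℚᵘ-injective (ℚᵘ.≃-trans (ℚ.toℚᵘ-homo-* (pos a / suc k) (ι (suc k)))
    (ℚᵘ.≃-trans (ℚᵘ.*-cong (toℚᵘ-/ a k) (toℚᵘ-/ (suc k) 0)) (ℚᵘ.≃-trans (ℚᵘ.*≡* main) (ℚᵘ.≃-sym (toℚᵘ-/ a 0)))))
    where
    main : (pos a ℤ.* pos (suc k)) ℤ.* pos 1 ≡ pos a ℤ.* pos (suc k ℕ.* 1)
    main = trans (ℤ.*-identityʳ _) (cong (λ n → pos a ℤ.* pos n) (sym (ℕ.*-identityʳ (suc k))))

ι-suc : ∀ n → ι (suc n) ≡ 1ℚ + ι n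
ι-suc n = trans (ι-+ 1 n) (cong (_+ ι n) (ι≡/1 1))

ι-mono : ∀ {a b} → a ℕ.≤ b → ι a ≲ ι b
ι-mono {a} {b} a≤b = ≤-by (ι (b ℕ.∸ a)) (0≤ι (b ℕ.∸ a))
  (trans (cong ι (sym (ℕ.m+[n∸m]≡n a≤b))) (ι-+ a (b ℕ.∸ a)))

1≤ι : ∀ {n} → .{{ℕ.NonZero n}} → 1ℚ ≲ ι n
1≤ι {suc n} = subst (_≲ ι (suc n)) (ι≡/1 1) (ι-mono {1} {suc n} (ℕ.s≤s ℕ.z≤n))

0<ι : ∀ n → .{{ℕ.NonZero n}} → 0ℚ < ι n
0<ι n = ℚ.<-≤-trans 0<1 (1≤ι {n})

0≤^ : ∀ {x} n → 0ℚ ≲ x → 0ℚ ≲ x ^ n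
0≤^ zero    h = 0≤1
0≤^ (suc n) h = h ⊛ 0≤^ n h

1≤^ : ∀ {x} n → 1ℚ ≲ x → 1ℚ ≲ x ^ n
1≤^ zero    h = ℚ.≤-refl
1≤^ {x} (suc n) h = *-mono {1ℚ} {x} {1ℚ} {x ^ n} 0≤1 (ℚ.≤-trans 0≤1 h) h (1≤^ n h)

^-mono : ∀ {x y} n → 0ℚ ≲ x → x ≲ y → x ^ n ≲ y ^ n
^-mono zero    0≤x x≤y = ℚ.≤-refl
^-mono (suc n) 0≤x x≤y = *-mono (0≤^ n 0≤x) (ℚ.≤-trans 0≤x x≤y) x≤y (^-mono n 0≤x x≤y)

*-^ : ∀ x y n → (x · y) ^ n ≡ x ^ n · y ^ n
*-^ x y zero    = refl
*-^ x y (suc n) = trans (cong (x · y ·_) (*-^ x y n))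
  (solve 4 (λ x y a b → x :* y :* (a :* b) := x :* a :* (y :* b)) refl x y (x ^ n) (y ^ n))

^-double : ∀ x n → x ^ (n ℕ.+ n) ≡ x ^ n · x ^ n
^-double x n = go n
  where
  go : ∀ m → x ^ (m ℕ.+ n) ≡ x ^ m · x ^ n
  go zero    = sym (ℚ.*-identityˡ (x ^ n))
  go (suc m) = trans (cong (x ·_) (go m)) (sym (ℚ.*-assoc x (x ^ m) (x ^ n)))

-- Sums over the k-subsets of a finite set

-- Pascal's recursion in the order in which `∑` branches on the first element, so that `∑-1` is a
-- structural induction.
choose : ℕ → ℕ → ℕ
choose n       zero    = 1
choose zero    (suc k) = 0
choose (suc n) (suc k) = choose n (suc k) ℕ.+ choose n k

choose≡C : ∀ n k → choose n k ≡ n ℕ.C k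
choose≡C n       zero    = refl
choose≡C zero    (suc k) = refl
choose≡C (suc n) (suc k) = trans (cong₂ ℕ._+_ (choose≡C n (suc k)) (choose≡C n k))
  (trans (ℕ.+-comm (n ℕ.C suc k) (n ℕ.C k)) (ℕ.nCk+nC[k+1]≡[n+1]C[k+1] n k))

absorption : ∀ n k → ι (suc k) · ι (choose (suc n) (suc k)) ≡ ι (suc n) · ι (choose n k)
absorption n k = trans (sym (ι-* (suc k) (choose (suc n) (suc k))))
  (trans (cong ι (go n k)) (ι-* (suc n) (choose n k)))
  where
  module N = ℕ-Solver
  open ≡-Reasoning
  go : ∀ n k → suc k ℕ.* choose (suc n) (suc k) ≡ suc n ℕ.* choose n k
  go zero    zero    = refl
  go zero    (suc k) = ℕ.*-zeroʳ (suc (suc k))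
  go (suc n) zero    = begin
    1 ℕ.* (choose (suc n) 1 ℕ.+ 1)  ≡⟨ ℕ.*-distribˡ-+ 1 (choose (suc n) 1) 1 ⟩
    1 ℕ.* choose (suc n) 1 ℕ.+ 1    ≡⟨ cong (ℕ._+ 1) (go n zero) ⟩
    suc n ℕ.* 1 ℕ.+ 1               ≡⟨ ℕ.+-comm (suc n ℕ.* 1) 1 ⟩
    suc (suc n) ℕ.* 1               ∎
  go (suc n) (suc k) = begin
    suc (suc k) ℕ.* (a ℕ.+ b)                                  ≡⟨ N.solve 3 (λ k a b → (N.con 2 N.:+ k) N.:* (a N.:+ b)
                                                                    N.:= (N.con 2 N.:+ k) N.:* a N.:+ ((N.con 1 N.:+ k) N.:* b N.:+ b)) refl k a b ⟩
    suc (suc k) ℕ.* a ℕ.+ (suc k ℕ.* b ℕ.+ b)                  ≡⟨ cong₂ (λ x y → x ℕ.+ (y ℕ.+ b)) (go n (suc k)) (go n k) ⟩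
    suc n ℕ.* choose n (suc k) ℕ.+ (suc n ℕ.* choose n k ℕ.+ b)  ≡⟨ N.solve 3 (λ n x y → (N.con 1 N.:+ n) N.:* x N.:+ ((N.con 1 N.:+ n) N.:* y N.:+ (x N.:+ y))
                                                                    N.:= (N.con 2 N.:+ n) N.:* (x N.:+ y)) refl n (choose n (suc k)) (choose n k) ⟩
    suc (suc n) ℕ.* (choose n (suc k) ℕ.+ choose n k)          ∎
    where
    a = choose (suc n) (suc (suc k))
    b = choose (suc n) (suc k)

-- Both sides count pairs of a k-set and a point outside it. Algebraically, `absorption` is
-- subtracted from (k + n) times Pascal's recursion.
choose-complement : ∀ k n → ι n · ι (choose (k ℕ.+ n) k) ≡ ι (k ℕ.+ n) · ι (choose (ℕ.pred (k ℕ.+ n)) k)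
choose-complement zero    zero    = refl
choose-complement zero    (suc n) = refl
choose-complement (suc k) n       = begin
  ι n · ι c                         ≡⟨ solve 3 (λ n k c → n :* c := (k :+ n) :* c :- k :* c) refl (ι n) (ι (suc k)) (ι c) ⟩
  (ι (suc k) + ι n) · ι c - ι (suc k) · ι c
                                    ≡⟨ cong₂ (λ x y → x · ι c - y) (sym (ι-+ (suc k) n)) (absorption (k ℕ.+ n) k) ⟩
  ι (suc k ℕ.+ n) · ι c - ι (suc k ℕ.+ n) · ι (choose (k ℕ.+ n) k)
                                    ≡⟨ cong (λ x → ι (suc k ℕ.+ n) · x - ι (suc k ℕ.+ n) · ι (choose (k ℕ.+ n) k)) (ι-+ (choose (k ℕ.+ n) (suc k)) (choose (k ℕ.+ n) k)) ⟩
  ι (suc k ℕ.+ n) · (ι (choose (k ℕ.+ n) (suc k)) + ι (choose (k ℕ.+ n) k)) - ι (suc k ℕ.+ n) · ι (choose (k ℕ.+ n) k)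
                                    ≡⟨ solve 3 (λ r a b → r :* (a :+ b) :- r :* b := r :* a) refl (ι (suc k ℕ.+ n)) (ι (choose (k ℕ.+ n) (suc k))) (ι (choose (k ℕ.+ n) k)) ⟩
  ι (suc k ℕ.+ n) · ι (choose (k ℕ.+ n) (suc k)) ∎
  where
  open ≡-Reasoning
  c = choose (suc k ℕ.+ n) (suc k)

choose-nonZero : ∀ {n k} → k ℕ.≤ n → ℕ.NonZero (choose n k)
choose-nonZero {n}     {zero}  _           = _
choose-nonZero {suc n} {suc k} (ℕ.s≤s k≤n) = ℕ.>-nonZero
  (ℕ.≤-trans (ℕ.>-nonZero⁻¹ (choose n k) {{choose-nonZero k≤n}}) (ℕ.m≤n+m (choose n k) (choose n (suc k))))

-- The sum of g B (R ─ B) over the k-element subsets B of R.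
∑ : ℕ → Subset m → (Subset m → Subset m → ℚ) → ℚ
∑ k       (outside ∷ R) g = ∑ k R (λ B C → g (outside ∷ B) (outside ∷ C))
∑ zero    []            g = g [] []
∑ (suc k) []            g = 0ℚ
∑ zero    (inside ∷ R)  g = ∑ zero R (λ B C → g (outside ∷ B) (inside ∷ C))
∑ (suc k) (inside ∷ R)  g = ∑ (suc k) R (λ B C → g (outside ∷ B) (inside ∷ C))
                          + ∑ k R (λ B C → g (inside ∷ B) (outside ∷ C))

-- The pairs (B, C) visited by `∑ k R`, generated by the same recursion. A termwise argument
-- receives a `Split` and reads off from it the size of C and that C is `R ─ B`.
data Split : ∀ {m} → ℕ → Subset m → Subset m → Subset m → Set where
  []   : Split 0 [] [] []
  out  : ∀ {k} {R B C : Subset m} → Split k R B C → Split k (outside ∷ R) (outside ∷ B) (outside ∷ C)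
  skip : ∀ {k} {R B C : Subset m} → Split k R B C → Split k (inside ∷ R) (outside ∷ B) (inside ∷ C)
  take : ∀ {k} {R B C : Subset m} → Split k R B C → Split (suc k) (inside ∷ R) (inside ∷ B) (outside ∷ C)

split-size : ∀ {k} {R B C : Subset m} → Split k R B C → ∣ R ∣ ≡ k ℕ.+ ∣ C ∣
split-size []       = refl
split-size (out s)  = split-size s
split-size {k = k} (skip {C = C} s) = trans (cong suc (split-size s)) (sym (ℕ.+-suc k ∣ C ∣))
split-size (take s) = cong suc (split-size s)

split-∸ : ∀ {k} {R B C : Subset m} → Split k R B C → ∣ C ∣ ≡ ∣ R ∣ ℕ.∸ k
split-∸ {k = k} {C = C} s = trans (sym (ℕ.m+n∸m≡n k ∣ C ∣)) (cong (ℕ._∸ k) (sym (split-size s)))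

split-rest : ∀ {k} {R B C : Subset m} → Split k R B C → C ≡ R ─ B
split-rest []       = refl
split-rest (out s)  = cong (outside ∷_) (split-rest s)
split-rest (skip s) = cong (inside ∷_) (split-rest s)
split-rest (take s) = cong (outside ∷_) (split-rest s)

split-⊥ : ∀ {R B C : Subset m} → Split 0 R B C → B ≡ ⊥
split-⊥ []       = refl
split-⊥ (out s)  = cong (outside ∷_) (split-⊥ s)
split-⊥ (skip s) = cong (outside ∷_) (split-⊥ s)

split-id : ∀ {R B C : Subset m} → Split 0 R B C → C ≡ R
split-id []       = refl
split-id (out s)  = cong (outside ∷_) (split-id s)
split-id (skip s) = cong (inside ∷_) (split-id s)

∑-mono : ∀ k (R : Subset m) {g h} → (∀ {B C} → Split k R B C → g B C ≲ h B C) → ∑ k R g ≲ ∑ k R h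
∑-mono k       (outside ∷ R) g≤h = ∑-mono k R (λ s → g≤h (out s))
∑-mono zero    []            g≤h = g≤h []
∑-mono (suc k) []            g≤h = ℚ.≤-refl
∑-mono zero    (inside ∷ R)  g≤h = ∑-mono zero R (λ s → g≤h (skip s))
∑-mono (suc k) (inside ∷ R)  g≤h = ℚ.+-mono-≤ (∑-mono (suc k) R (λ s → g≤h (skip s))) (∑-mono k R (λ s → g≤h (take s)))

∑-cong : ∀ k (R : Subset m) {g h} → (∀ {B C} → Split k R B C → g B C ≡ h B C) → ∑ k R g ≡ ∑ k R h
∑-cong k R g≡h = ℚ.≤-antisym (∑-mono k R (λ s → ℚ.≤-reflexive (g≡h s))) (∑-mono k R (λ s → ℚ.≤-reflexive (sym (g≡h s))))

∑-+ : ∀ k (R : Subset m) g h → ∑ k R (λ B C → g B C + h B C) ≡ ∑ k R g + ∑ k R h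
∑-+ k       (outside ∷ R) g h = ∑-+ k R _ _
∑-+ zero    []            g h = refl
∑-+ (suc k) []            g h = refl
∑-+ zero    (inside ∷ R)  g h = ∑-+ zero R _ _
∑-+ (suc k) (inside ∷ R)  g h = trans (cong₂ _+_ (∑-+ (suc k) R _ _) (∑-+ k R _ _))
  (solve 4 (λ a b c d → (a :+ b) :+ (c :+ d) := (a :+ c) :+ (b :+ d)) refl
    (∑ (suc k) R (λ B C → g (outside ∷ B) (inside ∷ C))) (∑ (suc k) R (λ B C → h (outside ∷ B) (inside ∷ C)))
    (∑ k R (λ B C → g (inside ∷ B) (outside ∷ C))) (∑ k R (λ B C → h (inside ∷ B) (outside ∷ C))))

∑-* : ∀ c k (R : Subset m) g → ∑ k R (λ B C → c · g B C) ≡ c · ∑ k R g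
∑-* c k       (outside ∷ R) g = ∑-* c k R _
∑-* c zero    []            g = refl
∑-* c (suc k) []            g = sym (ℚ.*-zeroʳ c)
∑-* c zero    (inside ∷ R)  g = ∑-* c zero R _
∑-* c (suc k) (inside ∷ R)  g = trans (cong₂ _+_ (∑-* c (suc k) R _) (∑-* c k R _)) (sym (ℚ.*-distribˡ-+ c _ _))

∑-1 : ∀ k (R : Subset m) → ∑ k R (λ _ _ → 1ℚ) ≡ ι (choose ∣ R ∣ k)
∑-1 k       (outside ∷ R) = ∑-1 k R
∑-1 zero    []            = sym (ι≡/1 1)
∑-1 (suc k) []            = sym (ι≡/1 0)
∑-1 zero    (inside ∷ R)  = ∑-1 zero R
∑-1 (suc k) (inside ∷ R)  = trans (cong₂ _+_ (∑-1 (suc k) R) (∑-1 k R)) (sym (ι-+ (choose ∣ R ∣ (suc k)) (choose ∣ R ∣ k)))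

∑-const : ∀ c k (R : Subset m) → ∑ k R (λ _ _ → c) ≡ c · ι (choose ∣ R ∣ k)
∑-const c k R = trans (∑-cong k R (λ _ → sym (ℚ.*-identityʳ c))) (trans (∑-* c k R _) (cong (c ·_) (∑-1 k R)))

∑-nonNeg : ∀ k (R : Subset m) {g} → (∀ {B C} → Split k R B C → 0ℚ ≲ g B C) → 0ℚ ≲ ∑ k R g
∑-nonNeg k R h = ℚ.≤-trans (ℚ.≤-reflexive (sym (trans (∑-const 0ℚ k R) (ℚ.*-zeroˡ (ι (choose ∣ R ∣ k)))))) (∑-mono k R h)

∑-0 : ∀ (R : Subset m) g → ∑ 0 R g ≡ g ⊥ R
∑-0 (outside ∷ R) g = ∑-0 R _
∑-0 []            g = refl
∑-0 (inside ∷ R)  g = ∑-0 R _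

-- Each element of R goes to the j-set, to the k-set or to the rest, whichever set is drawn first.
-- All double counting below rests on this.
∑-exchange : ∀ j k (R : Subset m) (G : Subset m → Subset m → Subset m → ℚ) →
  ∑ j R (λ B C → ∑ k C (λ D E → G B D E)) ≡ ∑ k R (λ D C → ∑ j C (λ B E → G B D E))
∑-exchange j       k       (outside ∷ R) G = ∑-exchange j k R _
∑-exchange zero    zero    []            G = refl
∑-exchange zero    (suc k) []            G = refl
∑-exchange (suc j) zero    []            G = refl
∑-exchange (suc j) (suc k) []            G = refl
∑-exchange zero    zero    (inside ∷ R)  G = ∑-exchange zero zero R _
∑-exchange zero    (suc k) (inside ∷ R)  G = trans (∑-+ zero R _ _)
  (cong₂ _+_ (∑-exchange zero (suc k) R _) (∑-exchange zero k R _))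
∑-exchange (suc j) zero    (inside ∷ R)  G = sym (trans (∑-+ zero R _ _)
  (cong₂ _+_ (∑-exchange zero (suc j) R _) (∑-exchange zero j R _)))
∑-exchange (suc j) (suc k) (inside ∷ R)  G = begin
  ∑ (suc j) R (λ B C → ∑ (suc k) C (λ D E → G (outside ∷ B) (outside ∷ D) (inside ∷ E))
                       + ∑ k C (λ D E → G (outside ∷ B) (inside ∷ D) (outside ∷ E)))
    + ∑ j R (λ B C → ∑ (suc k) C (λ D E → G (inside ∷ B) (outside ∷ D) (outside ∷ E)))
    ≡⟨ cong₂ _+_ (trans (∑-+ (suc j) R _ _) (cong₂ _+_ (∑-exchange (suc j) (suc k) R _) (∑-exchange (suc j) k R _)))
         (∑-exchange j (suc k) R _) ⟩
  x + y + z
    ≡⟨ solve 3 (λ x y z → x :+ y :+ z := x :+ z :+ y) refl x y z ⟩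
  x + z + y
    ≡⟨ cong (_+ y) (∑-+ (suc k) R _ _) ⟨
  ∑ (suc k) R (λ D C → ∑ (suc j) C (λ B E → G (outside ∷ B) (outside ∷ D) (inside ∷ E))
                       + ∑ j C (λ B E → G (inside ∷ B) (outside ∷ D) (outside ∷ E))) + y ∎
  where
  open ≡-Reasoning
  x = ∑ (suc k) R (λ D C → ∑ (suc j) C (λ B E → G (outside ∷ B) (outside ∷ D) (inside ∷ E)))
  y = ∑ k R (λ D C → ∑ (suc j) C (λ B E → G (outside ∷ B) (inside ∷ D) (outside ∷ E)))
  z = ∑ (suc k) R (λ D C → ∑ j C (λ B E → G (inside ∷ B) (outside ∷ D) (outside ∷ E)))

-- A removed (k + 1)-set arises once for each choice of its last removed point.
∑-merge : ∀ k (R : Subset m) (F : Subset m → ℚ) →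
  ∑ k R (λ _ C → ∑ 1 C (λ _ E → F E)) ≡ ι (suc k) · ∑ (suc k) R (λ _ E → F E)
∑-merge k       (outside ∷ R) F = ∑-merge k R _
∑-merge zero    []            F = sym (ℚ.*-zeroʳ (ι 1))
∑-merge (suc k) []            F = sym (ℚ.*-zeroʳ (ι (suc (suc k))))
∑-merge zero    (inside ∷ R)  F = begin
  ∑ 0 R (λ _ C → ∑ 1 C (λ _ E → F (inside ∷ E)) + ∑ 0 C (λ _ E → F (outside ∷ E)))
    ≡⟨ ∑-0 R (λ _ C → ∑ 1 C (λ _ E → F (inside ∷ E)) + ∑ 0 C (λ _ E → F (outside ∷ E))) ⟩
  s  ≡⟨ ℚ.*-identityˡ s ⟨
  1ℚ · s  ≡⟨ cong (_· s) (ι≡/1 1) ⟨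
  ι 1 · s ∎
  where
  open ≡-Reasoning
  s = ∑ 1 R (λ _ E → F (inside ∷ E)) + ∑ 0 R (λ _ E → F (outside ∷ E))
∑-merge (suc k) (inside ∷ R)  F = begin
  ∑ (suc k) R (λ _ C → ∑ 1 C (λ _ E → F (inside ∷ E)) + ∑ 0 C (λ _ E → F (outside ∷ E)))
    + ∑ k R (λ _ C → ∑ 1 C (λ _ E → F (outside ∷ E)))
    ≡⟨ cong₂ _+_ (∑-+ (suc k) R _ _) (∑-merge k R _) ⟩
  ∑ (suc k) R (λ _ C → ∑ 1 C (λ _ E → F (inside ∷ E))) + ∑ (suc k) R (λ _ C → ∑ 0 C (λ _ E → F (outside ∷ E)))
    + ι (suc k) · y
    ≡⟨ cong₂ (λ u v → u + v + ι (suc k) · y) (∑-merge (suc k) R _) (∑-cong (suc k) R (λ {_} {C} _ → ∑-0 C _)) ⟩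
  ι (suc (suc k)) · x + y + ι (suc k) · y
    ≡⟨ solve 4 (λ a b x y → a :* x :+ y :+ b :* y := a :* x :+ (con 1ℚ :+ b) :* y) refl (ι (suc (suc k))) (ι (suc k)) x y ⟩
  ι (suc (suc k)) · x + (1ℚ + ι (suc k)) · y
    ≡⟨ cong (λ a → ι (suc (suc k)) · x + a · y) (ι-suc (suc k)) ⟨
  ι (suc (suc k)) · x + ι (suc (suc k)) · y
    ≡⟨ ℚ.*-distribˡ-+ (ι (suc (suc k))) x y ⟨
  ι (suc (suc k)) · (x + y) ∎
  where
  open ≡-Reasoning
  x = ∑ (suc (suc k)) R (λ _ E → F (inside ∷ E))
  y = ∑ (suc k) R (λ _ E → F (outside ∷ E))

∑-shrink : ∀ {j} k {R B C : Subset m} → Split j R B C → (f : Subset m → ℚ) → (∀ D → 0ℚ ≲ f D) →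
  ∑ k C (λ D _ → f D) ≲ ∑ k R (λ D _ → f D)
∑-shrink k       []       f 0≤f = ℚ.≤-refl
∑-shrink k       (out s)  f 0≤f = ∑-shrink k s _ (λ D → 0≤f _)
∑-shrink zero    (skip s) f 0≤f = ∑-shrink zero s _ (λ D → 0≤f _)
∑-shrink (suc k) (skip s) f 0≤f = ℚ.+-mono-≤ (∑-shrink (suc k) s _ (λ D → 0≤f _)) (∑-shrink k s _ (λ D → 0≤f _))
∑-shrink zero    (take s) f 0≤f = ∑-shrink zero s _ (λ D → 0≤f _)
∑-shrink (suc k) (take {R = R} s) f 0≤f = ℚ.≤-trans (∑-shrink (suc k) s _ (λ D → 0≤f _))
  (≤-by (∑ k R (λ D _ → f (inside ∷ D))) (∑-nonNeg k R (λ _ → 0≤f _)) refl)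

-- Points are encoded as 1-element subsets, so that removing a point and removing a set are both
-- instances of `∑`.
∑-point : ∀ {R B C : Subset m} → Split 1 R B C → (f : Subset m → ℚ) →
  ∑ 1 R (λ x _ → f x) ≡ f B + ∑ 1 C (λ x _ → f x)
∑-point (out s) f = ∑-point s _
∑-point (skip {R = R} {B} {C} s) f = begin
  ∑ 1 R (λ x _ → f (outside ∷ x)) + ∑ 0 R (λ x _ → f (inside ∷ x))
    ≡⟨ cong₂ _+_ (∑-point s _) (trans (∑-0 R _) (sym (∑-0 C _))) ⟩
  f (outside ∷ B) + ∑ 1 C (λ x _ → f (outside ∷ x)) + ∑ 0 C (λ x _ → f (inside ∷ x))
    ≡⟨ ℚ.+-assoc (f (outside ∷ B)) _ _ ⟩
  f (outside ∷ B) + (∑ 1 C (λ x _ → f (outside ∷ x)) + ∑ 0 C (λ x _ → f (inside ∷ x))) ∎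
  where open ≡-Reasoning
∑-point (take {R = R} s) f rewrite split-⊥ s | split-id s =
  trans (cong (∑ 1 R (λ x _ → f (outside ∷ x)) +_) (∑-0 R _)) (ℚ.+-comm (∑ 1 R (λ x _ → f (outside ∷ x))) (f (inside ∷ ⊥)))

-- Densities and the removal of one element

-- The value at 0 makes `α` total, with α R = 0 when R has fewer than l elements; thus `0≤α` holds
-- for every R.
recip : ℕ → ℚ
recip zero    = 0ℚ
recip (suc n) = pos 1 / suc n

0≤recip : ∀ n → 0ℚ ≲ recip n
0≤recip zero    = ℚ.≤-refl
0≤recip (suc n) = ℚ.nonNegative⁻¹ (recip (suc n)) {{ℚ.normalize-nonNeg 1 (suc n)}}

recip-cancel : ∀ n → .{{ℕ.NonZero n}} → recip n · ι n ≡ 1ℚ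
recip-cancel (suc n) = trans (/-cancel 1 (suc n)) (ι≡/1 1)

choose-1 : ∀ n → choose n 1 ≡ n
choose-1 zero    = refl
choose-1 (suc n) = trans (cong (ℕ._+ 1) (choose-1 n)) (ℕ.+-comm n 1)

-- The coefficient ¾ is what 2 p z ≤ 1 makes room for.
power-bound : ∀ p ζ z → 0ℚ ≲ ζ → (ι p · ζ) + (ι p · ζ) ≲ 1ℚ → z ≲ ζ → 0ℚ ≲ 1ℚ + z → ∀ j → j ℕ.≤ p →
  (1ℚ + z) ^ j ≲ 1ℚ + ι j · z + (pos 3 / 4) · (ι j · ι j) · (z · z)
power-bound p ζ z 0≤ζ pζ z≤ζ 0≤1+z zero    _   = ℚ.≤-reflexive (sym (trans
  (cong (λ x → 1ℚ + x · z + (pos 3 / 4) · (x · x) · (z · z)) (ι≡/1 0))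
  (solve 1 (λ z → con 1ℚ :+ con 0ℚ :* z :+ con (pos 3 / 4) :* (con 0ℚ :* con 0ℚ) :* (z :* z) := con 1ℚ) refl z)))
power-bound p ζ z 0≤ζ pζ z≤ζ 0≤1+z (suc j) j<p = begin
  (1ℚ + z) · (1ℚ + z) ^ j
    ≤⟨ *-monoˡ (1ℚ + z) 0≤1+z (power-bound p ζ z 0≤ζ pζ z≤ζ 0≤1+z j (ℕ.<⇒≤ j<p)) ⟩
  (1ℚ + z) · (1ℚ + J · z + (pos 3 / 4) · (J · J) · (z · z))
    -- The surplus is z² (¾ + J/2 - ¾ J² z), and ¾ J² z is at most 3J/8 because 2 J z ≤ 1; the sign
    -- of z is immaterial.
    ≤⟨ ≤-by (z · z · ((pos 3 / 8) · J · (1ℚ - (J · z + J · z)) + J · (pos 1 / 8) + (pos 3 / 4)))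
        (0≤sq z ⊛ (ℚ.nonNegative⁻¹ (pos 3 / 8) ⊛ 0≤ι j ⊛ x≤y⇒0≤y-x 2jz≤1 ⊕ 0≤ι j ⊛ ℚ.nonNegative⁻¹ (pos 1 / 8) ⊕ ℚ.nonNegative⁻¹ (pos 3 / 4)))
        (solve 2 (λ J z → con 1ℚ :+ (con 1ℚ :+ J) :* z :+ con (pos 3 / 4) :* ((con 1ℚ :+ J) :* (con 1ℚ :+ J)) :* (z :* z)
          := (con 1ℚ :+ z) :* (con 1ℚ :+ J :* z :+ con (pos 3 / 4) :* (J :* J) :* (z :* z))
            :+ z :* z :* (con (pos 3 / 8) :* J :* (con 1ℚ :- (J :* z :+ J :* z)) :+ J :* con (pos 1 / 8) :+ con (pos 3 / 4))) refl J z) ⟩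
  1ℚ + (1ℚ + J) · z + (pos 3 / 4) · ((1ℚ + J) · (1ℚ + J)) · (z · z)
    ≡⟨ cong (λ x → 1ℚ + x · z + (pos 3 / 4) · (x · x) · (z · z)) (ι-suc j) ⟨
  1ℚ + ι (suc j) · z + (pos 3 / 4) · (ι (suc j) · ι (suc j)) · (z · z) ∎
  where
  open ℚ.≤-Reasoning
  J = ι j
  jz≤pζ : J · z ≲ ι p · ζ
  jz≤pζ = ℚ.≤-trans (*-monoˡ J (0≤ι j) z≤ζ) (*-monoʳ ζ 0≤ζ (ι-mono (ℕ.<⇒≤ j<p)))
  2jz≤1 : J · z + J · z ≲ 1ℚ
  2jz≤1 = ℚ.≤-trans (ℚ.+-mono-≤ jz≤pζ jz≤pζ) pζ

-- Removing a k-set is removing k points in turn, each of which multiplies the mean of F by at most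
-- c. The condition k + b ≤ |R| keeps more than b points present before every removal.
∑-iterate : ∀ c → 0ℚ ≲ c → (F : Subset m → ℚ) (b : ℕ) →
  (∀ C → b ℕ.< ∣ C ∣ → ∑ 1 C (λ _ E → F E) ≲ ι ∣ C ∣ · (c · F C)) →
  ∀ k R → k ℕ.+ b ℕ.≤ ∣ R ∣ → ∑ k R (λ _ C → F C) ≲ ι (choose ∣ R ∣ k) · (c ^ k · F R)
∑-iterate c 0≤c F b step zero    R _ = ℚ.≤-reflexive (trans (∑-0 R _)
  (trans (solve 1 (λ x → x := con 1ℚ :* (con 1ℚ :* x)) refl (F R)) (cong (_· (1ℚ · F R)) (sym (ι≡/1 1)))))
∑-iterate c 0≤c F b step (suc k) R h = *-cancelˡ (ι (suc k)) (0<ι (suc k)) (begin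
  ι (suc k) · ∑ (suc k) R (λ _ C → F C)
    ≡⟨ ∑-merge k R F ⟨
  ∑ k R (λ _ C → ∑ 1 C (λ _ E → F E))
    ≤⟨ ∑-mono k R (λ {_} {C} s → ℚ.≤-trans (step C (b<∣C∣ s))
         (ℚ.≤-reflexive (trans (cong (λ n → ι n · (c · F C)) (split-∸ s)) (sym (ℚ.*-assoc r c (F C)))))) ⟩
  ∑ k R (λ _ C → r · c · F C)
    ≡⟨ ∑-* (r · c) k R _ ⟩
  r · c · ∑ k R (λ _ C → F C)
    ≤⟨ *-monoˡ (r · c) (0≤ι _ ⊛ 0≤c) (∑-iterate c 0≤c F b step k R (ℕ.≤-trans (ℕ.n≤1+n _) h)) ⟩
  r · c · (ι (choose ∣ R ∣ k) · (c ^ k · F R))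
    ≡⟨ solve 5 (λ r c N x F → r :* c :* (N :* (x :* F)) := (r :* N) :* (c :* x :* F)) refl r c (ι (choose ∣ R ∣ k)) (c ^ k) (F R) ⟩
  (r · ι (choose ∣ R ∣ k)) · (c · c ^ k · F R)
    ≡⟨ cong (_· (c · c ^ k · F R)) absorb ⟩
  (ι (suc k) · ι (choose ∣ R ∣ (suc k))) · (c · c ^ k · F R)
    ≡⟨ ℚ.*-assoc (ι (suc k)) (ι (choose ∣ R ∣ (suc k))) (c · c ^ k · F R) ⟩
  ι (suc k) · (ι (choose ∣ R ∣ (suc k)) · (c ^ suc k · F R)) ∎)
  where
  open ℚ.≤-Reasoning
  r = ι (∣ R ∣ ℕ.∸ k)
  b<∣C∣ : ∀ {B C} → Split k R B C → b ℕ.< ∣ C ∣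
  b<∣C∣ {C = C} s = ℕ.+-cancelˡ-< k b ∣ C ∣ (subst (k ℕ.+ b ℕ.<_) (split-size s) h)
  absorb : r · ι (choose ∣ R ∣ k) ≡ ι (suc k) · ι (choose ∣ R ∣ (suc k))
  -- The identity (|R| - k) C(|R|, k) = (k + 1) C(|R|, k + 1) is `∑-merge` for the constant 1.
  absorb = trans (sym (∑-const r k R)) (trans
    (∑-cong k R (λ {_} {C} s → sym (trans (∑-1 1 C) (cong ι (trans (choose-1 ∣ C ∣) (split-∸ s))))))
    (trans (∑-merge k R (λ _ → 1ℚ)) (cong (ι (suc k) ·_) (∑-1 (suc k) R))))

module Density {m} (k : ℕ) (f : Subset m → ℚ) (0≤f : ∀ B → 0ℚ ≲ f B) (f≤1 : ∀ B → f B ≲ 1ℚ) where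

  l : ℕ
  l = suc k

  S : Subset m → ℚ
  S R = ∑ l R (λ B _ → f B)

  α : Subset m → ℚ
  α R = S R · recip (choose ∣ R ∣ l)

  0≤α : ∀ R → 0ℚ ≲ α R
  0≤α R = ∑-nonNeg l R (λ _ → 0≤f _) ⊛ 0≤recip (choose ∣ R ∣ l)

  αN≡S : ∀ R → l ℕ.≤ ∣ R ∣ → α R · ι (choose ∣ R ∣ l) ≡ S R
  αN≡S R l≤ = trans (ℚ.*-assoc (S R) _ _) (trans (cong (S R ·_) (recip-cancel _ {{choose-nonZero l≤}})) (ℚ.*-identityʳ (S R)))

  0<choose : ∀ {n} → l ℕ.≤ n → 0ℚ < ι (choose n l)
  0<choose {n} l≤n = 0<ι (choose n l) {{choose-nonZero l≤n}}

  α≤1 : ∀ R → l ℕ.≤ ∣ R ∣ → α R ≲ 1ℚ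
  α≤1 R l≤ = *-cancelˡ N (0<choose l≤) (begin
    N · α R          ≡⟨ trans (ℚ.*-comm N (α R)) (αN≡S R l≤) ⟩
    S R              ≤⟨ ∑-mono l R (λ _ → f≤1 _) ⟩
    ∑ l R (λ _ _ → 1ℚ) ≡⟨ trans (∑-1 l R) (sym (ℚ.*-identityʳ N)) ⟩
    N · 1ℚ ∎)
    where
    open ℚ.≤-Reasoning
    N = ι (choose ∣ R ∣ l)

  -- Here `suc q` is r - l and `suc n` is r - 1. The numbers `N`, `N′`, `N″` count the l-subsets of
  -- R, of R without one point and of R without two.
  module Remove (R : Subset m) (q : ℕ) (∣R∣ : ∣ R ∣ ≡ l ℕ.+ suc q) where

    n : ℕ
    n = k ℕ.+ q

    ∣R∣′ : ∣ R ∣ ≡ suc (suc n)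
    ∣R∣′ = trans ∣R∣ (cong suc (ℕ.+-suc k q))

    a r N N′ N″ : ℚ
    a  = α R
    r  = ι ∣ R ∣
    N  = ι (choose ∣ R ∣ l)
    N′ = ι (choose (suc n) l)
    N″ = ι (choose n l)

    ∣C∣ : ∀ {B C} → Split 1 R B C → ∣ C ∣ ≡ suc n
    ∣C∣ s = ℕ.suc-injective (trans (sym (split-size s)) ∣R∣′)

    l≤1+n : l ℕ.≤ suc n
    l≤1+n = ℕ.s≤s (ℕ.m≤m+n k q)

    0<N′ : 0ℚ < N′
    0<N′ = 0<choose l≤1+n

    a-S : a · N ≡ S R
    a-S = αN≡S R (subst (l ℕ.≤_) (sym ∣R∣′) (ℕ.m≤n⇒m≤1+n l≤1+n))

    α-S : ∀ {B C} → Split 1 R B C → α C · N′ ≡ S C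
    α-S {C = C} s = trans (cong (λ n → α C · ι (choose n l)) (sym (∣C∣ s))) (αN≡S C (subst (l ℕ.≤_) (sym (∣C∣ s)) l≤1+n))

    complement : ι (suc q) · N ≡ r · N′
    complement = trans (cong (λ n → ι (suc q) · ι (choose n l)) ∣R∣)
      (trans (choose-complement l (suc q)) (cong₂ (λ x y → ι x · ι (choose y l)) (sym ∣R∣) (ℕ.+-suc k q)))

    ∑1-const : ∀ c → ∑ 1 R (λ _ _ → c) ≡ r · c
    ∑1-const c = trans (∑-const c 1 R) (trans (cong (λ n → c · ι n) (choose-1 ∣ R ∣)) (ℚ.*-comm c r))

    -- Each l-set survives the removal of exactly the r - l points outside it, so the density is a
    -- martingale under removal of a uniform point.
    average : ∑ 1 R (λ _ C → α C) ≡ r · a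
    average = ℚ.≤-antisym (cancel (ℚ.≤-reflexive eq)) (cancel (ℚ.≤-reflexive (sym eq)))
      where
      cancel : ∀ {x y} → N′ · x ≲ N′ · y → x ≲ y
      cancel = *-cancelˡ N′ 0<N′
      open ≡-Reasoning
      eq : N′ · ∑ 1 R (λ _ C → α C) ≡ N′ · (r · a)
      eq = begin
        N′ · ∑ 1 R (λ _ C → α C)                     ≡⟨ ∑-* N′ 1 R _ ⟨
        ∑ 1 R (λ _ C → N′ · α C)                     ≡⟨ ∑-cong 1 R (λ {_} {C} s → trans (ℚ.*-comm N′ (α C)) (α-S s)) ⟩
        ∑ 1 R (λ _ C → ∑ l C (λ B _ → f B))          ≡⟨ ∑-exchange 1 l R (λ _ B _ → f B) ⟩
        ∑ l R (λ B C → ∑ 1 C (λ _ _ → f B))          ≡⟨ ∑-cong l R (λ {B} {C} s → trans (∑-const (f B) 1 C) (trans (ℚ.*-comm (f B) _)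
                                                          (cong (λ n → ι n · f B) (trans (choose-1 ∣ C ∣) (ℕ.+-cancelˡ-≡ l ∣ C ∣ (suc q) (trans (sym (split-size s)) ∣R∣)))))) ⟩
        ∑ l R (λ B C → ι (suc q) · f B)              ≡⟨ ∑-* (ι (suc q)) l R _ ⟩
        ι (suc q) · S R                              ≡⟨ cong (ι (suc q) ·_) (sym a-S) ⟩
        ι (suc q) · (a · N)                          ≡⟨ solve 3 (λ q a N → q :* (a :* N) := a :* (q :* N)) refl (ι (suc q)) a N ⟩
        a · (ι (suc q) · N)                          ≡⟨ cong (a ·_) complement ⟩
        a · (r · N′)                                 ≡⟨ solve 3 (λ a r N → a :* (r :* N) := N :* (r :* a)) refl a r N′ ⟩
        N′ · (r · a)                                 ∎

    -- The l-subsets of C are among those of R, so the density can rise only because the number of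
    -- l-sets falls, by the factor (r - l) / r.
    upper : ∀ {B C} → Split 1 R B C → ι (suc q) · α C ≲ r · a
    upper {C = C} s = *-cancelˡ N′ 0<N′ (begin
      N′ · (ι (suc q) · α C)   ≡⟨ solve 3 (λ N q a → N :* (q :* a) := q :* (a :* N)) refl N′ (ι (suc q)) (α C) ⟩
      ι (suc q) · (α C · N′)   ≡⟨ cong (ι (suc q) ·_) (α-S s) ⟩
      ι (suc q) · S C          ≤⟨ *-monoˡ (ι (suc q)) (0≤ι (suc q)) (∑-shrink l s f 0≤f) ⟩
      ι (suc q) · S R          ≡⟨ cong (ι (suc q) ·_) (sym a-S) ⟩
      ι (suc q) · (a · N)      ≡⟨ solve 3 (λ q a N → q :* (a :* N) := a :* (q :* N)) refl (ι (suc q)) a N ⟩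
      a · (ι (suc q) · N)      ≡⟨ cong (a ·_) complement ⟩
      a · (r · N′)             ≡⟨ solve 3 (λ a r N → a :* (r :* N) := N :* (r :* a)) refl a r N′ ⟩
      N′ · (r · a)             ∎)
      where open ℚ.≤-Reasoning

    -- Written with `R ─ x` rather than with the remainder of a split: as a function of the point
    -- alone it can be summed over other sets, as in `Y`.
    D : Subset m → ℚ
    D x = α (R ─ x) - a

    D≡ : ∀ {B C} → Split 1 R B C → D B ≡ α C - a
    D≡ s = cong (λ C → α C - a) (sym (split-rest s))

    -- For C = R ─ B this is minus the sum of `D` over B, since `D` sums to zero over R. As a
    -- function of B it lies in the first eigenspace of the Johnson scheme and is the test function
    -- for f.
    Y : Subset m → ℚ
    Y C = ∑ 1 C (λ x _ → D x)

    Q : ℚ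
    Q = ∑ 1 R (λ x _ → D x · D x)

    ∑D≡0 : Y R ≡ 0ℚ
    ∑D≡0 = begin
      ∑ 1 R (λ x _ → D x)                  ≡⟨ ∑-cong 1 R D≡ ⟩
      ∑ 1 R (λ _ C → α C - a)              ≡⟨ ∑-+ 1 R (λ _ C → α C) (λ _ _ → - a) ⟩
      ∑ 1 R (λ _ C → α C) + ∑ 1 R (λ _ _ → - a)  ≡⟨ cong₂ _+_ average (∑1-const (- a)) ⟩
      r · a + r · (- a)                    ≡⟨ solve 2 (λ r a → r :* a :+ r :* (:- a) := con 0ℚ) refl r a ⟩
      0ℚ                                   ∎
      where open ≡-Reasoning

    ∑l-const : ∀ {B C} → Split 1 R B C → ∀ c → ∑ l C (λ _ _ → c) ≡ c · N′
    ∑l-const {C = C} s c = trans (∑-const c l C) (cong (λ n → c · ι (choose n l)) (∣C∣ s))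

    -- After exchanging the sums, a point x is weighted by S(R ─ x) = N′ (a + D x), and the part
    -- with a vanishes because `D` sums to zero.
    ∑fY : ∑ l R (λ B C → f B · Y C) ≡ N′ · Q
    ∑fY = begin
      ∑ l R (λ B C → f B · Y C)
        ≡⟨ ∑-cong l R (λ {B} {C} _ → sym (∑-* (f B) 1 C _)) ⟩
      ∑ l R (λ B C → ∑ 1 C (λ x _ → f B · D x))
        ≡⟨ ∑-exchange l 1 R (λ B x _ → f B · D x) ⟩
      ∑ 1 R (λ x C → ∑ l C (λ B _ → f B · D x))
        ≡⟨ ∑-cong 1 R (λ {x} {C} s → trans (∑-cong l C (λ {B} _ → ℚ.*-comm (f B) (D x))) (trans (∑-* (D x) l C _)
             (trans (cong (D x ·_) (sym (α-S s))) (term s)))) ⟩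
      ∑ 1 R (λ x C → N′ · (D x · D x) + (N′ · a) · D x)
        ≡⟨ trans (∑-+ 1 R _ _) (cong₂ _+_ (∑-* N′ 1 R _) (∑-* (N′ · a) 1 R _)) ⟩
      N′ · Q + (N′ · a) · Y R
        ≡⟨ trans (cong (λ y → N′ · Q + (N′ · a) · y) ∑D≡0) (trans (cong (λ x → N′ · Q + x) (ℚ.*-zeroʳ (N′ · a))) (ℚ.+-identityʳ (N′ · Q))) ⟩
      N′ · Q ∎
      where
      open ≡-Reasoning
      term : ∀ {x C} → Split 1 R x C → D x · (α C · N′) ≡ N′ · (D x · D x) + (N′ · a) · D x
      term {x} {C} s = trans (cong (λ d → D x · (d · N′)) (trans (solve 2 (λ c a → c := (c :- a) :+ a) refl (α C) a) (cong (_+ a) (sym (D≡ s)))))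
        (solve 3 (λ d a N → d :* ((d :+ a) :* N) := N :* (d :* d) :+ (N :* a) :* d) refl (D x) a N′)

    ∑Y : ∑ l R (λ _ C → Y C) ≡ 0ℚ
    ∑Y = begin
      ∑ l R (λ _ C → ∑ 1 C (λ x _ → D x))  ≡⟨ ∑-exchange l 1 R (λ _ x _ → D x) ⟩
      ∑ 1 R (λ x C → ∑ l C (λ _ _ → D x))  ≡⟨ ∑-cong 1 R (λ {x} s → trans (∑l-const s (D x)) (ℚ.*-comm (D x) N′)) ⟩
      ∑ 1 R (λ x C → N′ · D x)             ≡⟨ ∑-* N′ 1 R _ ⟩
      N′ · Y R                             ≡⟨ trans (cong (N′ ·_) ∑D≡0) (ℚ.*-zeroʳ N′) ⟩
      0ℚ                                   ∎
      where open ≡-Reasoning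

    Y-square : ∀ C → Y C · Y C ≡ ∑ 1 C (λ x _ → D x · D x) + ∑ 1 C (λ x E → D x · Y E)
    Y-square C = begin
      Y C · Y C                                       ≡⟨ ∑-* (Y C) 1 C _ ⟨
      ∑ 1 C (λ x _ → Y C · D x)                       ≡⟨ ∑-cong 1 C (λ {x} {E} s → trans (cong (_· D x) (∑-point s D))
                                                            (solve 2 (λ d y → (d :+ y) :* d := d :* d :+ d :* y) refl (D x) (Y E))) ⟩
      ∑ 1 C (λ x E → D x · D x + D x · Y E)           ≡⟨ ∑-+ 1 C _ _ ⟩
      ∑ 1 C (λ x _ → D x · D x) + ∑ 1 C (λ x E → D x · Y E)  ∎
      where open ≡-Reasoning

    -- The diagonal gives N′ Q. Two distinct points are both avoided by N″ sets, and the sum of `D`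
    -- over the points other than x is - D x, so the off-diagonal part is - N″ Q.
    ∑Y² : ∑ l R (λ _ C → Y C · Y C) ≡ (N′ - N″) · Q
    ∑Y² = begin
      ∑ l R (λ _ C → Y C · Y C)
        ≡⟨ trans (∑-cong l R (λ {_} {C} _ → Y-square C)) (∑-+ l R _ _) ⟩
      ∑ l R (λ _ C → ∑ 1 C (λ x _ → D x · D x)) + ∑ l R (λ _ C → ∑ 1 C (λ x E → D x · Y E))
        ≡⟨ cong₂ _+_ (∑-exchange l 1 R (λ _ x _ → D x · D x)) (∑-exchange l 1 R (λ _ x E → D x · Y E)) ⟩
      ∑ 1 R (λ x C → ∑ l C (λ _ _ → D x · D x)) + ∑ 1 R (λ x C → ∑ l C (λ _ E → D x · Y E))
        ≡⟨ cong₂ _+_ (∑-cong 1 R (λ {x} s → trans (∑l-const s (D x · D x)) (ℚ.*-comm (D x · D x) N′))) (∑-cong 1 R off-diagonal) ⟩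
      ∑ 1 R (λ x C → N′ · (D x · D x)) + ∑ 1 R (λ x C → (- N″) · (D x · D x))
        ≡⟨ cong₂ _+_ (∑-* N′ 1 R _) (∑-* (- N″) 1 R _) ⟩
      N′ · Q + (- N″) · Q
        ≡⟨ ℚ.*-distribʳ-+ Q N′ (- N″) ⟨
      (N′ - N″) · Q ∎
      where
      open ≡-Reasoning
      off-diagonal : ∀ {x C} → Split 1 R x C → ∑ l C (λ _ E → D x · Y E) ≡ (- N″) · (D x · D x)
      off-diagonal {x} {C} s = begin
        ∑ l C (λ _ E → D x · Y E)                     ≡⟨ ∑-* (D x) l C _ ⟩
        D x · ∑ l C (λ _ E → ∑ 1 E (λ y _ → D y))     ≡⟨ cong (D x ·_) (∑-exchange l 1 C (λ _ y _ → D y)) ⟩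
        D x · ∑ 1 C (λ y E → ∑ l E (λ _ _ → D y))     ≡⟨ cong (D x ·_) (∑-cong 1 C (λ {y} {E} s′ → trans (∑-const (D y) l E) (trans (ℚ.*-comm (D y) _)
                                                           (cong (λ n → ι (choose n l) · D y) (ℕ.suc-injective (trans (sym (split-size s′)) (∣C∣ s))))))) ⟩
        D x · ∑ 1 C (λ y E → N″ · D y)                ≡⟨ cong (D x ·_) (∑-* N″ 1 C _) ⟩
        D x · (N″ · Y C)                              ≡⟨ solve 3 (λ d N y → d :* (N :* y) := N :* (d :* (d :+ y)) :+ (:- N) :* (d :* d)) refl (D x) N″ (Y C) ⟩
        N″ · (D x · (D x + Y C)) + (- N″) · (D x · D x)  ≡⟨ cong (λ y → N″ · (D x · y) + (- N″) · (D x · D x)) (trans (sym (∑-point s D)) ∑D≡0) ⟩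
        N″ · (D x · 0ℚ) + (- N″) · (D x · D x)        ≡⟨ solve 2 (λ d N → N :* (d :* con 0ℚ) :+ (:- N) :* (d :* d) := (:- N) :* (d :* d)) refl (D x) N″ ⟩
        (- N″) · (D x · D x)                          ∎

    0≤Q : 0ℚ ≲ Q
    0≤Q = ∑-nonNeg 1 R (λ {x} _ → 0≤sq (D x))

    -- Sums the square of l (f B - ½) - (r - 1) Y(R ─ B) over B. With the scales l and r - 1,
    -- Pascal's rule and `absorption` make (r - 1)² ∑ Y² equal to l (r - 1) ∑ f Y, so half of the
    -- cross term survives. Centering f at ½ leaves the cross term unchanged, as Y has sum zero, and
    -- brings in the factor ¼.
    variance : (pos 4 / 1) · (ι (suc q) · ι (suc n) · Q) ≲ ι l · r
    variance = *-cancelˡ (L · N′) (*-pos (0<ι l) 0<N′) (begin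
      L · N′ · ((pos 4 / 1) · (ι (suc q) · K · Q))
        ≡⟨ solve 5 (λ L N q K Q → L :* N :* (con (pos 4 / 1) :* (q :* K :* Q)) := con (pos 4 / 1) :* q :* (L :* K :* (N :* Q))) refl L N′ (ι (suc q)) K Q ⟩
      (pos 4 / 1) · ι (suc q) · (L · K · (N′ · Q))
        ≤⟨ *-monoˡ ((pos 4 / 1) · ι (suc q)) (ℚ.nonNegative⁻¹ (pos 4 / 1) ⊛ 0≤ι (suc q)) bound ⟩
      (pos 4 / 1) · ι (suc q) · (L · L · (pos 1 / 4) · N)
        ≡⟨ solve 3 (λ q L N → con (pos 4 / 1) :* q :* (L :* L :* con (pos 1 / 4) :* N) := L :* L :* (q :* N)) refl (ι (suc q)) L N ⟩
      L · L · (ι (suc q) · N)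
        ≡⟨ cong (L · L ·_) complement ⟩
      L · L · (r · N′)
        ≡⟨ solve 3 (λ L r N → L :* L :* (r :* N) := L :* N :* (L :* r)) refl L r N′ ⟩
      L · N′ · (L · r) ∎)
      where
      open ℚ.≤-Reasoning
      L = ι l
      K = ι (suc n)
      pascal : N′ - N″ ≡ ι (choose n k)
      pascal = trans (cong (_- N″) (ι-+ (choose n l) (choose n k))) (solve 2 (λ a b → (a :+ b) :- a := b) refl N″ (ι (choose n k)))
      pointwise : ∀ {B C} → Split l R B C →
        L · K · (f B · Y C) + L · K · (f B · Y C) + (- (L · K)) · Y C ≲ L · L · (pos 1 / 4) + K · K · (Y C · Y C)
      -- The term f (1 - f) completes (f - ½)² to ¼.
      pointwise {B} {C} _ = ≤-by ((L · (f B - ½) - K · Y C) · (L · (f B - ½) - K · Y C) + L · L · (f B · (1ℚ - f B)))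
        (0≤sq (L · (f B - ½) - K · Y C) ⊕ 0≤sq L ⊛ (0≤f B ⊛ x≤y⇒0≤y-x (f≤1 B)))
        (solve 4 (λ L K f y → L :* L :* con (pos 1 / 4) :+ K :* K :* (y :* y)
          := L :* K :* (f :* y) :+ L :* K :* (f :* y) :+ (:- (L :* K)) :* y
             :+ ((L :* (f :- con ½) :- K :* y) :* (L :* (f :- con ½) :- K :* y) :+ L :* L :* (f :* (con 1ℚ :- f)))) refl L K (f B) (Y C))
      lhs : ∑ l R (λ B C → L · K · (f B · Y C) + L · K · (f B · Y C) + (- (L · K)) · Y C) ≡ L · K · (N′ · Q) + L · K · (N′ · Q)
      lhs = trans (trans (∑-+ l R _ _) (cong₂ _+_ (trans (∑-+ l R _ _) (cong₂ _+_ e e)) (trans (∑-* (- (L · K)) l R _) (cong ((- (L · K)) ·_) ∑Y))))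
        (solve 2 (λ x y → x :+ x :+ y :* con 0ℚ := x :+ x) refl (L · K · (N′ · Q)) (- (L · K)))
        where
        e = trans (∑-* (L · K) l R _) (cong (L · K ·_) ∑fY)
      rhs : ∑ l R (λ B C → L · L · (pos 1 / 4) + K · K · (Y C · Y C)) ≡ L · L · (pos 1 / 4) · N + L · K · (N′ · Q)
      rhs = trans (trans (∑-+ l R _ _) (cong₂ _+_ (∑-const (L · L · (pos 1 / 4)) l R) (trans (∑-* (K · K) l R _) (cong (K · K ·_) ∑Y²))))
        (cong (λ x → L · L · (pos 1 / 4) · N + x) (trans (cong (λ x → K · K · (x · Q)) pascal)
          (trans (solve 3 (λ K c Q → K :* K :* (c :* Q) := K :* (K :* c) :* Q) refl K (ι (choose n k)) Q)
          (trans (cong (λ x → K · x · Q) (sym (absorption n k)))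
            (solve 4 (λ K L N Q → K :* (L :* N) :* Q := L :* K :* (N :* Q)) refl K L N′ Q)))))
      bound : L · K · (N′ · Q) ≲ L · L · (pos 1 / 4) · N
      bound = 0≤y-x⇒x≤y (subst (0ℚ ≲_)
        (solve 2 (λ x y → (y :+ x) :- (x :+ x) := y :- x) refl (L · K · (N′ · Q)) (L · L · (pos 1 / 4) · N))
        (x≤y⇒0≤y-x (subst₂ _≲_ lhs rhs (∑-mono l R pointwise))))

-- The moment bound

1^ : ∀ n → 1ℚ ^ n ≡ 1ℚ
1^ zero    = refl
1^ (suc n) = trans (ℚ.*-identityˡ (1ℚ ^ n)) (1^ n)

inverse : ∀ {x} → 1ℚ ≲ x → ∃ λ i → x · i ≡ 1ℚ × 0ℚ ≲ i × i ≲ 1ℚ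
inverse {x} 1≤x = i , x*i , 0≤i , subst (i ≲_) x*i (subst (_≲ x · i) (ℚ.*-identityˡ i) (*-monoʳ i 0≤i 1≤x))
  where
  instance
    x-pos : ℚ.Positive x
    x-pos = positive (ℚ.<-≤-trans 0<1 1≤x)
    x≢0 : ℚ.NonZero x
    x≢0 = ℚ.pos⇒nonZero x
  i : ℚ
  i = 1/ x
  x*i : x · i ≡ 1ℚ
  x*i = ℚ.*-inverseʳ x
  0≤i : 0ℚ ≲ i
  0≤i = ℚ.<⇒≤ (ℚ.positive⁻¹ i {{ℚ.1/pos⇒pos x}})

-- By induction from (1 + x)(1 - (n + 1) x) ≤ 1 - n x. It bounds compound growth from above, as
-- opposed to Bernoulli's inequality.
compound : ∀ x → 0ℚ ≲ x → ∀ n → (1ℚ + x) ^ n · (1ℚ - ι n · x) ≲ 1ℚ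
compound x 0≤x zero    = ℚ.≤-reflexive (trans (cong (λ y → 1ℚ · (1ℚ - y · x)) (ι≡/1 0))
  (solve 1 (λ x → con 1ℚ :* (con 1ℚ :- con 0ℚ :* x) := con 1ℚ) refl x))
compound x 0≤x (suc n) = begin
  (1ℚ + x) · y · (1ℚ - ι (suc n) · x)
    ≤⟨ ≤-by (y · ((1ℚ + ι n) · (x · x))) (0≤^ n (0≤1 ⊕ 0≤x) ⊛ ((0≤1 ⊕ 0≤ι n) ⊛ 0≤sq x))
        (trans (solve 3 (λ x y n → y :* (con 1ℚ :- n :* x)
          := (con 1ℚ :+ x) :* y :* (con 1ℚ :- (con 1ℚ :+ n) :* x) :+ y :* ((con 1ℚ :+ n) :* (x :* x))) refl x y (ι n))
          (cong (λ s → (1ℚ + x) · y · (1ℚ - s · x) + y · ((1ℚ + ι n) · (x · x))) (sym (ι-suc n)))) ⟩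
  y · (1ℚ - ι n · x)
    ≤⟨ compound x 0≤x n ⟩
  1ℚ ∎
  where
  open ℚ.≤-Reasoning
  y = (1ℚ + x) ^ n

-- Draws the sets one after another from what is left; `∑ᴸ-matchings` identifies it with the sum
-- over the enumerated tuples.
matchingSum : ℕ → (Subset m → ℚ) → ℕ → Subset m → ℚ
matchingSum l w zero    R = 1ℚ
matchingSum l w (suc n) R = ∑ l R (λ B C → w B · matchingSum l w n C)

matchingCount : ℕ → ℕ → ℕ → ℕ
matchingCount l zero    r = 1
matchingCount l (suc n) r = choose r l ℕ.* matchingCount l n (r ℕ.∸ l)

matchingSum-1 : ∀ l n (R : Subset m) → matchingSum l (λ _ → 1ℚ) n R ≡ ι (matchingCount l n ∣ R ∣)
matchingSum-1 l zero    R = sym (ι≡/1 1)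
matchingSum-1 l (suc n) R = begin
  ∑ l R (λ _ C → 1ℚ · matchingSum l (λ _ → 1ℚ) n C)
    ≡⟨ ∑-cong l R (λ {_} {C} s → trans (ℚ.*-identityˡ _) (trans (matchingSum-1 l n C) (cong (λ r → ι (matchingCount l n r)) (split-∸ s)))) ⟩
  ∑ l R (λ _ _ → ι (matchingCount l n (∣ R ∣ ℕ.∸ l)))
    ≡⟨ ∑-const M l R ⟩
  ι (matchingCount l n (∣ R ∣ ℕ.∸ l)) · ι (choose ∣ R ∣ l)
    ≡⟨ trans (ℚ.*-comm M (ι (choose ∣ R ∣ l))) (sym (ι-* (choose ∣ R ∣ l) (matchingCount l n (∣ R ∣ ℕ.∸ l)))) ⟩
  ι (choose ∣ R ∣ l ℕ.* matchingCount l n (∣ R ∣ ℕ.∸ l)) ∎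
  where
  open ≡-Reasoning
  M : ℚ
  M = ι (matchingCount l n (∣ R ∣ ℕ.∸ l))

module Moment {m} (k : ℕ) (f : Subset m → ℚ) (0≤f : ∀ B → 0ℚ ≲ f B) (f≤1 : ∀ B → f B ≲ 1ℚ)
  (μ : ℚ) (0≤μ : 0ℚ ≲ μ) (4μ≤1 : (pos 4 / 1) · μ ≲ 1ℚ) where

  open Density k f 0≤f f≤1

  A : Subset m → ℚ
  A R = 1ℚ + μ · α R

  1≤A : ∀ R → 1ℚ ≲ A R
  1≤A R = ≤-by (μ · α R) (0≤μ ⊛ 0≤α R) refl

  0≤A : ∀ R → 0ℚ ≲ A R
  0≤A R = ℚ.≤-trans 0≤1 (1≤A R)

  -- The allowed growth of the mean of A^(2n) per removed point: ¾ (2n)² μ² Q / r, where Q / r ≤ 1 /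
  -- (2 n² l) by `Q-bound`.
  κ : ℚ
  κ = (pos 3 / 2) · (μ · μ) · recip l

  0≤κ : 0ℚ ≲ κ
  0≤κ = ℚ.nonNegative⁻¹ (pos 3 / 2) ⊛ 0≤sq μ ⊛ 0≤recip l

  module Step (ν p : ℕ) (p≡ : p ≡ suc (suc ν) ℕ.+ suc (suc ν)) (R : Subset m) (nl<∣R∣ : suc (suc ν) ℕ.* l ℕ.< ∣ R ∣) where

    n q : ℕ
    n = suc (suc ν)
    q = ∣ R ∣ ℕ.∸ suc l

    ∣R∣≡ : ∣ R ∣ ≡ l ℕ.+ suc q
    ∣R∣≡ = sym (trans (ℕ.+-suc l q) (ℕ.m+[n∸m]≡n (ℕ.≤-trans (ℕ.s≤s (ℕ.m≤m+n l (suc ν ℕ.* l))) nl<∣R∣)))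

    open Remove R q ∣R∣≡ using (a; r; D; D≡; Q; 0≤Q; ∑D≡0; ∑1-const; upper; variance; ∣R∣′) renaming (n to n′)

    nl≤ : n ℕ.* l ℕ.≤ suc n′
    nl≤ = ℕ.≤-pred (subst (n ℕ.* l ℕ.<_) ∣R∣′ nl<∣R∣)

    [n-1]l≤ : suc ν ℕ.* l ℕ.≤ suc q
    [n-1]l≤ = ℕ.+-cancelˡ-≤ l _ _ (subst (n ℕ.* l ℕ.≤_) ∣R∣≡ (ℕ.<⇒≤ nl<∣R∣))

    L g P v : ℚ
    L = ι l
    g = recip l
    P = ι p
    v = ι ν

    ιn : ι n ≡ 1ℚ + (1ℚ + v)
    ιn = trans (ι-suc (suc ν)) (cong (1ℚ +_) (ι-suc ν))

    ιp : P ≡ ι n + ι n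
    ιp = trans (cong ι p≡) (ι-+ n n)

    -- Inserts r - l ≥ (n - 1) l and r - 1 ≥ n l into `variance`. The passage from 4 (n - 1) n to 2
    -- n² requires n ≥ 2, which is why `Step` starts at `suc (suc ν)`.
    Q-bound : (pos 2 / 1) · (ι n · ι n) · L · Q ≲ r
    Q-bound = *-cancelˡ L (0<ι l) (begin
      L · ((pos 2 / 1) · (ι n · ι n) · L · Q)
        ≡⟨ cong (λ x → L · ((pos 2 / 1) · (x · x) · L · Q)) ιn ⟩
      L · ((pos 2 / 1) · ((1ℚ + (1ℚ + v)) · (1ℚ + (1ℚ + v))) · L · Q)
        ≤⟨ ≤-by (L · (pos 2 / 1) · (v · (1ℚ + (1ℚ + v))) · L · Q)
             (0≤ι l ⊛ ℚ.nonNegative⁻¹ (pos 2 / 1) ⊛ (0≤ι ν ⊛ (0≤1 ⊕ (0≤1 ⊕ 0≤ι ν))) ⊛ 0≤ι l ⊛ 0≤Q)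
             (solve 3 (λ L v Q → con (pos 4 / 1) :* ((con 1ℚ :+ v) :* L :* ((con 1ℚ :+ (con 1ℚ :+ v)) :* L) :* Q)
               := L :* (con (pos 2 / 1) :* ((con 1ℚ :+ (con 1ℚ :+ v)) :* (con 1ℚ :+ (con 1ℚ :+ v))) :* L :* Q)
                  :+ L :* con (pos 2 / 1) :* (v :* (con 1ℚ :+ (con 1ℚ :+ v))) :* L :* Q) refl L v Q) ⟩
      (pos 4 / 1) · ((1ℚ + v) · L · ((1ℚ + (1ℚ + v)) · L) · Q)
        ≡⟨ cong₂ (λ x y → (pos 4 / 1) · (x · L · (y · L) · Q)) (ι-suc ν) ιn ⟨
      (pos 4 / 1) · (ι (suc ν) · L · (ι n · L) · Q)
        ≡⟨ cong₂ (λ x y → (pos 4 / 1) · (x · y · Q)) (ι-* (suc ν) l) (ι-* n l) ⟨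
      (pos 4 / 1) · (ι (suc ν ℕ.* l) · ι (n ℕ.* l) · Q)
        ≤⟨ *-monoˡ (pos 4 / 1) (ℚ.nonNegative⁻¹ (pos 4 / 1)) (*-monoʳ Q 0≤Q (*-mono (0≤ι (n ℕ.* l)) (0≤ι (suc q)) (ι-mono [n-1]l≤) (ι-mono nl≤))) ⟩
      (pos 4 / 1) · (ι (suc q) · ι (suc n′) · Q)
        ≤⟨ variance ⟩
      L · r ∎)
      where open ℚ.≤-Reasoning

    0<r : 0ℚ < r
    0<r = 0<ι ∣ R ∣ {{ℕ.>-nonZero (ℕ.≤-<-trans ℕ.z≤n nl<∣R∣)}}

    nL≤r : ι n · L ≲ r
    nL≤r = subst (_≲ r) (ι-* n l) (ι-mono (ℕ.<⇒≤ nl<∣R∣))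

    -- From `upper`, r (c - a) ≤ l c ≤ l, and n l ≤ r. For negative changes `power-bound` relies on
    -- 0 ≤ 1 + z, which is 0 ≤ A C divided by A R.
    D≤ : ∀ {x C} → Split 1 R x C → D x ≲ recip n
    D≤ {x} {C} s = begin
      D x                      ≡⟨ D≡ s ⟩
      c - a                    ≡⟨ ℚ.*-identityˡ (c - a) ⟨
      1ℚ · (c - a)             ≡⟨ cong (_· (c - a)) (recip-cancel n) ⟨
      recip n · ι n · (c - a)  ≡⟨ ℚ.*-assoc (recip n) (ι n) (c - a) ⟩
      recip n · (ι n · (c - a)) ≤⟨ *-monoˡ (recip n) (0≤recip n) n[c-a]≤1 ⟩
      recip n · 1ℚ             ≡⟨ ℚ.*-identityʳ (recip n) ⟩
      recip n                  ∎
      where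
      open ℚ.≤-Reasoning
      c = α C
      ιq = ι (suc q)
      r≡ : r ≡ L + ιq
      r≡ = trans (cong ι ∣R∣≡) (ι-+ l (suc q))
      ∣C∣≥l : l ℕ.≤ ∣ C ∣
      ∣C∣≥l = subst (l ℕ.≤_) (ℕ.suc-injective (trans (sym ∣R∣′) (split-size s))) (ℕ.≤-trans (ℕ.m≤m+n l (suc ν ℕ.* l)) nl≤)
      n[c-a]≤1 : ι n · (c - a) ≲ 1ℚ
      n[c-a]≤1 = *-cancelˡ r 0<r (begin
        r · (ι n · (c - a))            ≡⟨ solve 4 (λ r n c a → r :* (n :* (c :- a)) := n :* (r :* c) :- n :* (r :* a)) refl r (ι n) c a ⟩
        ι n · (r · c) - ι n · (r · a)  ≤⟨ ≤-by (ι n · (r · a - ιq · c)) (0≤ι n ⊛ x≤y⇒0≤y-x (upper s))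
                                            (trans (solve 5 (λ n L q c x → n :* L :* c := (n :* ((L :+ q) :* c) :- n :* x) :+ n :* (x :- q :* c)) refl
                                                     (ι n) L ιq c (r · a))
                                              (cong (λ x → (ι n · (x · c) - ι n · (r · a)) + ι n · (r · a - ιq · c)) (sym r≡))) ⟩
        ι n · L · c                    ≤⟨ *-mono (0≤α C) (ℚ.<⇒≤ 0<r) nL≤r (α≤1 C ∣C∣≥l) ⟩
        r · 1ℚ                         ∎)

    ∑-quadratic : ∀ c₁ c₂ → ∑ 1 R (λ x _ → 1ℚ + (c₁ · D x + c₂ · (D x · D x))) ≡ r + c₂ · Q
    ∑-quadratic c₁ c₂ = begin
      ∑ 1 R (λ x _ → 1ℚ + (c₁ · D x + c₂ · (D x · D x)))
        ≡⟨ ∑-+ 1 R (λ _ _ → 1ℚ) (λ x _ → c₁ · D x + c₂ · (D x · D x)) ⟩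
      ∑ 1 R (λ _ _ → 1ℚ) + ∑ 1 R (λ x _ → c₁ · D x + c₂ · (D x · D x))
        ≡⟨ cong₂ _+_ (∑1-const 1ℚ) (∑-+ 1 R (λ x _ → c₁ · D x) (λ x _ → c₂ · (D x · D x))) ⟩
      r · 1ℚ + (∑ 1 R (λ x _ → c₁ · D x) + ∑ 1 R (λ x _ → c₂ · (D x · D x)))
        ≡⟨ cong₂ (λ x y → r · 1ℚ + (x + y)) (trans (∑-* c₁ 1 R (λ x _ → D x)) (cong (c₁ ·_) ∑D≡0)) (∑-* c₂ 1 R (λ x _ → D x · D x)) ⟩
      r · 1ℚ + (c₁ · 0ℚ + c₂ · Q)
        ≡⟨ solve 3 (λ r c x → r :* con 1ℚ :+ (c :* con 0ℚ :+ x) := r :+ x) refl r c₁ (c₂ · Q) ⟩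
      r + c₂ · Q ∎
      where open ≡-Reasoning

    -- With i = 1 / A R the relative change of A is z = μ i D x. In the second-order expansion the
    -- linear terms cancel by the martingale property, and the quadratic ones give c₂ Q ≤ r κ.
    step′ : ∀ i → A R · i ≡ 1ℚ → 0ℚ ≲ i → i ≲ 1ℚ → ∑ 1 R (λ _ C → A C ^ p) ≲ r · ((1ℚ + κ) · A R ^ p)
    step′ i Ai 0≤i i≤1 = begin
      ∑ 1 R (λ _ C → A C ^ p)
        ≤⟨ ∑-mono 1 R pointwise ⟩
      ∑ 1 R (λ x _ → A R ^ p · (1ℚ + (c₁ · D x + c₂ · (D x · D x))))
        ≡⟨ ∑-* (A R ^ p) 1 R (λ x _ → 1ℚ + (c₁ · D x + c₂ · (D x · D x))) ⟩
      A R ^ p · ∑ 1 R (λ x _ → 1ℚ + (c₁ · D x + c₂ · (D x · D x)))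
        ≡⟨ cong (A R ^ p ·_) (∑-quadratic c₁ c₂) ⟩
      A R ^ p · (r + c₂ · Q)
        ≤⟨ *-monoˡ (A R ^ p) (0≤^ p (0≤A R)) (ℚ.+-monoʳ-≤ r c₂Q≤) ⟩
      A R ^ p · (r + r · κ)
        ≡⟨ solve 3 (λ x r k → x :* (r :+ r :* k) := r :* ((con 1ℚ :+ k) :* x)) refl (A R ^ p) r κ ⟩
      r · ((1ℚ + κ) · A R ^ p) ∎
      where
      open ℚ.≤-Reasoning
      c₁ c₂ ζ : ℚ
      c₁ = P · (μ · i)
      c₂ = (pos 3 / 4) · (P · P) · (μ · i · (μ · i))
      ζ = μ · recip n

      c₂Q≤ : c₂ · Q ≲ r · κ
      c₂Q≤ = begin
        c₂ · Q
          ≡⟨ cong (λ P → (pos 3 / 4) · (P · P) · (μ · i · (μ · i)) · Q) ιp ⟩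
        (pos 3 / 4) · ((ι n + ι n) · (ι n + ι n)) · (μ · i · (μ · i)) · Q
          ≡⟨ solve 4 (λ n μ i Q → con (pos 3 / 4) :* ((n :+ n) :* (n :+ n)) :* (μ :* i :* (μ :* i)) :* Q
               := con (pos 3 / 1) :* (n :* n) :* (μ :* μ) :* Q :* (i :* i)) refl (ι n) μ i Q ⟩
        (pos 3 / 1) · (ι n · ι n) · (μ · μ) · Q · (i · i)
          ≤⟨ *-monoˡ _ (ℚ.nonNegative⁻¹ (pos 3 / 1) ⊛ (0≤ι n ⊛ 0≤ι n) ⊛ 0≤sq μ ⊛ 0≤Q) (*-mono {y = 1ℚ} {v = 1ℚ} 0≤i 0≤1 i≤1 i≤1) ⟩
        (pos 3 / 1) · (ι n · ι n) · (μ · μ) · Q · 1ℚ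
          ≡⟨ cong ((pos 3 / 1) · (ι n · ι n) · (μ · μ) · Q ·_) (sym (recip-cancel l)) ⟩
        (pos 3 / 1) · (ι n · ι n) · (μ · μ) · Q · (g · L)
          ≡⟨ solve 5 (λ n μ Q g L → con (pos 3 / 1) :* (n :* n) :* (μ :* μ) :* Q :* (g :* L)
               := con (pos 3 / 2) :* (μ :* μ) :* g :* (con (pos 2 / 1) :* (n :* n) :* L :* Q)) refl (ι n) μ Q g L ⟩
        κ · ((pos 2 / 1) · (ι n · ι n) · L · Q)
          ≤⟨ *-monoˡ κ 0≤κ Q-bound ⟩
        κ · r
          ≡⟨ ℚ.*-comm κ r ⟩
        r · κ ∎

      0≤ζ : 0ℚ ≲ ζ
      0≤ζ = 0≤μ ⊛ 0≤recip n

      -- For p = 2n and ζ = μ / n this is 4μ ≤ 1, the origin of the restriction on μ.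
      Pζ : P · ζ + P · ζ ≲ 1ℚ
      Pζ = begin
        P · ζ + P · ζ                        ≡⟨ cong (λ P → P · ζ + P · ζ) ιp ⟩
        (ι n + ι n) · ζ + (ι n + ι n) · ζ    ≡⟨ solve 3 (λ n μ g → (n :+ n) :* (μ :* g) :+ (n :+ n) :* (μ :* g) := con (pos 4 / 1) :* μ :* (g :* n)) refl (ι n) μ (recip n) ⟩
        (pos 4 / 1) · μ · (recip n · ι n)      ≡⟨ trans (cong ((pos 4 / 1) · μ ·_) (recip-cancel n)) (ℚ.*-identityʳ ((pos 4 / 1) · μ)) ⟩
        (pos 4 / 1) · μ                        ≤⟨ 4μ≤1 ⟩
        1ℚ                                   ∎

      pointwise : ∀ {x C} → Split 1 R x C → A C ^ p ≲ A R ^ p · (1ℚ + (c₁ · D x + c₂ · (D x · D x)))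
      pointwise {x} {C} s = begin
        A C ^ p                   ≡⟨ cong (_^ p) AC ⟩
        (A R · (1ℚ + z)) ^ p      ≡⟨ *-^ (A R) (1ℚ + z) p ⟩
        A R ^ p · (1ℚ + z) ^ p    ≤⟨ *-monoˡ (A R ^ p) (0≤^ p (0≤A R)) (power-bound p ζ z 0≤ζ Pζ z≤ζ 0≤1+z p ℕ.≤-refl) ⟩
        A R ^ p · (1ℚ + P · z + (pos 3 / 4) · (P · P) · (z · z))
          ≡⟨ cong (A R ^ p ·_) (solve 4 (λ P μ i d → con 1ℚ :+ P :* (μ :* (i :* d)) :+ con (pos 3 / 4) :* (P :* P) :* (μ :* (i :* d) :* (μ :* (i :* d)))
               := con 1ℚ :+ (P :* (μ :* i) :* d :+ con (pos 3 / 4) :* (P :* P) :* (μ :* i :* (μ :* i)) :* (d :* d))) refl P μ i (D x)) ⟩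
        A R ^ p · (1ℚ + (c₁ · D x + c₂ · (D x · D x))) ∎
        where
        z = μ · (i · D x)
        AC′ : A C ≡ A R + μ · D x
        AC′ = trans (solve 3 (λ μ a c → con 1ℚ :+ μ :* c := (con 1ℚ :+ μ :* a) :+ μ :* (c :- a)) refl μ a (α C)) (cong (λ d → A R + μ · d) (sym (D≡ s)))
        AC : A C ≡ A R · (1ℚ + z)
        AC = trans AC′ (trans (cong (λ d → A R + μ · d) (trans (sym (ℚ.*-identityˡ (D x))) (cong (_· D x) (sym Ai))))
          (solve 4 (λ A μ i d → A :+ μ :* (A :* i :* d) := A :* (con 1ℚ :+ μ :* (i :* d))) refl (A R) μ i (D x)))
        0≤1+z : 0ℚ ≲ 1ℚ + z
        0≤1+z = subst (0ℚ ≲_) (trans (cong (i ·_) AC) (trans (solve 3 (λ i A y → i :* (A :* y) := (A :* i) :* y) refl i (A R) (1ℚ + z))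
          (trans (cong (_· (1ℚ + z)) Ai) (ℚ.*-identityˡ (1ℚ + z))))) (0≤i ⊛ 0≤A C)
        z≤ζ : z ≲ ζ
        z≤ζ = *-monoˡ μ 0≤μ (begin
          i · D x       ≤⟨ *-monoˡ i 0≤i (D≤ s) ⟩
          i · recip n   ≤⟨ *-monoʳ (recip n) (0≤recip n) i≤1 ⟩
          1ℚ · recip n  ≡⟨ ℚ.*-identityˡ (recip n) ⟩
          recip n       ∎)

    step : ∑ 1 R (λ _ C → A C ^ p) ≲ r · ((1ℚ + κ) · A R ^ p)
    step = let i , Ai , 0≤i , i≤1 = inverse (1≤A R) in step′ i Ai 0≤i i≤1

  16μ²≤1 : (pos 16 / 1) · (μ · μ) ≲ 1ℚ
  16μ²≤1 = subst (_≲ 1ℚ) (solve 1 (λ μ → con (pos 4 / 1) :* μ :* (con (pos 4 / 1) :* μ) := con (pos 16 / 1) :* (μ :* μ)) refl μ)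
    (*-mono {y = 1ℚ} {v = 1ℚ} (ℚ.nonNegative⁻¹ (pos 4 / 1) ⊛ 0≤μ) 0≤1 4μ≤1 4μ≤1)

  -- By `compound` with l κ = 3μ²/2 it suffices that (1 - 3μ²/2)(1 + 7μ²/4) = 1 + μ²/4 - 21μ⁴/8 is
  -- at least 1, and 16μ² ≤ 1 leaves room to spare.
  growth : (1ℚ + κ) ^ l ≲ 1ℚ + (pos 7 / 4) · (μ · μ)
  growth = *-cancelˡ (1ℚ - x) 0<1-x (begin
    (1ℚ - x) · (1ℚ + κ) ^ l       ≡⟨ trans (ℚ.*-comm (1ℚ - x) _) (cong (λ y → (1ℚ + κ) ^ l · (1ℚ - y)) (sym lκ)) ⟩
    (1ℚ + κ) ^ l · (1ℚ - ι l · κ)  ≤⟨ compound κ 0≤κ l ⟩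
    1ℚ                             ≤⟨ ≤-by (μ · μ · ((pos 21 / 128) · (1ℚ - (pos 16 / 1) · (μ · μ)) + (pos 11 / 128)))
                                        (0≤sq μ ⊛ (ℚ.nonNegative⁻¹ (pos 21 / 128) ⊛ x≤y⇒0≤y-x 16μ²≤1 ⊕ ℚ.nonNegative⁻¹ (pos 11 / 128)))
                                        (solve 1 (λ μ → (con 1ℚ :- con (pos 3 / 2) :* (μ :* μ)) :* (con 1ℚ :+ con (pos 7 / 4) :* (μ :* μ))
                                          := con 1ℚ :+ μ :* μ :* (con (pos 21 / 128) :* (con 1ℚ :- con (pos 16 / 1) :* (μ :* μ)) :+ con (pos 11 / 128))) refl μ) ⟩
    (1ℚ - x) · (1ℚ + (pos 7 / 4) · (μ · μ)) ∎)
    where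
    open ℚ.≤-Reasoning
    x = (pos 3 / 2) · (μ · μ)
    lκ : ι l · κ ≡ x
    lκ = trans (solve 3 (λ L x g → L :* (x :* g) := x :* (g :* L)) refl (ι l) x (recip l)) (trans (cong (x ·_) (recip-cancel l)) (ℚ.*-identityʳ x))
    0<1-x : 0ℚ < 1ℚ - x
    0<1-x = ℚ.<-≤-trans (ℚ.positive⁻¹ ½) (≤-by ((pos 3 / 32) · (1ℚ - (pos 16 / 1) · (μ · μ)) + (pos 13 / 32))
      (ℚ.nonNegative⁻¹ (pos 3 / 32) ⊛ x≤y⇒0≤y-x 16μ²≤1 ⊕ ℚ.nonNegative⁻¹ (pos 13 / 32))
      (solve 1 (λ μ → con 1ℚ :- con (pos 3 / 2) :* (μ :* μ)
        := con ½ :+ (con (pos 3 / 32) :* (con 1ℚ :- con (pos 16 / 1) :* (μ :* μ)) :+ con (pos 13 / 32))) refl μ))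

  w : Subset m → ℚ
  w B = 1ℚ + μ · f B

  E : ℚ
  E = 1ℚ + μ · μ

  0≤w : ∀ B → 0ℚ ≲ w B
  0≤w B = 0≤1 ⊕ 0≤μ ⊛ 0≤f B

  module _ (R : Subset m) where

    private
      a N : ℚ
      a = α R
      N = ι (choose ∣ R ∣ l)

    ∑w : l ℕ.≤ ∣ R ∣ → ∑ l R (λ B _ → w B) ≡ N · A R
    ∑w l≤ = trans (∑-+ l R _ _) (trans (cong₂ _+_ (∑-1 l R) (trans (∑-* μ l R _) (cong (μ ·_) (sym (αN≡S R l≤)))))
      (solve 3 (λ N μ a → N :+ μ :* (a :* N) := N :* (con 1ℚ :+ μ :* a)) refl N μ a))

    -- As f² ≤ f, the mean of w² is at most 1 + 2μa + μ²a = A² + μ² a (1 - a), and a (1 - a) ≤ ¼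
    -- while A ≥ 1.
    ∑w² : l ℕ.≤ ∣ R ∣ → ∑ l R (λ B _ → w B · w B) ≲ N · (A R · A R · (1ℚ + (pos 1 / 4) · (μ · μ)))
    ∑w² l≤ = begin
      ∑ l R (λ B _ → w B · w B)
        ≤⟨ ∑-mono l R (λ {B} _ → ≤-by (μ · μ · (f B · (1ℚ - f B))) (0≤sq μ ⊛ (0≤f B ⊛ x≤y⇒0≤y-x (f≤1 B)))
             (solve 2 (λ μ f → con 1ℚ :+ (μ :+ μ :+ μ :* μ) :* f := (con 1ℚ :+ μ :* f) :* (con 1ℚ :+ μ :* f) :+ μ :* μ :* (f :* (con 1ℚ :- f))) refl μ (f B))) ⟩
      ∑ l R (λ B _ → 1ℚ + (μ + μ + μ · μ) · f B)
        ≡⟨ trans (∑-+ l R _ _) (cong₂ _+_ (∑-1 l R) (trans (∑-* (μ + μ + μ · μ) l R _) (cong ((μ + μ + μ · μ) ·_) (sym (αN≡S R l≤))))) ⟩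
      N + (μ + μ + μ · μ) · (a · N)
        ≤⟨ ≤-by (N · (μ · μ · ((a - ½) · (a - ½) + (A R · A R - 1ℚ) · (pos 1 / 4))))
             (0≤ι _ ⊛ (0≤sq μ ⊛ (0≤sq (a - ½) ⊕ x≤y⇒0≤y-x (*-mono {1ℚ} {A R} {1ℚ} {A R} 0≤1 (0≤A R) (1≤A R) (1≤A R)) ⊛ ℚ.nonNegative⁻¹ (pos 1 / 4))))
             (solve 3 (λ N μ a → N :* ((con 1ℚ :+ μ :* a) :* (con 1ℚ :+ μ :* a) :* (con 1ℚ :+ con (pos 1 / 4) :* (μ :* μ)))
               := N :+ (μ :+ μ :+ μ :* μ) :* (a :* N)
                  :+ N :* (μ :* μ :* ((a :- con ½) :* (a :- con ½) :+ ((con 1ℚ :+ μ :* a) :* (con 1ℚ :+ μ :* a) :- con 1ℚ) :* con (pos 1 / 4)))) refl N μ a) ⟩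
      N · (A R · A R · (1ℚ + (pos 1 / 4) · (μ · μ))) ∎
      where open ℚ.≤-Reasoning

    ∑α : l ℕ.+ l ℕ.≤ ∣ R ∣ → ∑ l R (λ _ C → α C) ≲ N · a
    ∑α h = ℚ.≤-trans (∑-iterate 1ℚ 0≤1 α l step l R h)
      (ℚ.≤-reflexive (cong (N ·_) (trans (cong (_· a) (1^ l)) (ℚ.*-identityˡ a))))
      where
      step : ∀ C → l ℕ.< ∣ C ∣ → ∑ 1 C (λ _ E → α E) ≲ ι ∣ C ∣ · (1ℚ · α C)
      step C l<∣C∣ = ℚ.≤-reflexive (trans (Remove.average C (∣ C ∣ ℕ.∸ suc l) (sym (trans (ℕ.+-suc l _) (ℕ.m+[n∸m]≡n l<∣C∣))))
        (cong (ι ∣ C ∣ ·_) (sym (ℚ.*-identityˡ (α C)))))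

  -- The exponents 0 and 1 are treated directly, since `Q-bound` starts at 2. From there on,
  -- squaring A C ^ n produces the exponent 2n of `Step`.
  set-step : ∀ n R → suc n ℕ.* l ℕ.≤ ∣ R ∣ →
    ∑ l R (λ B C → w B · A C ^ n) ≲ ι (choose ∣ R ∣ l) · (A R ^ suc n · E)
  set-step zero R h = begin
    ∑ l R (λ B C → w B · 1ℚ)   ≡⟨ ∑-cong l R (λ {B} _ → ℚ.*-identityʳ (w B)) ⟩
    ∑ l R (λ B _ → w B)        ≡⟨ ∑w R (subst (ℕ._≤ ∣ R ∣) (ℕ.+-identityʳ l) h) ⟩
    N · A R                    ≤⟨ ≤-by (N · (A R · (μ · μ))) (0≤ι _ ⊛ (0≤A R ⊛ 0≤sq μ))
                                    (solve 3 (λ N A μ → N :* (A :* con 1ℚ :* (con 1ℚ :+ μ :* μ)) := N :* A :+ N :* (A :* (μ :* μ))) refl N (A R) μ) ⟩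
    N · (A R · 1ℚ · E)         ∎
    where
    open ℚ.≤-Reasoning
    N = ι (choose ∣ R ∣ l)
  set-step (suc zero) R h = begin
    ∑ l R (λ B C → w B · (A C · 1ℚ))
      -- The product f B · α C couples B with the rest; bounding it by 1 costs μ², which E allows,
      -- and leaves terms with known means.
      ≤⟨ ∑-mono l R (λ {B} {C} s → ≤-by (μ · μ · (1ℚ - f B · α C)) (0≤sq μ ⊛ x≤y⇒0≤y-x
           (*-mono {f B} {1ℚ} {α C} {1ℚ} (0≤α C) 0≤1 (f≤1 B) (α≤1 C (l≤∣C∣ s))))
           (solve 3 (λ μ f c → (con 1ℚ :+ μ :* f) :+ (μ :* c :+ μ :* μ)
             := (con 1ℚ :+ μ :* f) :* ((con 1ℚ :+ μ :* c) :* con 1ℚ) :+ μ :* μ :* (con 1ℚ :- f :* c)) refl μ (f B) (α C))) ⟩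
    ∑ l R (λ B C → w B + (μ · α C + μ · μ))
      ≡⟨ trans (∑-+ l R _ _) (cong₂ _+_ (∑w R l≤) (trans (∑-+ l R _ _) (cong₂ _+_ (∑-* μ l R _) (∑-const (μ · μ) l R)))) ⟩
    N · A R + (μ · ∑ l R (λ _ C → α C) + μ · μ · N)
      ≤⟨ ℚ.+-monoʳ-≤ (N · A R) (ℚ.+-monoˡ-≤ (μ · μ · N) (*-monoˡ μ 0≤μ (∑α R 2l≤))) ⟩
    N · A R + (μ · (N · α R) + μ · μ · N)
      ≤⟨ ≤-by (N · (μ · μ · (α R · α R) + (A R · A R - 1ℚ) · (μ · μ)))
           (0≤ι _ ⊛ (0≤sq μ ⊛ 0≤sq (α R) ⊕ x≤y⇒0≤y-x (*-mono {1ℚ} {A R} {1ℚ} {A R} 0≤1 (0≤A R) (1≤A R) (1≤A R)) ⊛ 0≤sq μ))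
           (solve 3 (λ N μ a → N :* ((con 1ℚ :+ μ :* a) :* ((con 1ℚ :+ μ :* a) :* con 1ℚ) :* (con 1ℚ :+ μ :* μ))
             := N :* (con 1ℚ :+ μ :* a) :+ (μ :* (N :* a) :+ μ :* μ :* N)
               :+ N :* (μ :* μ :* (a :* a) :+ ((con 1ℚ :+ μ :* a) :* (con 1ℚ :+ μ :* a) :- con 1ℚ) :* (μ :* μ))) refl N μ (α R)) ⟩
    N · (A R · (A R · 1ℚ) · E) ∎
    where
    open ℚ.≤-Reasoning
    N = ι (choose ∣ R ∣ l)
    2l≤ : l ℕ.+ l ℕ.≤ ∣ R ∣
    2l≤ = subst (λ x → l ℕ.+ x ℕ.≤ ∣ R ∣) (ℕ.+-identityʳ l) h
    l≤ : l ℕ.≤ ∣ R ∣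
    l≤ = ℕ.≤-trans (ℕ.m≤m+n l l) 2l≤
    l≤∣C∣ : ∀ {B C} → Split l R B C → l ℕ.≤ ∣ C ∣
    l≤∣C∣ {C = C} s = ℕ.+-cancelˡ-≤ l l ∣ C ∣ (subst (l ℕ.+ l ℕ.≤_) (split-size s) 2l≤)
  set-step n@(suc (suc ν)) R h = *-cancelˡ (X + X) (ℚ.<-≤-trans 0<1 1≤2X) (begin
    (X + X) · ∑ l R (λ B C → w B · A C ^ n)
      ≡⟨ ∑-* (X + X) l R _ ⟨
    ∑ l R (λ B C → (X + X) · (w B · A C ^ n))
      ≤⟨ ∑-mono l R amgm ⟩
    ∑ l R (λ B C → y · y · (w B · w B) + A R · A R · A C ^ (n ℕ.+ n))
      ≡⟨ trans (∑-+ l R _ _) (cong₂ _+_ (∑-* (y · y) l R _) (∑-* (A R · A R) l R _)) ⟩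
    y · y · ∑ l R (λ B _ → w B · w B) + A R · A R · ∑ l R (λ _ C → A C ^ (n ℕ.+ n))
      ≤⟨ ℚ.+-mono-≤ (*-monoˡ (y · y) (0≤sq y) (∑w² R l≤)) (*-monoˡ (A R · A R) (0≤sq (A R)) removal) ⟩
    y · y · (N · (A R · A R · (1ℚ + (pos 1 / 4) · (μ · μ)))) + A R · A R · (N · ((1ℚ + (pos 7 / 4) · (μ · μ)) · (y · y)))
      ≡⟨ solve 4 (λ y N A μ → y :* y :* (N :* (A :* A :* (con 1ℚ :+ con (pos 1 / 4) :* (μ :* μ)))) :+ A :* A :* (N :* ((con 1ℚ :+ con (pos 7 / 4) :* (μ :* μ)) :* (y :* y)))
           := (A :* y :+ A :* y) :* (N :* (A :* y :* (con 1ℚ :+ μ :* μ)))) refl y N (A R) μ ⟩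
    (X + X) · (N · (A R ^ suc n · E)) ∎)
    where
    open ℚ.≤-Reasoning
    N y X : ℚ
    N = ι (choose ∣ R ∣ l)
    y = A R ^ n
    X = A R ^ suc n
    1≤2X : 1ℚ ≲ X + X
    1≤2X = ℚ.≤-trans (1≤^ (suc n) (1≤A R)) (≤-by X (0≤^ (suc n) (0≤A R)) refl)
    l≤ : l ℕ.≤ ∣ R ∣
    l≤ = ℕ.≤-trans (ℕ.m≤m+n l _) h
    -- Applied to y · w B and A R · A C ^ n: the factors y = A R ^ n and A R bring both squares to
    -- the scale A R ^ (2n + 2). Unlike the Cauchy-Schwarz inequality this takes no square root, so
    -- it stays within ℚ.
    amgm : ∀ {B C} → Split l R B C → (X + X) · (w B · A C ^ n) ≲ y · y · (w B · w B) + A R · A R · A C ^ (n ℕ.+ n)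
    amgm {B} {C} _ = ≤-by ((y · w B - A R · c) · (y · w B - A R · c)) (0≤sq (y · w B - A R · c))
      (trans (cong (λ x → y · y · (w B · w B) + A R · A R · x) (^-double (A C) n))
        (solve 4 (λ y w A c → y :* y :* (w :* w) :+ A :* A :* (c :* c)
          := (A :* y :+ A :* y) :* (w :* c) :+ (y :* w :- A :* c) :* (y :* w :- A :* c)) refl y (w B) (A R) c))
      where c = A C ^ n
    removal : ∑ l R (λ _ C → A C ^ (n ℕ.+ n)) ≲ N · ((1ℚ + (pos 7 / 4) · (μ · μ)) · (y · y))
    removal = begin
      ∑ l R (λ _ C → A C ^ (n ℕ.+ n))
        ≤⟨ ∑-iterate (1ℚ + κ) (0≤1 ⊕ 0≤κ) (λ C → A C ^ (n ℕ.+ n)) (n ℕ.* l) (λ C h → Step.step ν (n ℕ.+ n) refl C h) l R h ⟩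
      N · ((1ℚ + κ) ^ l · A R ^ (n ℕ.+ n))
        ≤⟨ *-monoˡ N (0≤ι _) (*-monoʳ (A R ^ (n ℕ.+ n)) (0≤^ (n ℕ.+ n) (0≤A R)) growth) ⟩
      N · ((1ℚ + (pos 7 / 4) · (μ · μ)) · A R ^ (n ℕ.+ n))
        ≡⟨ cong (λ x → N · ((1ℚ + (pos 7 / 4) · (μ · μ)) · x)) (^-double (A R) n) ⟩
      N · ((1ℚ + (pos 7 / 4) · (μ · μ)) · (y · y)) ∎

  moment-bound : ∀ n R → n ℕ.* l ℕ.≤ ∣ R ∣ → matchingSum l w n R ≲ ι (matchingCount l n ∣ R ∣) · (A R ^ n · E ^ n)
  moment-bound zero    R h = ℚ.≤-reflexive (sym (cong (_· (1ℚ · 1ℚ)) (ι≡/1 1)))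
  moment-bound (suc n) R h = begin
    ∑ l R (λ B C → w B · matchingSum l w n C)
      ≤⟨ ∑-mono l R (λ {B} {C} s → ℚ.≤-trans (*-monoˡ (w B) (0≤w B) (ℚ.≤-trans (moment-bound n C (rest s))
           (ℚ.≤-reflexive (cong (λ r → ι (matchingCount l n r) · (A C ^ n · E ^ n)) (split-∸ s)))))
           (ℚ.≤-reflexive (solve 4 (λ w M a e → w :* (M :* (a :* e)) := M :* e :* (w :* a)) refl (w B) M (A C ^ n) (E ^ n)))) ⟩
    ∑ l R (λ B C → M · E ^ n · (w B · A C ^ n))
      ≡⟨ ∑-* (M · E ^ n) l R _ ⟩
    M · E ^ n · ∑ l R (λ B C → w B · A C ^ n)
      ≤⟨ *-monoˡ (M · E ^ n) (0≤ι _ ⊛ 0≤^ n (0≤1 ⊕ 0≤sq μ)) (set-step n R h) ⟩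
    M · E ^ n · (N · (A R ^ suc n · E))
      ≡⟨ solve 5 (λ M e N a E → M :* e :* (N :* (a :* E)) := N :* M :* (a :* (E :* e))) refl M (E ^ n) N (A R ^ suc n) E ⟩
    N · M · (A R ^ suc n · E ^ suc n)
      ≡⟨ cong (_· (A R ^ suc n · E ^ suc n)) (ι-* (choose ∣ R ∣ l) (matchingCount l n (∣ R ∣ ℕ.∸ l))) ⟨
    ι (matchingCount l (suc n) ∣ R ∣) · (A R ^ suc n · E ^ suc n) ∎
    where
    open ℚ.≤-Reasoning
    M N : ℚ
    M = ι (matchingCount l n (∣ R ∣ ℕ.∸ l))
    N = ι (choose ∣ R ∣ l)
    rest : ∀ {B C} → Split l R B C → n ℕ.* l ℕ.≤ ∣ C ∣
    rest {C = C} s = ℕ.+-cancelˡ-≤ l _ ∣ C ∣ (subst (l ℕ.+ n ℕ.* l ℕ.≤_) (split-size s) h)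

-- Partial sums of the exponential series

inv! : ℕ → ℚ
inv! k = (pos 1 / (k !)) {{k ℕ.!≢0}}

inv!-cancel : ∀ k → inv! k · ι (k !) ≡ 1ℚ
inv!-cancel k = trans (/-cancel 1 (k !) {{k ℕ.!≢0}}) (ι≡/1 1)

0≤inv! : ∀ k → 0ℚ ≲ inv! k
0≤inv! k = ℚ.nonNegative⁻¹ (inv! k) {{ℚ.normalize-nonNeg 1 (k !) {{k ℕ.!≢0}}}}

inv!-suc : ∀ k → ι (suc k) · inv! (suc k) ≡ inv! k
inv!-suc k = begin
  ι (suc k) · inv! (suc k)                       ≡⟨ ℚ.*-identityʳ _ ⟨
  ι (suc k) · inv! (suc k) · 1ℚ                  ≡⟨ cong (ι (suc k) · inv! (suc k) ·_) (inv!-cancel k) ⟨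
  ι (suc k) · inv! (suc k) · (inv! k · ι (k !))  ≡⟨ solve 4 (λ s a b f → s :* a :* (b :* f) := b :* (a :* (s :* f))) refl (ι (suc k)) (inv! (suc k)) (inv! k) (ι (k !)) ⟩
  inv! k · (inv! (suc k) · (ι (suc k) · ι (k !)))  ≡⟨ cong (λ x → inv! k · (inv! (suc k) · x)) (ι-* (suc k) (k !)) ⟨
  inv! k · (inv! (suc k) · ι (suc k !))          ≡⟨ cong (inv! k ·_) (inv!-cancel (suc k)) ⟩
  inv! k · 1ℚ                                    ≡⟨ ℚ.*-identityʳ (inv! k) ⟩
  inv! k                                         ∎
  where open ≡-Reasoning

expTerm-suc : ∀ k x → ι (suc k) · expTerm (suc k) x ≡ x · expTerm k x
expTerm-suc k x = trans (solve 4 (λ s x y c → s :* (x :* y :* c) := x :* (y :* (s :* c))) refl (ι (suc k)) x (x ^ k) (inv! (suc k)))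
  (cong (λ c → x · (x ^ k · c)) (inv!-suc k))

0≤expTerm : ∀ k {x} → 0ℚ ≲ x → 0ℚ ≲ expTerm k x
0≤expTerm k 0≤x = 0≤^ k 0≤x ⊛ 0≤inv! k

expTerm-mono : ∀ k {x y} → 0ℚ ≲ x → x ≲ y → expTerm k x ≲ expTerm k y
expTerm-mono k 0≤x x≤y = *-monoʳ (inv! k) (0≤inv! k) (^-mono k 0≤x x≤y)

expTerm-neg : ∀ k x → expTerm k (- x) ≡ expTerm k x ⊎ expTerm k (- x) ≡ - expTerm k x
expTerm-neg k x with go k
  where
  go : ∀ k → (- x) ^ k ≡ x ^ k ⊎ (- x) ^ k ≡ - (x ^ k)
  go zero = inj₁ refl
  go (suc k) with go k
  ... | inj₁ e = inj₂ (trans (cong (- x ·_) e) (solve 2 (λ x y → :- x :* y := :- (x :* y)) refl x (x ^ k)))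
  ... | inj₂ e = inj₁ (trans (cong (- x ·_) e) (solve 2 (λ x y → :- x :* :- y := x :* y) refl x (x ^ k)))
... | inj₁ e = inj₁ (cong (_· inv! k) e)
... | inj₂ e = inj₂ (trans (cong (_· inv! k) e) (sym (ℚ.neg-distribˡ-* (x ^ k) (inv! k))))

-- Even terms double and odd terms cancel.
0≤expTerm-pair : ∀ k {x} → 0ℚ ≲ x → 0ℚ ≲ expTerm k (- x) + expTerm k x
0≤expTerm-pair k {x} 0≤x with expTerm-neg k x
... | inj₁ e rewrite e = 0≤expTerm k 0≤x ⊕ 0≤expTerm k 0≤x
... | inj₂ e rewrite e = ℚ.≤-reflexive (sym (ℚ.+-inverseˡ (expTerm k x)))

expTerm≤^ : ∀ k {x} → 0ℚ ≲ x → expTerm k x ≲ x ^ k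
expTerm≤^ k {x} 0≤x = subst (expTerm k x ≲_) (ℚ.*-identityʳ (x ^ k)) (*-monoˡ (x ^ k) (0≤^ k 0≤x)
  (subst (_≲ 1ℚ) (ℚ.*-identityʳ (inv! k)) (subst (inv! k · 1ℚ ≲_) (inv!-cancel k) (*-monoˡ (inv! k) (0≤inv! k) (1≤ι {k !} {{k ℕ.!≢0}})))))

∑< : ℕ → (ℕ → ℚ) → ℚ
∑< zero    h = 0ℚ
∑< (suc n) h = ∑< n h + h n

∑<-mono : ∀ n {g h} → (∀ j → j ℕ.< n → g j ≲ h j) → ∑< n g ≲ ∑< n h
∑<-mono zero    g≤h = ℚ.≤-refl
∑<-mono (suc n) g≤h = ℚ.+-mono-≤ (∑<-mono n (λ j j<n → g≤h j (ℕ.m≤n⇒m≤1+n j<n))) (g≤h n ℕ.≤-refl)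

∑<-cong : ∀ n {g h} → (∀ j → j ℕ.< n → g j ≡ h j) → ∑< n g ≡ ∑< n h
∑<-cong zero    g≡h = refl
∑<-cong (suc n) g≡h = cong₂ _+_ (∑<-cong n (λ j j<n → g≡h j (ℕ.m≤n⇒m≤1+n j<n))) (g≡h n ℕ.≤-refl)

∑<-+ : ∀ n g h → ∑< n (λ j → g j + h j) ≡ ∑< n g + ∑< n h
∑<-+ zero    g h = refl
∑<-+ (suc n) g h = trans (cong (_+ (g n + h n)) (∑<-+ n g h))
  (solve 4 (λ a b c d → a :+ b :+ (c :+ d) := a :+ c :+ (b :+ d)) refl (∑< n g) (∑< n h) (g n) (h n))

∑<-* : ∀ c n g → ∑< n (λ j → c · g j) ≡ c · ∑< n g
∑<-* c zero    g = sym (ℚ.*-zeroʳ c)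
∑<-* c (suc n) g = trans (cong (_+ c · g n) (∑<-* c n g)) (sym (ℚ.*-distribˡ-+ c (∑< n g) (g n)))

∑<-shift : ∀ n h → ∑< (suc n) h ≡ h 0 + ∑< n (λ j → h (suc j))
∑<-shift zero    h = ℚ.+-comm 0ℚ (h 0)
∑<-shift (suc n) h = trans (cong (_+ h (suc n)) (∑<-shift n h)) (ℚ.+-assoc (h 0) _ (h (suc n)))

∑<-nonNeg : ∀ n {h} → (∀ j → 0ℚ ≲ h j) → 0ℚ ≲ ∑< n h
∑<-nonNeg zero    0≤h = ℚ.≤-refl
∑<-nonNeg (suc n) 0≤h = ∑<-nonNeg n 0≤h ⊕ 0≤h n

∑<-extend : ∀ {n n′} h → (∀ j → 0ℚ ≲ h j) → n ℕ.≤ n′ → ∑< n h ≲ ∑< n′ h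
∑<-extend {n} h 0≤h n≤n′ = subst (λ n′ → ∑< n h ≲ ∑< n′ h) (ℕ.m∸n+n≡m n≤n′) (go (_ ℕ.∸ n))
  where
  go : ∀ d → ∑< n h ≲ ∑< (d ℕ.+ n) h
  go zero    = ℚ.≤-refl
  go (suc d) = ℚ.≤-trans (go d) (≤-by (h (d ℕ.+ n)) (0≤h (d ℕ.+ n)) refl)

expSum≡∑< : ∀ n x → expSum n x ≡ ∑< n (λ j → expTerm j x)
expSum≡∑< zero    x = refl
expSum≡∑< (suc n) x = cong (_+ expTerm n x) (expSum≡∑< n x)

expSum-* : ∀ n x c → expSum n x · c ≡ ∑< n (λ j → expTerm j x · c)
expSum-* n x c = trans (ℚ.*-comm (expSum n x) c) (trans (cong (c ·_) (expSum≡∑< n x))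
  (trans (sym (∑<-* c n _)) (∑<-cong n (λ j _ → ℚ.*-comm c (expTerm j x)))))

0≤expSum : ∀ n {x} → 0ℚ ≲ x → 0ℚ ≲ expSum n x
0≤expSum n {x} 0≤x = subst (0ℚ ≲_) (sym (expSum≡∑< n x)) (∑<-nonNeg n (λ j → 0≤expTerm j 0≤x))

expSum-mono : ∀ n {x y} → 0ℚ ≲ x → x ≲ y → expSum n x ≲ expSum n y
expSum-mono zero    0≤x x≤y = ℚ.≤-refl
expSum-mono (suc n) 0≤x x≤y = ℚ.+-mono-≤ (expSum-mono n 0≤x x≤y) (expTerm-mono n 0≤x x≤y)

expSum-extend : ∀ {n n′ x} → 0ℚ ≲ x → n ℕ.≤ n′ → expSum n x ≲ expSum n′ x
expSum-extend {n} {n′} {x} 0≤x n≤n′ = subst₂ _≲_ (sym (expSum≡∑< n x)) (sym (expSum≡∑< n′ x))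
  (∑<-extend _ (λ j → 0≤expTerm j 0≤x) n≤n′)

-- The binomial theorem divided by n!. After multiplication by n + 1 = j + (n + 1 - j), each summand
-- splits into two in which one index drops by `expTerm-suc`; no binomial coefficients occur.
expTerm-+ : ∀ n x y → ∑< (suc n) (λ j → expTerm j x · expTerm (n ℕ.∸ j) y) ≡ expTerm n (x + y)
expTerm-+ zero    x y = refl
expTerm-+ (suc n) x y = cancel (begin
  s · ∑< (suc (suc n)) t
    ≡⟨ ∑<-* s (suc (suc n)) t ⟨
  ∑< (suc (suc n)) (λ j → s · t j)
    ≡⟨ ∑<-cong (suc (suc n)) split ⟩
  ∑< (suc (suc n)) (λ j → ι j · expTerm j x · expTerm (suc n ℕ.∸ j) y + expTerm j x · (ι (suc n ℕ.∸ j) · expTerm (suc n ℕ.∸ j) y))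
    ≡⟨ ∑<-+ (suc (suc n)) (λ j → ι j · expTerm j x · expTerm (suc n ℕ.∸ j) y) (λ j → expTerm j x · (ι (suc n ℕ.∸ j) · expTerm (suc n ℕ.∸ j) y)) ⟩
  ∑< (suc (suc n)) (λ j → ι j · expTerm j x · expTerm (suc n ℕ.∸ j) y) + ∑< (suc (suc n)) (λ j → expTerm j x · (ι (suc n ℕ.∸ j) · expTerm (suc n ℕ.∸ j) y))
    ≡⟨ cong₂ _+_ left right ⟩
  x · c + y · c
    ≡⟨ ℚ.*-distribʳ-+ c x y ⟨
  (x + y) · c
    ≡⟨ cong ((x + y) ·_) (expTerm-+ n x y) ⟩
  (x + y) · expTerm n (x + y)
    ≡⟨ expTerm-suc n (x + y) ⟨
  s · expTerm (suc n) (x + y) ∎)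
  where
  open ≡-Reasoning
  s = ι (suc n)
  c = ∑< (suc n) (λ j → expTerm j x · expTerm (n ℕ.∸ j) y)
  t : ℕ → ℚ
  t j = expTerm j x · expTerm (suc n ℕ.∸ j) y
  cancel : ∀ {u v} → s · u ≡ s · v → u ≡ v
  cancel e = ℚ.≤-antisym (*-cancelˡ s (0<ι (suc n)) (ℚ.≤-reflexive e)) (*-cancelˡ s (0<ι (suc n)) (ℚ.≤-reflexive (sym e)))
  split : ∀ j → j ℕ.< suc (suc n) →
    s · t j ≡ ι j · expTerm j x · expTerm (suc n ℕ.∸ j) y + expTerm j x · (ι (suc n ℕ.∸ j) · expTerm (suc n ℕ.∸ j) y)
  split j j< = trans (cong (_· t j) (trans (cong ι (sym (ℕ.m+[n∸m]≡n (ℕ.≤-pred j<)))) (ι-+ j (suc n ℕ.∸ j))))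
    (solve 4 (λ a b u v → (a :+ b) :* (u :* v) := a :* u :* v :+ u :* (b :* v)) refl (ι j) (ι (suc n ℕ.∸ j)) (expTerm j x) (expTerm (suc n ℕ.∸ j) y))
  left : ∑< (suc (suc n)) (λ j → ι j · expTerm j x · expTerm (suc n ℕ.∸ j) y) ≡ x · c
  left = begin
    ∑< (suc (suc n)) (λ j → ι j · expTerm j x · expTerm (suc n ℕ.∸ j) y)
      ≡⟨ ∑<-shift (suc n) (λ j → ι j · expTerm j x · expTerm (suc n ℕ.∸ j) y) ⟩
    ι 0 · expTerm 0 x · expTerm (suc n) y + ∑< (suc n) (λ j → ι (suc j) · expTerm (suc j) x · expTerm (n ℕ.∸ j) y)
      ≡⟨ cong₂ _+_ (trans (cong (λ z → z · expTerm 0 x · expTerm (suc n) y) (ι≡/1 0)) (solve 2 (λ a b → con 0ℚ :* a :* b := con 0ℚ) refl (expTerm 0 x) (expTerm (suc n) y)))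
           (trans (∑<-cong (suc n) (λ j _ → trans (cong (_· expTerm (n ℕ.∸ j) y) (expTerm-suc j x)) (ℚ.*-assoc x (expTerm j x) (expTerm (n ℕ.∸ j) y))))
             (∑<-* x (suc n) (λ j → expTerm j x · expTerm (n ℕ.∸ j) y))) ⟩
    0ℚ + x · c
      ≡⟨ ℚ.+-identityˡ (x · c) ⟩
    x · c ∎
  right : ∑< (suc (suc n)) (λ j → expTerm j x · (ι (suc n ℕ.∸ j) · expTerm (suc n ℕ.∸ j) y)) ≡ y · c
  right = begin
    ∑< (suc n) (λ j → expTerm j x · (ι (suc n ℕ.∸ j) · expTerm (suc n ℕ.∸ j) y)) + expTerm (suc n) x · (ι (n ℕ.∸ n) · expTerm (n ℕ.∸ n) y)
      ≡⟨ cong₂ _+_ (trans (∑<-cong (suc n) term) (∑<-* y (suc n) (λ j → expTerm j x · expTerm (n ℕ.∸ j) y)))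
           (trans (cong (λ z → expTerm (suc n) x · (z · expTerm (n ℕ.∸ n) y)) (trans (cong ι (ℕ.n∸n≡0 n)) (ι≡/1 0)))
             (solve 2 (λ a b → a :* (con 0ℚ :* b) := con 0ℚ) refl (expTerm (suc n) x) (expTerm (n ℕ.∸ n) y))) ⟩
    y · c + 0ℚ
      ≡⟨ ℚ.+-identityʳ (y · c) ⟩
    y · c ∎
    where
    term : ∀ j → j ℕ.< suc n → expTerm j x · (ι (suc n ℕ.∸ j) · expTerm (suc n ℕ.∸ j) y) ≡ y · (expTerm j x · expTerm (n ℕ.∸ j) y)
    term j j< = trans (cong (λ i → expTerm j x · (ι i · expTerm i y)) (ℕ.+-∸-assoc 1 (ℕ.≤-pred j<)))
      (trans (cong (expTerm j x ·_) (expTerm-suc (n ℕ.∸ j) y))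
        (solve 3 (λ a y b → a :* (y :* b) := y :* (a :* b)) refl (expTerm j x) y (expTerm (n ℕ.∸ j) y)))

-- The Cauchy product over the triangle i + j < n. The square i, j < n contains this triangle and
-- lies in the one of size 2n, which yields `expSum-+-≤` and `expSum-*-≤`.
expSum-+ : ∀ n x y → ∑< n (λ j → expTerm j x · expSum (n ℕ.∸ j) y) ≡ expSum n (x + y)
expSum-+ zero    x y = refl
expSum-+ (suc n) x y = begin
  ∑< (suc n) (λ j → expTerm j x · expSum (suc n ℕ.∸ j) y)
    ≡⟨ ∑<-cong (suc n) (λ j j< → trans (cong (λ i → expTerm j x · expSum i y) (ℕ.+-∸-assoc 1 (ℕ.≤-pred j<)))
         (ℚ.*-distribˡ-+ (expTerm j x) (expSum (n ℕ.∸ j) y) (expTerm (n ℕ.∸ j) y))) ⟩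
  ∑< (suc n) (λ j → expTerm j x · expSum (n ℕ.∸ j) y + expTerm j x · expTerm (n ℕ.∸ j) y)
    ≡⟨ ∑<-+ (suc n) (λ j → expTerm j x · expSum (n ℕ.∸ j) y) (λ j → expTerm j x · expTerm (n ℕ.∸ j) y) ⟩
  ∑< n (λ j → expTerm j x · expSum (n ℕ.∸ j) y) + expTerm n x · expSum (n ℕ.∸ n) y + ∑< (suc n) (λ j → expTerm j x · expTerm (n ℕ.∸ j) y)
    ≡⟨ cong₂ _+_ (trans (cong₂ _+_ (expSum-+ n x y) (trans (cong (λ i → expTerm n x · expSum i y) (ℕ.n∸n≡0 n)) (ℚ.*-zeroʳ (expTerm n x))))
         (ℚ.+-identityʳ (expSum n (x + y)))) (expTerm-+ n x y) ⟩
  expSum n (x + y) + expTerm n (x + y) ∎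
  where open ≡-Reasoning

expSum-+-≤ : ∀ n {x y} → 0ℚ ≲ x → 0ℚ ≲ y → expSum n (x + y) ≲ expSum n x · expSum n y
expSum-+-≤ n {x} {y} 0≤x 0≤y = subst₂ _≲_ (expSum-+ n x y) (sym (expSum-* n x (expSum n y)))
  (∑<-mono n (λ j _ → *-monoˡ (expTerm j x) (0≤expTerm j 0≤x) (expSum-extend 0≤y (ℕ.m∸n≤m n j))))

expSum-*-≤ : ∀ n {x y} → 0ℚ ≲ x → 0ℚ ≲ y → expSum n x · expSum n y ≲ expSum (n ℕ.+ n) (x + y)
expSum-*-≤ n {x} {y} 0≤x 0≤y = subst₂ _≲_ (sym (expSum-* n x (expSum n y))) (expSum-+ (n ℕ.+ n) x y) (ℚ.≤-trans
  (∑<-mono n (λ j j<n → *-monoˡ (expTerm j x) (0≤expTerm j 0≤x) (expSum-extend 0≤y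
    (ℕ.m+n≤o⇒m≤o∸n n (ℕ.+-monoʳ-≤ n (ℕ.<⇒≤ j<n))))))
  (∑<-extend _ (λ j → 0≤expTerm j 0≤x ⊛ 0≤expSum (n ℕ.+ n ℕ.∸ j) 0≤y) (ℕ.m≤m+n n n)))

expSum-0 : ∀ n → expSum (suc n) 0ℚ ≡ 1ℚ
expSum-0 zero    = refl
expSum-0 (suc n) = trans (cong₂ _+_ (expSum-0 n) (solve 2 (λ a b → con 0ℚ :* a :* b := con 0ℚ) refl (0ℚ ^ n) (inv! (suc n)))) refl

-- On the triangle the product of the sums at x and -x is exactly 1. On the rest of the square it is
-- at least minus the same part for x and x, by `0≤expTerm-pair`, and that part is at most the terms
-- of e^(2x) between n and 2n.
expSum-inverse : ∀ n {x} → 0ℚ ≲ x → 1ℚ - (expSum (suc n ℕ.+ suc n) (x + x) - expSum (suc n) (x + x)) ≲ expSum (suc n) x · expSum (suc n) (- x)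
expSum-inverse k {x} 0≤x = begin
  1ℚ - (expSum (n ℕ.+ n) (x + x) - expSum n (x + x))
    ≤⟨ ≤-by (expSum (n ℕ.+ n) (x + x) - expSum n x · expSum n x) (x≤y⇒0≤y-x (expSum-*-≤ n 0≤x 0≤x))
         (solve 3 (λ a b c → con 1ℚ :- (c :- b) := con 1ℚ :- (a :- b) :+ (a :- c)) refl (expSum (n ℕ.+ n) (x + x)) (expSum n (x + x)) (expSum n x · expSum n x)) ⟩
  1ℚ - (expSum n x · expSum n x - expSum n (x + x))
    ≡⟨ cong₂ (λ a b → 1ℚ - (a - b)) (expSum-* n x (expSum n x)) (sym (expSum-+ n x x)) ⟩
  1ℚ - (b - d)
    ≡⟨ cong (λ z → z - (b - d))
         (sym (trans (expSum-+ n x (- x)) (trans (cong (expSum n) (ℚ.+-inverseʳ x)) (expSum-0 k)))) ⟩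
  c - (b - d)
    ≤⟨ 0≤y-x⇒x≤y (subst (0ℚ ≲_) (solve 4 (λ a b c d → (a :+ b) :- (c :+ d) := a :- (c :- (b :- d))) refl a b c d) (x≤y⇒0≤y-x paired)) ⟩
  a ≡⟨ expSum-* n x (expSum n (- x)) ⟨
  expSum n x · expSum n (- x) ∎
  where
  open ℚ.≤-Reasoning
  n = suc k
  a b c d : ℚ
  a = ∑< n (λ j → expTerm j x · expSum n (- x))
  b = ∑< n (λ j → expTerm j x · expSum n x)
  c = ∑< n (λ j → expTerm j x · expSum (n ℕ.∸ j) (- x))
  d = ∑< n (λ j → expTerm j x · expSum (n ℕ.∸ j) x)
  pair-extend : ∀ {i} → i ℕ.≤ n → expSum i (- x) + expSum i x ≲ expSum n (- x) + expSum n x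
  pair-extend {i} i≤n = subst₂ _≲_ (eq i) (eq n) (∑<-extend _ (λ j → 0≤expTerm-pair j 0≤x) i≤n)
    where
    eq : ∀ i → ∑< i (λ j → expTerm j (- x) + expTerm j x) ≡ expSum i (- x) + expSum i x
    eq i = trans (∑<-+ i (λ j → expTerm j (- x)) (λ j → expTerm j x)) (sym (cong₂ _+_ (expSum≡∑< i (- x)) (expSum≡∑< i x)))
  paired : c + d ≲ a + b
  paired = subst₂ _≲_ (∑<-+ n _ _) (∑<-+ n _ _) (∑<-mono n (λ j _ → subst₂ _≲_
    (ℚ.*-distribˡ-+ (expTerm j x) _ _) (ℚ.*-distribˡ-+ (expTerm j x) _ _) (*-monoˡ (expTerm j x) (0≤expTerm j 0≤x) (pair-extend (ℕ.m∸n≤m n j)))))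

expSum-tail-mono : ∀ d n {x y} → 0ℚ ≲ x → x ≲ y → expSum (d ℕ.+ n) x - expSum n x ≲ expSum (d ℕ.+ n) y - expSum n y
expSum-tail-mono zero    n {x} {y} 0≤x x≤y = ℚ.≤-reflexive (trans (ℚ.+-inverseʳ (expSum n x)) (sym (ℚ.+-inverseʳ (expSum n y))))
expSum-tail-mono (suc d) n {x} {y} 0≤x x≤y = subst₂ _≲_ (eq x) (eq y)
  (ℚ.+-mono-≤ (expSum-tail-mono d n 0≤x x≤y) (expTerm-mono (d ℕ.+ n) 0≤x x≤y))
  where
  eq : ∀ x → expSum (d ℕ.+ n) x - expSum n x + expTerm (d ℕ.+ n) x ≡ expSum (suc d ℕ.+ n) x - expSum n x
  eq x = solve 3 (λ a b c → a :- b :+ c := a :+ c :- b) refl (expSum (d ℕ.+ n) x) (expSum n x) (expTerm (d ℕ.+ n) x)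

-- Termwise comparison with the geometric series: the form of eˣ ≤ 1 / (1 - x) for partial sums.
expSum-geometric : ∀ n {x} → 0ℚ ≲ x → x ≲ 1ℚ → expSum n x · (1ℚ - x) ≲ 1ℚ
expSum-geometric n {x} 0≤x x≤1 = ℚ.≤-trans (go n) (≤-by (x ^ n) (0≤^ n 0≤x) (solve 1 (λ y → con 1ℚ := con 1ℚ :- y :+ y) refl (x ^ n)))
  where
  go : ∀ n → expSum n x · (1ℚ - x) ≲ 1ℚ - x ^ n
  go zero    = ℚ.≤-reflexive (ℚ.*-zeroˡ (1ℚ - x))
  go (suc n) = subst₂ _≲_ (sym (ℚ.*-distribʳ-+ (1ℚ - x) (expSum n x) (expTerm n x)))
    (solve 2 (λ x y → con 1ℚ :- y :+ y :* (con 1ℚ :- x) := con 1ℚ :- x :* y) refl x (x ^ n))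
    (ℚ.+-mono-≤ (go n) (*-monoʳ (1ℚ - x) (x≤y⇒0≤y-x x≤1) (expTerm≤^ n 0≤x)))

expSum-*ι : ∀ n {x} → 0ℚ ≲ x → ∀ k → expSum (suc n) (ι k · x) ≲ expSum (suc n) x ^ k
expSum-*ι n {x} 0≤x zero    = ℚ.≤-reflexive (trans (cong (λ z → expSum (suc n) z) (trans (cong (_· x) (ι≡/1 0)) (ℚ.*-zeroˡ x))) (expSum-0 n))
expSum-*ι n {x} 0≤x (suc k) = begin
  expSum (suc n) (ι (suc k) · x)                     ≡⟨ cong (expSum (suc n)) (trans (cong (_· x) (ι-suc k)) (solve 2 (λ k x → (con 1ℚ :+ k) :* x := x :+ k :* x) refl (ι k) x)) ⟩
  expSum (suc n) (x + ι k · x)                       ≤⟨ expSum-+-≤ (suc n) 0≤x (0≤ι k ⊛ 0≤x) ⟩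
  expSum (suc n) x · expSum (suc n) (ι k · x)        ≤⟨ *-monoˡ (expSum (suc n) x) (0≤expSum (suc n) 0≤x) (expSum-*ι n 0≤x k) ⟩
  expSum (suc n) x · expSum (suc n) x ^ k            ∎
  where open ℚ.≤-Reasoning

-- Keeps the terms j = 0 and j = 1 of the convolution `expSum-+`. The truncation grows by one
-- because the term j = 1 is cut off one place earlier.
expSum-1+ : ∀ n {x y} → 0ℚ ≲ x → 0ℚ ≲ y → (1ℚ + x) · expSum n y ≲ expSum (suc n) (x + y)
expSum-1+ zero    {x} {y} 0≤x 0≤y = ℚ.≤-trans (ℚ.≤-reflexive (ℚ.*-zeroʳ (1ℚ + x))) (0≤expSum 1 (0≤x ⊕ 0≤y))
expSum-1+ (suc n) {x} {y} 0≤x 0≤y = begin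
  (1ℚ + x) · expSum (suc n) y
    ≤⟨ ≤-by (expTerm (suc n) y + rest) (0≤expTerm (suc n) 0≤y ⊕ ∑<-nonNeg n (λ j → 0≤expTerm (suc (suc j)) 0≤x ⊛ 0≤expSum (n ℕ.∸ j) 0≤y))
         (solve 4 (λ x s e r → con 1ℚ :* con 1ℚ :* (s :+ e) :+ (x :* con 1ℚ :* con 1ℚ :* s :+ r) := (con 1ℚ :+ x) :* s :+ (e :+ r)) refl x (expSum (suc n) y) (expTerm (suc n) y) rest) ⟩
  t 0 + (t 1 + rest)
    ≡⟨ trans (∑<-shift (suc n) t) (cong (t 0 +_) (∑<-shift n (λ j → t (suc j)))) ⟨
  ∑< (suc (suc n)) t
    ≡⟨ expSum-+ (suc (suc n)) x y ⟩
  expSum (suc (suc n)) (x + y) ∎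
  where
  open ℚ.≤-Reasoning
  t : ℕ → ℚ
  t j = expTerm j x · expSum (suc (suc n) ℕ.∸ j) y
  rest = ∑< n (λ j → t (suc (suc j)))

expSum-1+^ : ∀ k n {x y} → 0ℚ ≲ x → 0ℚ ≲ y → (1ℚ + x) ^ k · expSum n y ≲ expSum (k ℕ.+ n) (ι k · x + y)
expSum-1+^ zero    n {x} {y} 0≤x 0≤y = ℚ.≤-reflexive (trans (ℚ.*-identityˡ (expSum n y))
  (cong (expSum n) (sym (trans (cong (λ z → z · x + y) (ι≡/1 0)) (solve 2 (λ x y → con 0ℚ :* x :+ y := y) refl x y)))))
expSum-1+^ (suc k) n {x} {y} 0≤x 0≤y = begin
  (1ℚ + x) · (1ℚ + x) ^ k · expSum n y       ≡⟨ ℚ.*-assoc (1ℚ + x) ((1ℚ + x) ^ k) (expSum n y) ⟩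
  (1ℚ + x) · ((1ℚ + x) ^ k · expSum n y)     ≤⟨ *-monoˡ (1ℚ + x) (0≤1 ⊕ 0≤x) (expSum-1+^ k n 0≤x 0≤y) ⟩
  (1ℚ + x) · expSum (k ℕ.+ n) (ι k · x + y)  ≤⟨ expSum-1+ (k ℕ.+ n) 0≤x (0≤ι k ⊛ 0≤x ⊕ 0≤y) ⟩
  expSum (suc k ℕ.+ n) (x + (ι k · x + y))   ≡⟨ cong (expSum (suc k ℕ.+ n)) (trans (solve 3 (λ k x y → x :+ (k :* x :+ y) := (con 1ℚ :+ k) :* x :+ y) refl (ι k) x y)
                                                  (cong (λ z → z · x + y) (sym (ι-suc k)))) ⟩
  expSum (suc k ℕ.+ n) (ι (suc k) · x + y)   ∎
  where open ℚ.≤-Reasoning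

-- e^(μ/(1+μ)) ≤ 1+μ turns a power of 1+μ into an exponential from below, and 1+x ≤ eˣ the two other factors from above.
exp-tail : ∀ {μ a σ} η t n → 0ℚ ≲ μ → 0ℚ ≲ a → 0ℚ ≲ σ → η ℕ.≤ t →
  σ + (ι t · (μ · μ) + ι t · (μ · μ)) ≲ μ · (ι η - a · ι t) →
  (1ℚ + μ · a) ^ t · (1ℚ + μ · μ) ^ t · expSum n σ ≲ (1ℚ + μ) ^ η
exp-tail {μ} {a} {σ} η t n 0≤μ 0≤a 0≤σ η≤t h = go (inverse (≤-by μ 0≤μ refl))
  where
  open ℚ.≤-Reasoning
  x = μ · a
  y = μ · μ
  T = ι t
  X = T · x + (T · y + σ)
  0≤x : 0ℚ ≲ x
  0≤x = 0≤μ ⊛ 0≤a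
  0≤y : 0ℚ ≲ y
  0≤y = 0≤sq μ
  go : (∃ λ i → (1ℚ + μ) · i ≡ 1ℚ × 0ℚ ≲ i × i ≲ 1ℚ) → (1ℚ + x) ^ t · (1ℚ + y) ^ t · expSum n σ ≲ (1ℚ + μ) ^ η
  go (i , [1+μ]i , 0≤i , i≤1) = begin
    (1ℚ + x) ^ t · (1ℚ + y) ^ t · expSum n σ       ≡⟨ ℚ.*-assoc ((1ℚ + x) ^ t) ((1ℚ + y) ^ t) (expSum n σ) ⟩
    (1ℚ + x) ^ t · ((1ℚ + y) ^ t · expSum n σ)     ≤⟨ *-monoˡ ((1ℚ + x) ^ t) (0≤^ t (0≤1 ⊕ 0≤x)) (expSum-1+^ t n 0≤y 0≤σ) ⟩
    (1ℚ + x) ^ t · expSum (t ℕ.+ n) (T · y + σ)    ≤⟨ expSum-1+^ t (t ℕ.+ n) 0≤x (0≤ι t ⊛ 0≤y ⊕ 0≤σ) ⟩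
    expSum (t ℕ.+ (t ℕ.+ n)) X                     ≤⟨ expSum-extend 0≤X (ℕ.n≤1+n (t ℕ.+ (t ℕ.+ n))) ⟩
    expSum (suc (t ℕ.+ (t ℕ.+ n))) X               ≤⟨ expSum-mono (suc (t ℕ.+ (t ℕ.+ n))) 0≤X X≤ηu ⟩
    expSum (suc (t ℕ.+ (t ℕ.+ n))) (ι η · u)       ≤⟨ expSum-*ι (t ℕ.+ (t ℕ.+ n)) 0≤u η ⟩
    expSum (suc (t ℕ.+ (t ℕ.+ n))) u ^ η           ≤⟨ ^-mono η (0≤expSum (suc (t ℕ.+ (t ℕ.+ n))) 0≤u) (exp-u≤ (suc (t ℕ.+ (t ℕ.+ n)))) ⟩
    (1ℚ + μ) ^ η                                   ∎
    where
    u = μ · i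
    0≤u : 0ℚ ≲ u
    0≤u = 0≤μ ⊛ 0≤i
    0≤X : 0ℚ ≲ X
    0≤X = 0≤ι t ⊛ 0≤x ⊕ (0≤ι t ⊛ 0≤y ⊕ 0≤σ)
    1-u : 1ℚ - u ≡ i
    1-u = trans (cong (_- u) (sym [1+μ]i)) (solve 2 (λ μ i → (con 1ℚ :+ μ) :* i :- μ :* i := i) refl μ i)
    u≡ : u ≡ μ - μ · u
    u≡ = trans (cong (μ ·_) (sym 1-u)) (solve 2 (λ μ u → μ :* (con 1ℚ :- u) := μ :- μ :* u) refl μ u)
    u≤1 : u ≲ 1ℚ
    u≤1 = 0≤y-x⇒x≤y (subst (0ℚ ≲_) (sym 1-u) 0≤i)
    μ-μ²≤u : μ - y ≲ u
    μ-μ²≤u = subst (μ - y ≲_) (sym u≡) (≤-by (μ · (μ - u)) (0≤μ ⊛ x≤y⇒0≤y-x (subst (u ≲_) (ℚ.*-identityʳ μ) (*-monoˡ μ 0≤μ i≤1)))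
      (solve 2 (λ μ u → μ :- μ :* u := μ :- μ :* μ :+ μ :* (μ :- u)) refl μ u))
    exp-u≤ : ∀ N → expSum N u ≲ 1ℚ + μ
    exp-u≤ N = begin
      expSum N u                      ≡⟨ trans (sym (ℚ.*-identityʳ (expSum N u))) (cong (expSum N u ·_) (sym [1+μ]i)) ⟩
      expSum N u · ((1ℚ + μ) · i)     ≡⟨ solve 3 (λ s m i → s :* (m :* i) := m :* (s :* i)) refl (expSum N u) (1ℚ + μ) i ⟩
      (1ℚ + μ) · (expSum N u · i)     ≤⟨ *-monoˡ (1ℚ + μ) (0≤1 ⊕ 0≤μ) (subst (λ z → expSum N u · z ≲ 1ℚ) 1-u (expSum-geometric N 0≤u u≤1)) ⟩
      (1ℚ + μ) · 1ℚ                   ≡⟨ ℚ.*-identityʳ (1ℚ + μ) ⟩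
      1ℚ + μ                          ∎
    -- Of the two terms t μ² in `h`, one is the exponent belonging to (1 + μ²)^t; the other pays for
    -- u ≥ μ - μ² in η ≤ t factors.
    X≤ηu : X ≲ ι η · u
    X≤ηu = begin
      X                               ≤⟨ ≤-by (μ · (ι η - a · T) - (σ + (T · y + T · y))) (x≤y⇒0≤y-x h)
                                           (solve 5 (λ μ a T H σ → μ :* H :- T :* (μ :* μ)
                                             := T :* (μ :* a) :+ (T :* (μ :* μ) :+ σ) :+ (μ :* (H :- a :* T) :- (σ :+ (T :* (μ :* μ) :+ T :* (μ :* μ))))) refl μ a T (ι η) σ) ⟩
      μ · ι η - T · y                 ≤⟨ ≤-by ((T - ι η) · y) (x≤y⇒0≤y-x (ι-mono η≤t) ⊛ 0≤y)
                                           (solve 4 (λ μ H T y → H :* (μ :- y) := μ :* H :- T :* y :+ (T :- H) :* y) refl μ (ι η) T y) ⟩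
      ι η · (μ - y)                   ≤⟨ *-monoˡ (ι η) (0≤ι η) μ-μ²≤u ⟩
      ι η · u                         ∎

-- Tail bounds over the list of matchings

private
  variable
    X Φ Ψ Θ : Set

⟦_⟧ : Dec Φ → ℚ
⟦ P? ⟧ = if does P? then 1ℚ else 0ℚ

0≤⟦⟧ : (P? : Dec Φ) → 0ℚ ≲ ⟦ P? ⟧
0≤⟦⟧ (yes _) = 0≤1
0≤⟦⟧ (no _)  = ℚ.≤-refl

⟦⟧≤1 : (P? : Dec Φ) → ⟦ P? ⟧ ≲ 1ℚ
⟦⟧≤1 (yes _) = ℚ.≤-refl
⟦⟧≤1 (no _)  = 0≤1

⟦⟧-yes : (P? : Dec Φ) → Φ → ⟦ P? ⟧ ≡ 1ℚ
⟦⟧-yes (yes _) p = refl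
⟦⟧-yes (no ¬p) p = contradiction p ¬p

⟦⟧-no : (P? : Dec Φ) → ¬ Φ → ⟦ P? ⟧ ≡ 0ℚ
⟦⟧-no (yes p) ¬p = contradiction p ¬p
⟦⟧-no (no _)  ¬p = refl

⟦⟧-cong : (P? : Dec Φ) (Q? : Dec Ψ) → (Φ → Ψ) → (Ψ → Φ) → ⟦ P? ⟧ ≡ ⟦ Q? ⟧
⟦⟧-cong (yes p) Q? f g = sym (⟦⟧-yes Q? (f p))
⟦⟧-cong (no ¬p) Q? f g = sym (⟦⟧-no Q? (λ q → ¬p (g q)))

⟦⟧-× : (P? : Dec Φ) (Q? : Dec Ψ) (R? : Dec Θ) → (Φ → Ψ × Θ) → (Ψ → Θ → Φ) → ⟦ P? ⟧ ≡ ⟦ Q? ⟧ · ⟦ R? ⟧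
⟦⟧-× P? (yes q) (yes r) f g = ⟦⟧-yes P? (g q r)
⟦⟧-× P? (yes q) (no ¬r) f g = ⟦⟧-no P? (λ p → ¬r (proj₂ (f p)))
⟦⟧-× P? (no ¬q) R?      f g = trans (⟦⟧-no P? (λ p → ¬q (proj₁ (f p)))) (sym (ℚ.*-zeroˡ ⟦ R? ⟧))

∑ᴸ : List X → (X → ℚ) → ℚ
∑ᴸ []       g = 0ℚ
∑ᴸ (x ∷ xs) g = g x + ∑ᴸ xs g

∑ᴸ-cong : ∀ (xs : List X) {g h} → (∀ x → g x ≡ h x) → ∑ᴸ xs g ≡ ∑ᴸ xs h
∑ᴸ-cong []       g≡h = refl
∑ᴸ-cong (x ∷ xs) g≡h = cong₂ _+_ (g≡h x) (∑ᴸ-cong xs g≡h)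

∑ᴸ-* : ∀ c (xs : List X) g → ∑ᴸ xs (λ x → c · g x) ≡ c · ∑ᴸ xs g
∑ᴸ-* c []       g = sym (ℚ.*-zeroʳ c)
∑ᴸ-* c (x ∷ xs) g = trans (cong (c · g x +_) (∑ᴸ-* c xs g)) (sym (ℚ.*-distribˡ-+ c (g x) (∑ᴸ xs g)))

∑ᴸ-0 : ∀ (xs : List X) {g} → (∀ x → g x ≡ 0ℚ) → ∑ᴸ xs g ≡ 0ℚ
∑ᴸ-0 []       g≡0 = refl
∑ᴸ-0 (x ∷ xs) g≡0 = cong₂ _+_ (g≡0 x) (∑ᴸ-0 xs g≡0)

∑ᴸ-++ : ∀ (xs ys : List X) g → ∑ᴸ (xs ++ ys) g ≡ ∑ᴸ xs g + ∑ᴸ ys g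
∑ᴸ-++ []       ys g = sym (ℚ.+-identityˡ (∑ᴸ ys g))
∑ᴸ-++ (x ∷ xs) ys g = trans (cong (g x +_) (∑ᴸ-++ xs ys g)) (sym (ℚ.+-assoc (g x) (∑ᴸ xs g) (∑ᴸ ys g)))

∑ᴸ-map : ∀ {B : Set} (f : X → B) xs g → ∑ᴸ (map f xs) g ≡ ∑ᴸ xs (λ x → g (f x))
∑ᴸ-map f []       g = refl
∑ᴸ-map f (x ∷ xs) g = cong (g (f x) +_) (∑ᴸ-map f xs g)

∑ᴸ-product : ∀ {B C : Set} (f : X → B → C) xs ys g →
  ∑ᴸ (cartesianProductWith f xs ys) g ≡ ∑ᴸ xs (λ x → ∑ᴸ ys (λ y → g (f x y)))
∑ᴸ-product f []       ys g = refl
∑ᴸ-product f (x ∷ xs) ys g = trans (∑ᴸ-++ (map (f x) ys) (cartesianProductWith f xs ys) g)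
  (cong₂ _+_ (∑ᴸ-map (f x) ys g) (∑ᴸ-product f xs ys g))

∑ᴸ-filter : ∀ {P : Pred X 0ℓ} (P? : Decidable P) xs g → ∑ᴸ (filter P? xs) g ≡ ∑ᴸ xs (λ x → ⟦ P? x ⟧ · g x)
∑ᴸ-filter P? []       g = refl
∑ᴸ-filter P? (x ∷ xs) g with P? x
... | yes _ = cong₂ _+_ (sym (ℚ.*-identityˡ (g x))) (∑ᴸ-filter P? xs g)
... | no _  = trans (∑ᴸ-filter P? xs g) (sym (trans (cong (_+ s) (ℚ.*-zeroˡ (g x))) (ℚ.+-identityˡ s)))
  where s = ∑ᴸ xs (λ x → ⟦ P? x ⟧ · g x)

∑ᴸ-length : ∀ (xs : List X) → ∑ᴸ xs (λ _ → 1ℚ) ≡ ι (length xs)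
∑ᴸ-length []       = sym (ι≡/1 0)
∑ᴸ-length (x ∷ xs) = trans (cong (1ℚ +_) (∑ᴸ-length xs)) (sym (ι-suc (length xs)))

∑ᴸ-markov : ∀ {P : Pred X 0ℓ} (P? : Decidable P) c {g} → (∀ x → 0ℚ ≲ g x) → (∀ x → P x → c ≲ g x) →
  ∀ xs → ι (length (filter P? xs)) · c ≲ ∑ᴸ xs g
∑ᴸ-markov P? c 0≤g c≤g []       = ℚ.≤-reflexive (trans (cong (_· c) (ι≡/1 0)) (ℚ.*-zeroˡ c))
∑ᴸ-markov P? c {g} 0≤g c≤g (x ∷ xs) with P? x
... | yes p = ℚ.≤-trans (ℚ.≤-reflexive (trans (cong (_· c) (ι-suc (length (filter P? xs))))
                (solve 2 (λ n c → (con 1ℚ :+ n) :* c := c :+ n :* c) refl (ι (length (filter P? xs))) c)))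
                (ℚ.+-mono-≤ (c≤g x p) (∑ᴸ-markov P? c 0≤g c≤g xs))
... | no _  = ℚ.≤-trans (∑ᴸ-markov P? c 0≤g c≤g xs) (≤-by (g x) (0≤g x) (ℚ.+-comm (g x) (∑ᴸ xs g)))

filter-∪ : ∀ {D E F : Pred X 0ℓ} (D? : Decidable D) (E? : Decidable E) (F? : Decidable F) → (∀ x → D x → E x ⊎ F x) →
  ∀ xs → length (filter D? xs) ℕ.≤ length (filter E? xs) ℕ.+ length (filter F? xs)
filter-∪ D? E? F? D⊆E∪F [] = ℕ.z≤n
filter-∪ D? E? F? D⊆E∪F (x ∷ xs) with filter-∪ D? E? F? D⊆E∪F xs | D? x | E? x | F? x
... | h | yes d | yes _ | yes _ = ℕ.s≤s (ℕ.≤-trans h (ℕ.+-monoʳ-≤ _ (ℕ.n≤1+n _)))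
... | h | yes d | yes _ | no _  = ℕ.s≤s h
... | h | yes d | no _  | yes _ = ℕ.≤-trans (ℕ.s≤s h) (ℕ.≤-reflexive (sym (ℕ.+-suc _ _)))
... | h | yes d | no ¬e | no ¬f = contradiction (D⊆E∪F x d) λ { (inj₁ e) → ¬e e ; (inj₂ f) → ¬f f }
... | h | no _  | yes _ | yes _ = ℕ.m≤n⇒m≤1+n (ℕ.≤-trans h (ℕ.+-monoʳ-≤ _ (ℕ.n≤1+n _)))
... | h | no _  | yes _ | no _  = ℕ.m≤n⇒m≤1+n h
... | h | no _  | no _  | yes _ = ℕ.≤-trans h (ℕ.+-monoʳ-≤ _ (ℕ.n≤1+n _))
... | h | no _  | no _  | no _  = h

-- Enumerated subsets and matchings in terms of the recursive sums

isPart? : ∀ l (R B : Subset m) → Dec (∣ B ∣ ≡ l × B ⊆ R)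
isPart? l R B = (∣ B ∣ ℕ.≟ l) ×-dec (B ⊆? R)

∑ᴸ-subsets : ∀ l (R : Subset m) g → ∑ᴸ (subsets m) (λ B → ⟦ isPart? l R B ⟧ · g B (R ─ B)) ≡ ∑ l R g
∑ᴸ-subsets {zero} zero    [] g = trans (ℚ.+-identityʳ (1ℚ · g [] [])) (ℚ.*-identityˡ (g [] []))
∑ᴸ-subsets {zero} (suc l) [] g = trans (ℚ.+-identityʳ (0ℚ · g [] [])) (ℚ.*-zeroˡ (g [] []))
∑ᴸ-subsets {suc m} l (s ∷ R) g = trans (∑ᴸ-product _∷_ (outside ∷ inside ∷ []) (subsets m) _) (halves s l)
  where
  halves : ∀ s l → ∑ᴸ (subsets m) (λ B → ⟦ isPart? l (s ∷ R) (outside ∷ B) ⟧ · g (outside ∷ B) ((s ∷ R) ─ (outside ∷ B)))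
    + (∑ᴸ (subsets m) (λ B → ⟦ isPart? l (s ∷ R) (inside ∷ B) ⟧ · g (inside ∷ B) ((s ∷ R) ─ (inside ∷ B))) + 0ℚ) ≡ ∑ l (s ∷ R) g
  without : ∀ s l (h : Subset m → ℚ) → ∑ᴸ (subsets m) (λ B → ⟦ isPart? l (s ∷ R) (outside ∷ B) ⟧ · h B) ≡ ∑ᴸ (subsets m) (λ B → ⟦ isPart? l R B ⟧ · h B)
  without s l h = ∑ᴸ-cong (subsets m) (λ B → cong (_· h B) (⟦⟧-cong (isPart? l (s ∷ R) (outside ∷ B)) (isPart? l R B)
    (λ (e , B⊆) → e , drop-∷-⊆ B⊆) (λ (e , B⊆) → e , out⊆ B⊆)))
  vanish : ∀ s l (h : Subset m → ℚ) → (∀ B → ¬ (∣ inside ∷ B ∣ ≡ l × inside ∷ B ⊆ s ∷ R)) →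
    ∑ᴸ (subsets m) (λ B → ⟦ isPart? l (s ∷ R) (inside ∷ B) ⟧ · h B) + 0ℚ ≡ 0ℚ
  vanish s l h ¬part = trans (ℚ.+-identityʳ _) (∑ᴸ-0 (subsets m) (λ B → trans (cong (_· h B) (⟦⟧-no (isPart? l (s ∷ R) (inside ∷ B)) (¬part B))) (ℚ.*-zeroˡ (h B))))
  not-∈ : ∀ {B : Subset m} → ¬ (inside ∷ B ⊆ outside ∷ R)
  not-∈ B⊆ with B⊆ here
  ... | ()
  halves outside l = trans (cong₂ _+_ (trans (without outside l (λ B → g (outside ∷ B) (outside ∷ (R ─ B)))) (∑ᴸ-subsets l R (λ B C → g (outside ∷ B) (outside ∷ C))))
    (vanish outside l (λ B → g (inside ∷ B) (outside ∷ (R ─ B))) (λ B (_ , B⊆) → not-∈ B⊆))) (ℚ.+-identityʳ _)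
  halves inside zero = trans (cong₂ _+_ (trans (without inside zero (λ B → g (outside ∷ B) (inside ∷ (R ─ B)))) (∑ᴸ-subsets zero R (λ B C → g (outside ∷ B) (inside ∷ C))))
    (vanish inside zero (λ B → g (inside ∷ B) (outside ∷ (R ─ B))) (λ B ()))) (ℚ.+-identityʳ _)
  halves inside (suc l) = cong₂ _+_ (trans (without inside (suc l) (λ B → g (outside ∷ B) (inside ∷ (R ─ B)))) (∑ᴸ-subsets (suc l) R (λ B C → g (outside ∷ B) (inside ∷ C))))
    (trans (ℚ.+-identityʳ _) (trans
      (∑ᴸ-cong (subsets m) (λ B → cong (_· g (inside ∷ B) (outside ∷ (R ─ B))) (⟦⟧-cong (isPart? (suc l) (inside ∷ R) (inside ∷ B)) (isPart? l R B)
        (λ (e , B⊆) → ℕ.suc-injective e , drop-∷-⊆ B⊆) (λ (e , B⊆) → cong suc e , s⊆s B⊆))))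
      (∑ᴸ-subsets l R (λ B C → g (inside ∷ B) (outside ∷ C)))))

weight : ∀ {t} → (Subset m → ℚ) → Vec (Subset m) t → ℚ
weight w []       = 1ℚ
weight w (B ∷ Bs) = w B · weight w Bs

-- Confinement to R makes the condition recursive: once B is split off, disjointness from B turns
-- into containment in `R ─ B`.
isMatchingIn? : ∀ {t} l (R : Subset m) (Bs : Vec (Subset m) t) → Dec (IsMatching l Bs × All (_⊆ R) Bs)
isMatchingIn? l R Bs = isMatching? l Bs ×-dec All.all? (_⊆? R) Bs

∈─⇒∉ : ∀ (p q : Subset m) {x} → x ∈ p ─ q → x ∉ q
∈─⇒∉ (_ ∷ p) (_ ∷ q) (there x∈p─q) (there x∈q) = ∈─⇒∉ p q x∈p─q x∈q
∈─⇒∉ (s ∷ p) (inside ∷ q) () here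

matching-uncons : ∀ {t l} {R B : Subset m} {Bs : Vec (Subset m) t} → IsMatching l (B ∷ Bs) × All (_⊆ R) (B ∷ Bs) →
  (∣ B ∣ ≡ l × B ⊆ R) × (IsMatching l Bs × All (_⊆ R ─ B) Bs)
matching-uncons {R = R} {B} ((size ∷ sizes , disj ∷ disjs) , (B⊆R ∷ Bs⊆R)) =
  (size , B⊆R) , (sizes , disjs) , All.map (λ (dis , C⊆R) {x} x∈C → x∈p∧x∉q⇒x∈p─q (C⊆R x∈C) (λ x∈B → dis (_ , x∈p∩q⁺ (x∈B , x∈C)))) (All.zip (disj , Bs⊆R))

matching-cons : ∀ {t l} {R B : Subset m} {Bs : Vec (Subset m) t} → ∣ B ∣ ≡ l × B ⊆ R → IsMatching l Bs × All (_⊆ R ─ B) Bs →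
  IsMatching l (B ∷ Bs) × All (_⊆ R) (B ∷ Bs)
matching-cons {R = R} {B} (size , B⊆R) ((sizes , disjs) , Bs⊆R─B) =
  (size ∷ sizes , All.map (λ {C} C⊆R─B (x , x∈) → ∈─⇒∉ R B (C⊆R─B (proj₂ (x∈p∩q⁻ B C x∈))) (proj₁ (x∈p∩q⁻ B C x∈))) Bs⊆R─B ∷ disjs)
  , (B⊆R ∷ All.map (λ {C} C⊆R─B {x} x∈C → p─q⊆p R B (C⊆R─B x∈C)) Bs⊆R─B)

∑ᴸ-allVecs : ∀ l (w : Subset m → ℚ) t R →
  ∑ᴸ (allVecs (subsets m) t) (λ Bs → ⟦ isMatchingIn? l R Bs ⟧ · weight w Bs) ≡ matchingSum l w t R
∑ᴸ-allVecs l w zero    R = refl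
∑ᴸ-allVecs {m} l w (suc t) R = begin
  ∑ᴸ (allVecs (subsets m) (suc t)) (λ Bs → ⟦ isMatchingIn? l R Bs ⟧ · weight w Bs)
    ≡⟨ ∑ᴸ-product _∷_ (subsets m) (allVecs (subsets m) t) _ ⟩
  ∑ᴸ (subsets m) (λ B → ∑ᴸ (allVecs (subsets m) t) (λ Bs → ⟦ isMatchingIn? l R (B ∷ Bs) ⟧ · (w B · weight w Bs)))
    ≡⟨ ∑ᴸ-cong (subsets m) (λ B → trans (∑ᴸ-cong (allVecs (subsets m) t) (λ Bs → trans
         (cong (_· (w B · weight w Bs)) (⟦⟧-× (isMatchingIn? l R (B ∷ Bs)) (isPart? l R B) (isMatchingIn? l (R ─ B) Bs) matching-uncons matching-cons))
         (solve 4 (λ a b c d → a :* b :* (c :* d) := a :* c :* (b :* d)) refl ⟦ isPart? l R B ⟧ ⟦ isMatchingIn? l (R ─ B) Bs ⟧ (w B) (weight w Bs))))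
         (trans (∑ᴸ-* (⟦ isPart? l R B ⟧ · w B) (allVecs (subsets m) t) _)
           (trans (cong (⟦ isPart? l R B ⟧ · w B ·_) (∑ᴸ-allVecs l w t (R ─ B))) (ℚ.*-assoc ⟦ isPart? l R B ⟧ (w B) _)))) ⟩
  ∑ᴸ (subsets m) (λ B → ⟦ isPart? l R B ⟧ · (w B · matchingSum l w t (R ─ B)))
    ≡⟨ ∑ᴸ-subsets l R (λ B C → w B · matchingSum l w t C) ⟩
  ∑ l R (λ B C → w B · matchingSum l w t C) ∎
  where open ≡-Reasoning

∑ᴸ-matchings : ∀ l (w : Subset m → ℚ) t → ∑ᴸ (matchings m l t) (weight w) ≡ matchingSum l w t ⊤
∑ᴸ-matchings {m} l w t = trans (∑ᴸ-filter (isMatching? l) (allVecs (subsets m) t) (weight w))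
  (trans (∑ᴸ-cong (allVecs (subsets m) t) (λ Bs → cong (_· weight w Bs)
    (⟦⟧-cong (isMatching? l Bs) (isMatchingIn? l ⊤ Bs) (λ M → M , All.universal (λ _ {_} → ⊆⊤) Bs) proj₁)))
    (∑ᴸ-allVecs l w t ⊤))

weight-1 : ∀ {t} (Bs : Vec (Subset m) t) → weight (λ _ → 1ℚ) Bs ≡ 1ℚ
weight-1 []       = refl
weight-1 (B ∷ Bs) = trans (ℚ.*-identityˡ _) (weight-1 Bs)

∣matchings∣ : ∀ m l t → ι (length (matchings m l t)) ≡ ι (matchingCount l t m)
∣matchings∣ m l t = trans (sym (∑ᴸ-length (matchings m l t))) (trans (∑ᴸ-cong (matchings m l t) (λ Bs → sym (weight-1 Bs)))
  (trans (∑ᴸ-matchings l (λ _ → 1ℚ) t) (trans (matchingSum-1 l t ⊤) (cong (λ r → ι (matchingCount l t r)) (∣⊤∣≡n m)))))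

weight-count : ∀ {𝒢 : Pred (Subset m) 0ℓ} (𝒢? : Decidable 𝒢) μ {t} (Bs : Vec (Subset m) t) →
  weight (λ B → 1ℚ + μ · ⟦ 𝒢? B ⟧) Bs ≡ (1ℚ + μ) ^ count 𝒢? Bs
weight-count 𝒢? μ []       = refl
weight-count 𝒢? μ (B ∷ Bs) with 𝒢? B
... | yes _ = cong₂ _·_ (cong (1ℚ +_) (ℚ.*-identityʳ μ)) (weight-count 𝒢? μ Bs)
... | no _  = trans (cong₂ _·_ (trans (cong (1ℚ +_) (ℚ.*-zeroʳ μ)) refl) (weight-count 𝒢? μ Bs)) (ℚ.*-identityˡ _)

count≤ : ∀ {𝒢 : Pred (Subset m) 0ℓ} (𝒢? : Decidable 𝒢) {t} (Bs : Vec (Subset m) t) → count 𝒢? Bs ℕ.≤ t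
count≤ 𝒢? []       = ℕ.z≤n
count≤ 𝒢? (B ∷ Bs) with 𝒢? B
... | yes _ = ℕ.s≤s (count≤ 𝒢? Bs)
... | no _  = ℕ.m≤n⇒m≤1+n (count≤ 𝒢? Bs)

count-∁ : ∀ {𝒢 : Pred (Subset m) 0ℓ} (𝒢? : Decidable 𝒢) {t} (Bs : Vec (Subset m) t) →
  count 𝒢? Bs ℕ.+ count (λ B → ¬? (𝒢? B)) Bs ≡ t
count-∁ 𝒢? []       = refl
count-∁ 𝒢? (B ∷ Bs) with 𝒢? B
... | yes _ = cong suc (count-∁ 𝒢? Bs)
... | no _  = trans (ℕ.+-suc _ _) (cong suc (count-∁ 𝒢? Bs))

-- The density of the family and the tails of the count

mean : ∀ k {𝒢 : Pred (Subset m) 0ℓ} → Decidable 𝒢 → ℚ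
mean k 𝒢? = Density.α k (λ B → ⟦ 𝒢? B ⟧) (λ B → 0≤⟦⟧ (𝒢? B)) (λ B → ⟦⟧≤1 (𝒢? B)) ⊤

mean-∁ : ∀ k {𝒢 : Pred (Subset m) 0ℓ} (𝒢? : Decidable 𝒢) → suc k ℕ.≤ m → mean k (λ B → ¬? (𝒢? B)) ≡ 1ℚ - mean k 𝒢?
mean-∁ {m} k 𝒢? l≤m = begin
  S′ · c                 ≡⟨ solve 3 (λ S S′ c → S′ :* c := (S :+ S′) :* c :- S :* c) refl S S′ c ⟩
  (S + S′) · c - S · c   ≡⟨ cong (λ x → x · c - S · c) S+S′ ⟩
  ι N · c - S · c        ≡⟨ cong (_- S · c) (trans (ℚ.*-comm (ι N) c) (recip-cancel N {{choose-nonZero (subst (suc k ℕ.≤_) (sym (∣⊤∣≡n m)) l≤m)}})) ⟩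
  1ℚ - S · c             ∎
  where
  open ≡-Reasoning
  N = choose ∣ ⊤ {m} ∣ (suc k)
  c = recip N
  S S′ : ℚ
  S  = ∑ (suc k) ⊤ (λ B _ → ⟦ 𝒢? B ⟧)
  S′ = ∑ (suc k) ⊤ (λ B _ → ⟦ ¬? (𝒢? B) ⟧)
  sum1 : ∀ B → ⟦ 𝒢? B ⟧ + ⟦ ¬? (𝒢? B) ⟧ ≡ 1ℚ
  sum1 B with 𝒢? B
  ... | yes _ = refl
  ... | no _  = refl
  S+S′ : S + S′ ≡ ι N
  S+S′ = trans (sym (∑-+ (suc k) ⊤ (λ B _ → ⟦ 𝒢? B ⟧) (λ B _ → ⟦ ¬? (𝒢? B) ⟧)))
    (trans (∑-cong (suc k) (⊤ {m}) (λ {B} _ → sum1 B)) (∑-1 (suc k) (⊤ {m})))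

-- The density counts members of 𝒢 among all subsets; since they all have size l, this is a sum over
-- the l-subsets of `⊤`.
density≡mean : ∀ k {𝒢 : Pred (Subset m) 0ℓ} (𝒢? : Decidable 𝒢) → (∀ {s} → 𝒢 s → ∣ s ∣ ≡ suc k) →
  .{{_ : ℕ.NonZero (m ℕ.C suc k)}} → density (suc k) 𝒢? ≡ mean k 𝒢?
density≡mean {m} k 𝒢? uniform = begin
  d                      ≡⟨ ℚ.*-identityʳ d ⟨
  d · 1ℚ                 ≡⟨ cong (d ·_) (trans (cong (_· ι N) (cong recip N≡)) (recip-cancel N)) ⟨
  d · (recip N′ · ι N)   ≡⟨ solve 3 (λ d c n → d :* (c :* n) := d :* n :* c) refl d (recip N′) (ι N) ⟩
  d · ι N · recip N′     ≡⟨ cong (_· recip N′) (trans (/-cancel (length (filter 𝒢? (subsets m))) N) total) ⟩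
  mean k 𝒢?              ∎
  where
  open ≡-Reasoning
  N N′ : ℕ
  N  = m ℕ.C suc k
  N′ = choose ∣ ⊤ {m} ∣ (suc k)
  N≡ : N′ ≡ N
  N≡ = trans (cong (λ n → choose n (suc k)) (∣⊤∣≡n m)) (choose≡C m (suc k))
  d : ℚ
  d = density (suc k) 𝒢?
  indicator : ∀ B → ⟦ 𝒢? B ⟧ · 1ℚ ≡ ⟦ isPart? (suc k) ⊤ B ⟧ · ⟦ 𝒢? B ⟧
  indicator B with 𝒢? B
  ... | yes g = sym (trans (ℚ.*-identityʳ _) (⟦⟧-yes (isPart? (suc k) ⊤ B) (uniform g , ⊆⊤)))
  ... | no _  = trans (ℚ.*-zeroˡ 1ℚ) (sym (ℚ.*-zeroʳ ⟦ isPart? (suc k) ⊤ B ⟧))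
  total : ι (length (filter 𝒢? (subsets m))) ≡ ∑ (suc k) ⊤ (λ B _ → ⟦ 𝒢? B ⟧)
  total = trans (sym (∑ᴸ-length (filter 𝒢? (subsets m)))) (trans (∑ᴸ-filter 𝒢? (subsets m) (λ _ → 1ℚ))
    (trans (∑ᴸ-cong (subsets m) indicator) (∑ᴸ-subsets (suc k) ⊤ (λ B _ → ⟦ 𝒢? B ⟧))))

-- The maximum of μ s - 2 t μ² over μ, attained at μ = s / 4t; compare the hypothesis of `exp-tail`.
rate : ℕ → ℚ → ℚ
rate t s = s · s · (pos 1 / 8) · recip t

module _ {m k t} .{{_ : ℕ.NonZero t}} (tl≤m : t ℕ.* suc k ℕ.≤ m) (s : ℚ) (0≤s : 0ℚ ≲ s) (s≤t : s ≲ ι t) where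

  private
    Ω : List (Vec (Subset m) t)
    Ω = matchings m (suc k) t

    μ : ℚ
    μ = s · (pos 1 / 4) · recip t

    0≤μ : 0ℚ ≲ μ
    0≤μ = 0≤s ⊛ ℚ.nonNegative⁻¹ (pos 1 / 4) ⊛ 0≤recip t

    -- Since 4μ = s / t, this is the assumption s ≤ t.
    4μ≤1 : (pos 4 / 1) · μ ≲ 1ℚ
    4μ≤1 = subst₂ _≲_ (solve 2 (λ s c → c :* s := con (pos 4 / 1) :* (s :* con (pos 1 / 4) :* c)) refl s (recip t)) (recip-cancel t)
      (*-monoˡ (recip t) (0≤recip t) s≤t)

    budget : rate t s + (ι t · (μ · μ) + ι t · (μ · μ)) ≡ μ · s
    budget = trans (solve 3 (λ s c T → s :* s :* con (pos 1 / 8) :* c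
        :+ (T :* (s :* con (pos 1 / 4) :* c :* (s :* con (pos 1 / 4) :* c)) :+ T :* (s :* con (pos 1 / 4) :* c :* (s :* con (pos 1 / 4) :* c)))
      := s :* s :* con (pos 1 / 8) :* c :* (con 1ℚ :+ c :* T)) refl s (recip t) (ι t))
      (trans (cong (λ x → rate t s · (1ℚ + x)) (recip-cancel t))
        (solve 2 (λ s c → s :* s :* con (pos 1 / 8) :* c :* (con 1ℚ :+ con 1ℚ) := s :* con (pos 1 / 4) :* c :* s) refl s (recip t)))

  -- The common factor `G` bounds the moment from above and, times the partial sum, the weight of
  -- every outcome in D from below, so it cancels after Markov's inequality. Stating the result for
  -- every truncation keeps it rational.
  upper-tail : ∀ {𝒢 : Pred (Subset m) 0ℓ} (𝒢? : Decidable 𝒢) {D : Pred (Vec (Subset m) t) 0ℓ} (D? : Decidable D) →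
    (∀ Bs → D Bs → s ≲ ι (count 𝒢? Bs) - mean k 𝒢? · ι t) →
    ∀ n → ι (length (filter D? Ω)) · expSum n (rate t s) ≲ ι (length Ω)
  upper-tail 𝒢? D? s≤ n = *-cancelˡ G 0<G (begin
    G · (ι (length (filter D? Ω)) · expSum n (rate t s))
      ≡⟨ solve 3 (λ G d e → G :* (d :* e) := d :* (G :* e)) refl G (ι (length (filter D? Ω))) (expSum n (rate t s)) ⟩
    ι (length (filter D? Ω)) · (G · expSum n (rate t s))
      ≤⟨ ∑ᴸ-markov D? (G · expSum n (rate t s)) 0≤weight large Ω ⟩
    ∑ᴸ Ω (weight M.w)
      ≡⟨ ∑ᴸ-matchings (suc k) M.w t ⟩
    matchingSum (suc k) M.w t ⊤
      ≤⟨ M.moment-bound t ⊤ (subst (t ℕ.* suc k ℕ.≤_) (sym (∣⊤∣≡n m)) tl≤m) ⟩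
    ι (matchingCount (suc k) t ∣ ⊤ {m} ∣) · G
      ≡⟨ trans (cong (λ r → ι (matchingCount (suc k) t r) · G) (∣⊤∣≡n m)) (trans (cong (_· G) (sym (∣matchings∣ m (suc k) t))) (ℚ.*-comm _ G)) ⟩
    G · ι (length Ω) ∎)
    where
    open ℚ.≤-Reasoning
    module M = Moment k (λ B → ⟦ 𝒢? B ⟧) (λ B → 0≤⟦⟧ (𝒢? B)) (λ B → ⟦⟧≤1 (𝒢? B)) μ 0≤μ 4μ≤1
    a : ℚ
    a = mean k 𝒢?
    0≤a : 0ℚ ≲ a
    0≤a = Density.0≤α k (λ B → ⟦ 𝒢? B ⟧) (λ B → 0≤⟦⟧ (𝒢? B)) (λ B → ⟦⟧≤1 (𝒢? B)) ⊤
    G : ℚ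
    G = (1ℚ + μ · a) ^ t · (1ℚ + μ · μ) ^ t
    0<G : 0ℚ < G
    0<G = ℚ.<-≤-trans 0<1 (*-mono {1ℚ} {(1ℚ + μ · a) ^ t} {1ℚ} {(1ℚ + μ · μ) ^ t} 0≤1 (0≤^ t (0≤1 ⊕ 0≤μ ⊛ 0≤a))
      (1≤^ t (≤-by (μ · a) (0≤μ ⊛ 0≤a) refl)) (1≤^ t (≤-by (μ · μ) (0≤sq μ) refl)))
    0≤weight : ∀ Bs → 0ℚ ≲ weight M.w Bs
    0≤weight Bs = subst (0ℚ ≲_) (sym (weight-count 𝒢? μ Bs)) (0≤^ (count 𝒢? Bs) (0≤1 ⊕ 0≤μ))
    large : ∀ Bs → _ → G · expSum n (rate t s) ≲ weight M.w Bs
    large Bs d = subst (G · expSum n (rate t s) ≲_) (sym (weight-count 𝒢? μ Bs))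
      (exp-tail (count 𝒢? Bs) t n 0≤μ 0≤a (0≤s ⊛ 0≤s ⊛ ℚ.nonNegative⁻¹ (pos 1 / 8) ⊛ 0≤recip t) (count≤ 𝒢? Bs)
        (subst (_≲ μ · (ι (count 𝒢? Bs) - a · ι t)) (sym budget) (*-monoˡ μ 0≤μ (s≤ Bs d))))

  two-sided-tail : ∀ {𝒢 : Pred (Subset m) 0ℓ} (𝒢? : Decidable 𝒢) {D : Pred (Vec (Subset m) t) 0ℓ} (D? : Decidable D) →
    (∀ Bs → D Bs → s ≲ ℚ.∣ ι (count 𝒢? Bs) - mean k 𝒢? · ι t ∣) →
    ∀ n → ι (length (filter D? Ω)) · expSum n (rate t s) ≲ (pos 2 / 1) · ι (length Ω)
  two-sided-tail 𝒢? {D} D? s≤ n = begin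
    ι (length (filter D? Ω)) · e
      ≤⟨ *-monoʳ e 0≤e (ℚ.≤-trans (ι-mono (filter-∪ D? D⁺? D⁻? side Ω)) (ℚ.≤-reflexive (ι-+ (length (filter D⁺? Ω)) (length (filter D⁻? Ω))))) ⟩
    (ι (length (filter D⁺? Ω)) + ι (length (filter D⁻? Ω))) · e
      ≡⟨ ℚ.*-distribʳ-+ e (ι (length (filter D⁺? Ω))) (ι (length (filter D⁻? Ω))) ⟩
    ι (length (filter D⁺? Ω)) · e + ι (length (filter D⁻? Ω)) · e
      ≤⟨ ℚ.+-mono-≤ (upper-tail 𝒢? D⁺? (λ _ d → d) n) (upper-tail (λ B → ¬? (𝒢? B)) D⁻? (λ _ d → d) n) ⟩
    ι (length Ω) + ι (length Ω)
      ≡⟨ solve 1 (λ x → x :+ x := con (pos 2 / 1) :* x) refl (ι (length Ω)) ⟩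
    (pos 2 / 1) · ι (length Ω) ∎
    where
    open ℚ.≤-Reasoning
    e : ℚ
    e = expSum n (rate t s)
    0≤e : 0ℚ ≲ e
    0≤e = 0≤expSum n (0≤s ⊛ 0≤s ⊛ ℚ.nonNegative⁻¹ (pos 1 / 8) ⊛ 0≤recip t)
    D⁺ D⁻ : Pred (Vec (Subset m) t) 0ℓ
    D⁺ Bs = s ≲ ι (count 𝒢? Bs) - mean k 𝒢? · ι t
    D⁻ Bs = s ≲ ι (count (λ B → ¬? (𝒢? B)) Bs) - mean k (λ B → ¬? (𝒢? B)) · ι t
    D⁺? : Decidable D⁺
    D⁺? Bs = s ℚ.≤? _
    D⁻? : Decidable D⁻
    D⁻? Bs = s ℚ.≤? _
    l≤m : suc k ℕ.≤ m
    l≤m = ℕ.≤-trans (ℕ.m≤n*m (suc k) t) tl≤m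
    flip : ∀ Bs → - (ι (count 𝒢? Bs) - mean k 𝒢? · ι t) ≡ ι (count (λ B → ¬? (𝒢? B)) Bs) - mean k (λ B → ¬? (𝒢? B)) · ι t
    flip Bs = sym (trans (cong (λ x → ι c′ - x · ι t) (mean-∁ k 𝒢? l≤m))
      (trans (cong (λ x → ι c′ - (1ℚ - a) · x) t≡) (trans (solve 3 (λ c c′ a → c′ :- (con 1ℚ :- a) :* (c :+ c′) := :- (c :- a :* (c :+ c′))) refl (ι c) (ι c′) a)
        (cong (λ x → - (ι c - a · x)) (sym t≡)))))
      where
      a = mean k 𝒢?
      c = count 𝒢? Bs
      c′ = count (λ B → ¬? (𝒢? B)) Bs
      t≡ : ι t ≡ ι c + ι c′
      t≡ = trans (cong ι (sym (count-∁ 𝒢? Bs))) (ι-+ c c′)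
    side : ∀ Bs → D Bs → D⁺ Bs ⊎ D⁻ Bs
    side Bs d with ℚ.∣p∣≡p∨∣p∣≡-p (ι (count 𝒢? Bs) - mean k 𝒢? · ι t)
    ... | inj₁ e = inj₁ (subst (s ≲_) e (s≤ Bs d))
    ... | inj₂ e = inj₂ (subst (s ≲_) (trans e (flip Bs)) (s≤ Bs d))

-- Passage to the real bound

archimedean : ∀ q → ∃ λ K → q ≲ ι K
archimedean q = ℤ.∣ ℚ.↥ q ∣ , subst (q ℚ.≤_) (sym (ι≡/1 ℤ.∣ ℚ.↥ q ∣)) (go q)
  where
  go : ∀ q → q ≲ pos ℤ.∣ ℚ.↥ q ∣ / 1
  go q@(ℚ.mkℚ (pos a) d _) = ℚ.toℚᵘ-cancel-≤ (ℚᵘ.≤-respʳ-≃ (ℚᵘ.≃-sym (ℚ.toℚᵘ-fromℚᵘ (ℚᵘ.mkℚᵘ (pos a) 0)))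
    (ℚᵘ.*≤* (ℤ.*-monoˡ-≤-nonNeg (pos a) (ℤ.+≤+ (ℕ.s≤s ℕ.z≤n)))))
  go q@(ℚ.mkℚ ℤ.-[1+ a ] d _) = ℚ.≤-trans (ℚ.<⇒≤ (ℚ.negative⁻¹ q)) (ℚ.nonNegative⁻¹ (pos (suc a) / 1) {{ℚ.normalize-nonNeg (suc a) 1}})

recip-small : ∀ c {ε} → 0ℚ < ε → ∃ λ N → ∀ n → N ≤ n → c · recip (suc n) ≲ ε
recip-small c {ε} 0<ε = N , λ n N≤n → begin
  c · recip (suc n)                  ≤⟨ *-monoʳ (recip (suc n)) (0≤recip (suc n)) (c≤ n N≤n) ⟩
  ε · ι (suc n) · recip (suc n)      ≡⟨ trans (ℚ.*-assoc ε _ _) (trans (cong (ε ·_) (trans (ℚ.*-comm (ι (suc n)) _) (recip-cancel (suc n)))) (ℚ.*-identityʳ ε)) ⟩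
  ε                                  ∎
  where
  open ℚ.≤-Reasoning
  instance
    ε-pos : ℚ.Positive ε
    ε-pos = ℚ.positive 0<ε
    ε≢0 : ℚ.NonZero ε
    ε≢0 = ℚ.pos⇒nonZero ε
  i : ℚ
  i = ℚ.1/ ε
  N : ℕ
  N = proj₁ (archimedean (c · i))
  c≤ : ∀ n → N ≤ n → c ≲ ε · ι (suc n)
  c≤ n N≤n = begin
    c                 ≡⟨ trans (sym (ℚ.*-identityʳ c)) (trans (cong (c ·_) (sym (ℚ.*-inverseʳ ε))) (solve 3 (λ c e i → c :* (e :* i) := e :* (c :* i)) refl c ε i)) ⟩
    ε · (c · i)       ≤⟨ *-monoˡ ε (ℚ.<⇒≤ 0<ε) (ℚ.≤-trans (proj₂ (archimedean (c · i))) (ι-mono (ℕ.m≤n⇒m≤1+n N≤n))) ⟩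
    ε · ι (suc n)     ∎

lower : ∀ {x y} → 0ℚ < x → 0ℚ < y → ∃ λ δ → 0ℚ < δ × δ ≲ x × δ ≲ y
lower {x} {y} 0<x 0<y with ℚ.≤-total x y
... | inj₁ x≤y = x , 0<x , ℚ.≤-refl , x≤y
... | inj₂ y≤x = y , 0<y , y≤x , ℚ.≤-refl

0<½ : 0ℚ < ½
0<½ = ℚ.positive⁻¹ ½

½+½ : ∀ x → x · ½ + x · ½ ≡ x
½+½ x = solve 1 (λ x → x :* con ½ :+ x :* con ½ := x) refl x

-- The upper limit of x is at most c; x itself is not assumed to converge.
Eventually≤ : (ℕ → ℚ) → ℚ → Set
Eventually≤ x c = ∀ δ → 0ℚ < δ → ∃ λ N → ∀ n → N ≤ n → x n ≲ c + δ

-- For large n, `expSum-inverse` gives e(x n) e(-x n) ≥ 1 - δ, while e(x n) ≤ e(σ) e(δ) ≤ e(σ) / (1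
-- - δ), where e is the n-th partial sum. Hence p (1 - δ)² ≤ e(-x n), and the loss is at most 2δ ≤ ε
-- because p ≤ 1.
exp-neg-limit : ∀ p σ (x : ℕ → ℚ) → 0ℚ ≲ p → 0ℚ ≲ σ → (∀ n → p · expSum n σ ≲ 1ℚ) →
  (∀ n → 0ℚ ≲ x n) → Eventually≤ x σ → ∀ ε → 0ℚ < ε → ∃ λ N → ∀ n → N ≤ n → p ≲ expSum n (- x n) + ε
exp-neg-limit p σ x 0≤p 0≤σ pE≤1 0≤x x≤ ε 0<ε =
  let δ , 0<δ , δ≤ε/2 , δ≤½ = lower (*-pos 0<ε 0<½) 0<½
      N₁ , f = x≤ δ 0<δ
      N₂ , g = cauchy (exp (fromℚ v)) δ 0<δ
  in suc (N₁ ℕ.⊔ N₂) , λ { (suc k) (ℕ.s≤s N≤k) →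
       let n = suc k
           N₂≤n = ℕ.m≤n⇒m≤1+n (ℕ.≤-trans (ℕ.m≤n⊔m N₁ N₂) N≤k)
       in estimate δ 0<δ δ≤ε/2 δ≤½ k (f n (ℕ.m≤n⇒m≤1+n (ℕ.≤-trans (ℕ.m≤m⊔n N₁ N₂) N≤k)))
            (ℚ.≤-trans (x≤∣x∣ _) (g (n ℕ.+ n) n (ℕ.≤-trans N₂≤n (ℕ.m≤m+n n n)) N₂≤n)) }
  where
  -- Dominates 2 x n for all late n, as x n ≤ σ + δ ≤ σ + 1. The Cauchy modulus of the partial sums
  -- at this one point therefore controls the tail in `expSum-inverse`.
  v : ℚ
  v = (σ + 1ℚ) + (σ + 1ℚ)
  estimate : ∀ δ → 0ℚ < δ → δ ≲ ε · ½ → δ ≲ ½ → ∀ k → let n = suc k in x n ≲ σ + δ →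
    expSum (n ℕ.+ n) v - expSum n v ≲ δ → p ≲ expSum n (- x n) + ε
  estimate δ 0<δ δ≤ε/2 δ≤½ k y≤ tail = begin
    p
      ≤⟨ ≤-by ((1ℚ - p) · (δ + δ) + p · (δ · δ)) (x≤y⇒0≤y-x p≤1 ⊛ (0≤δ ⊕ 0≤δ) ⊕ 0≤p ⊛ (0≤δ ⊛ 0≤δ))
           (solve 2 (λ p d → p :* (con 1ℚ :- d) :* (con 1ℚ :- d) :+ (d :+ d) := p :+ ((con 1ℚ :- p) :* (d :+ d) :+ p :* (d :* d))) refl p δ) ⟩
    p · (1ℚ - δ) · (1ℚ - δ) + (δ + δ)
      ≤⟨ ℚ.+-mono-≤ (ℚ.≤-trans (*-monoˡ (p · (1ℚ - δ)) (0≤p ⊛ 0≤1-δ) ee′≥) (ℚ.≤-reflexive (sym (ℚ.*-assoc (p · (1ℚ - δ)) e e′))))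
           (ℚ.+-mono-≤ δ≤ε/2 δ≤ε/2) ⟩
    p · (1ℚ - δ) · e · e′ + (ε · ½ + ε · ½)
      ≤⟨ ℚ.+-mono-≤ (ℚ.≤-trans (*-monoʳ e′ 0≤e′ pe≤1) (ℚ.≤-reflexive (ℚ.*-identityˡ e′))) (ℚ.≤-reflexive (½+½ ε)) ⟩
    e′ + ε ∎
    where
    open ℚ.≤-Reasoning
    n = suc k
    y e e′ : ℚ
    y  = x n
    e  = expSum n y
    e′ = expSum n (- y)
    0≤δ : 0ℚ ≲ δ
    0≤δ = ℚ.<⇒≤ 0<δ
    δ≤1 : δ ≲ 1ℚ
    δ≤1 = ℚ.≤-trans δ≤½ (≤-by ½ 0≤½ refl)
    0≤1-δ : 0ℚ ≲ 1ℚ - δ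
    0≤1-δ = x≤y⇒0≤y-x δ≤1
    p≤1 : p ≲ 1ℚ
    p≤1 = subst (_≲ 1ℚ) (ℚ.*-identityʳ p) (pE≤1 1)
    y≤σ+1 : y ≲ σ + 1ℚ
    y≤σ+1 = ℚ.≤-trans y≤ (ℚ.+-monoʳ-≤ σ δ≤1)
    ee′≥ : 1ℚ - δ ≲ e · e′
    ee′≥ = ℚ.≤-trans (ℚ.+-monoʳ-≤ 1ℚ (ℚ.neg-antimono-≤ (ℚ.≤-trans
      (expSum-tail-mono n n (0≤x n ⊕ 0≤x n) (ℚ.+-mono-≤ y≤σ+1 y≤σ+1)) tail))) (expSum-inverse k (0≤x n))
    0<e : 0ℚ < e
    0<e = ℚ.<-≤-trans 0<1 (expSum-extend {1} {n} (0≤x n) (ℕ.s≤s ℕ.z≤n))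
    0≤e′ : 0ℚ ≲ e′
    0≤e′ = *-cancelˡ e 0<e (ℚ.≤-trans (ℚ.≤-reflexive (ℚ.*-zeroʳ e)) (ℚ.≤-trans 0≤1-δ ee′≥))
    pe≤1 : p · (1ℚ - δ) · e ≲ 1ℚ
    pe≤1 = begin
      p · (1ℚ - δ) · e                              ≤⟨ *-monoˡ (p · (1ℚ - δ)) (0≤p ⊛ 0≤1-δ) (ℚ.≤-trans (expSum-mono n (0≤x n) y≤) (expSum-+-≤ n 0≤σ 0≤δ)) ⟩
      p · (1ℚ - δ) · (expSum n σ · expSum n δ)      ≡⟨ solve 4 (λ p d a b → p :* d :* (a :* b) := p :* a :* (b :* d)) refl p (1ℚ - δ) (expSum n σ) (expSum n δ) ⟩
      p · expSum n σ · (expSum n δ · (1ℚ - δ))      ≤⟨ *-mono (0≤expSum n 0≤δ ⊛ 0≤1-δ) 0≤1 (pE≤1 n) (expSum-geometric n 0≤δ δ≤1) ⟩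
      1ℚ ∎

-- `√-seq` rounds √t down by less than 1 / (n + 1), whence the second bound. The first comes from t
-- ≥ 1 and lets `rate-limit` bound 2 b n by 2 b n · √-seq t n.
√-seq-bounds : ∀ t .{{_ : NonZero t}} n → 1ℚ ≲ √-seq t n × ι t ≲ (√-seq t n + recip (suc n)) · (√-seq t n + recip (suc n))
√-seq-bounds t n = 1≤r , t≤
  where
  w : ℕ
  w = ⌊√ t * (suc n * suc n) ⌋
  r h c : ℚ
  r = √-seq t n
  h = recip (suc n)
  c = ι (suc n)
  rc : r · c ≡ ι w
  rc = /-cancel w (suc n)
  <sq : t * (suc n * suc n) ℕ.< suc w * suc w
  <sq = proj₂ (⌊√⌋-spec (t * (suc n * suc n)))
  1+n≤w : suc n ≤ w
  1+n≤w = ℕ.≤-pred (ℕ.≰⇒> (λ 1+w≤1+n → ℕ.<⇒≱ <sq (ℕ.≤-trans (ℕ.*-mono-≤ 1+w≤1+n 1+w≤1+n) (ℕ.m≤n*m (suc n * suc n) t))))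
  1≤r : 1ℚ ≲ r
  1≤r = *-cancelˡ c (0<ι (suc n)) (subst₂ _≲_ (sym (ℚ.*-identityʳ c)) (trans (sym rc) (ℚ.*-comm r c)) (ι-mono 1+n≤w))
  t≤ : ι t ≲ (r + h) · (r + h)
  t≤ = *-cancelˡ (c · c) (*-pos (0<ι (suc n)) (0<ι (suc n))) (begin
    c · c · ι t                            ≡⟨ trans (ℚ.*-comm (c · c) (ι t)) (trans (cong (ι t ·_) (sym (ι-* (suc n) (suc n)))) (sym (ι-* t (suc n * suc n)))) ⟩
    ι (t * (suc n * suc n))                ≤⟨ ι-mono (ℕ.<⇒≤ <sq) ⟩
    ι (suc w * suc w)                      ≡⟨ trans (ι-* (suc w) (suc w)) (cong (λ x → x · x) 1+w) ⟩
    ((r + h) · c) · ((r + h) · c)          ≡⟨ solve 2 (λ x c → (x :* c) :* (x :* c) := c :* c :* (x :* x)) refl (r + h) c ⟩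
    c · c · ((r + h) · (r + h))            ∎)
    where
    open ℚ.≤-Reasoning
    1+w : ι (suc w) ≡ (r + h) · c
    1+w = trans (ι-suc w) (trans (ℚ.+-comm 1ℚ (ι w)) (trans (cong₂ _+_ (sym rc) (sym (recip-cancel (suc n)))) (sym (ℚ.*-distribʳ-+ c r h))))

-- Squares 2 b √t ≤ s, which is monotone because b is eventually nonnegative. One ε comes from the
-- limit and another from the rounding of √t, so 4 b² t ≤ (s + 2ε)²; by s ≤ t and ε ≤ 1 ≤ t the
-- excess 4εs + 4ε² is at most 8tε, and division by 8t leaves `rate t s` + ε.
rate-limit : ∀ t .{{_ : NonZero t}} s → 0ℚ ≲ s → s ≲ ι t → (b : ℕ → ℚ) → (∃ λ N → ∀ n → N ≤ n → 0ℚ ≲ b n) →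
  Eventually≤ (λ n → (pos 2 / 1) · b n · √-seq t n) s → Eventually≤ (λ n → ½ · (b n · b n)) (rate t s)
rate-limit t s 0≤s s≤t b (N₀ , 0≤b) h δ 0<δ =
  let ε , 0<ε , ε≤δ , ε≤1 = lower 0<δ 0<1
      N₁ , f = h ε 0<ε
      N₂ , g = recip-small (s + 1ℚ) 0<ε
  in N₀ ℕ.⊔ (N₁ ℕ.⊔ N₂) , λ n N≤n →
       let N₁₂≤n = ℕ.≤-trans (ℕ.m≤n⊔m N₀ (N₁ ℕ.⊔ N₂)) N≤n
       in estimate ε (ℚ.<⇒≤ 0<ε) ε≤δ ε≤1 n (0≤b n (ℕ.≤-trans (ℕ.m≤m⊔n N₀ (N₁ ℕ.⊔ N₂)) N≤n))
            (f n (ℕ.≤-trans (ℕ.m≤m⊔n N₁ N₂) N₁₂≤n)) (g n (ℕ.≤-trans (ℕ.m≤n⊔m N₁ N₂) N₁₂≤n))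
  where
  T : ℚ
  T = ι t
  estimate : ∀ ε → 0ℚ ≲ ε → ε ≲ δ → ε ≲ 1ℚ → ∀ n → 0ℚ ≲ b n → (pos 2 / 1) · b n · √-seq t n ≲ s + ε →
    (s + 1ℚ) · recip (suc n) ≲ ε → ½ · (b n · b n) ≲ rate t s + δ
  estimate ε 0≤ε ε≤δ ε≤1 n 0≤bₙ 2br≤ sh≤ε = *-cancelˡ ((pos 8 / 1) · T) (*-pos (ℚ.positive⁻¹ (pos 8 / 1)) (0<ι t)) (begin
    (pos 8 / 1) · T · (½ · (β · β))
      ≡⟨ solve 2 (λ T b → con (pos 8 / 1) :* T :* (con ½ :* (b :* b)) := con (pos 4 / 1) :* (b :* b) :* T) refl T β ⟩
    (pos 4 / 1) · (β · β) · T
      ≤⟨ *-monoˡ ((pos 4 / 1) · (β · β)) (ℚ.nonNegative⁻¹ (pos 4 / 1) ⊛ 0≤sq β) (proj₂ (√-seq-bounds t n)) ⟩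
    (pos 4 / 1) · (β · β) · ((r + h′) · (r + h′))
      ≡⟨ solve 3 (λ b r h → con (pos 4 / 1) :* (b :* b) :* ((r :+ h) :* (r :+ h))
           := (con (pos 2 / 1) :* b :* r :+ con (pos 2 / 1) :* b :* h) :* (con (pos 2 / 1) :* b :* r :+ con (pos 2 / 1) :* b :* h)) refl β r h′ ⟩
    z · z
      ≤⟨ *-mono 0≤z (0≤s ⊕ 0≤ε ⊕ 0≤ε) z≤ z≤ ⟩
    (s + ε + ε) · (s + ε + ε)
      ≤⟨ ≤-by ((pos 4 / 1) · (ε · (T - s)) + (pos 4 / 1) · (ε · (T - ε)) + (pos 8 / 1) · T · (δ - ε))
           (ℚ.nonNegative⁻¹ (pos 4 / 1) ⊛ (0≤ε ⊛ x≤y⇒0≤y-x s≤t) ⊕ ℚ.nonNegative⁻¹ (pos 4 / 1) ⊛ (0≤ε ⊛ x≤y⇒0≤y-x (ℚ.≤-trans ε≤1 (1≤ι {t})))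
             ⊕ ℚ.nonNegative⁻¹ (pos 8 / 1) ⊛ 0≤ι t ⊛ x≤y⇒0≤y-x ε≤δ)
           (solve 4 (λ s e T d → s :* s :* con 1ℚ :+ con (pos 8 / 1) :* T :* d
             := (s :+ e :+ e) :* (s :+ e :+ e) :+ (con (pos 4 / 1) :* (e :* (T :- s)) :+ con (pos 4 / 1) :* (e :* (T :- e)) :+ con (pos 8 / 1) :* T :* (d :- e))) refl s ε T δ) ⟩
    s · s · 1ℚ + (pos 8 / 1) · T · δ
      ≡⟨ trans (cong (λ x → s · s · x + (pos 8 / 1) · T · δ) (sym (recip-cancel t)))
           (solve 4 (λ s c T d → s :* s :* (c :* T) :+ con (pos 8 / 1) :* T :* d := con (pos 8 / 1) :* T :* (s :* s :* con (pos 1 / 8) :* c :+ d)) refl s (recip t) T δ) ⟩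
    (pos 8 / 1) · T · (rate t s + δ) ∎)
    where
    open ℚ.≤-Reasoning
    β r h′ z : ℚ
    β  = b n
    r  = √-seq t n
    h′ = recip (suc n)
    z  = (pos 2 / 1) · β · r + (pos 2 / 1) · β · h′
    0≤2β : 0ℚ ≲ (pos 2 / 1) · β
    0≤2β = ℚ.nonNegative⁻¹ (pos 2 / 1) ⊛ 0≤bₙ
    1≤r : 1ℚ ≲ r
    1≤r = proj₁ (√-seq-bounds t n)
    0≤z : 0ℚ ≲ z
    0≤z = 0≤2β ⊛ ℚ.≤-trans 0≤1 1≤r ⊕ 0≤2β ⊛ 0≤recip (suc n)
    2β≤s+1 : (pos 2 / 1) · β ≲ s + 1ℚ
    2β≤s+1 = ℚ.≤-trans (subst (_≲ (pos 2 / 1) · β · r) (ℚ.*-identityʳ ((pos 2 / 1) · β)) (*-monoˡ ((pos 2 / 1) · β) 0≤2β 1≤r))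
      (ℚ.≤-trans 2br≤ (ℚ.+-monoʳ-≤ s ε≤1))
    z≤ : z ≲ s + ε + ε
    z≤ = ℚ.+-mono-≤ 2br≤ (ℚ.≤-trans (*-monoʳ h′ (0≤recip (suc n)) 2β≤s+1) sh≤ε)

-- Supplies the rational threshold: the minimizer lies in D and so obeys the real inequality, while
-- its value bounds the deviation from below on all of D.
minimum : ∀ {A : Set} {D : Pred A 0ℓ} (D? : Decidable D) (g : A → ℚ) (xs : List A) →
  (∀ x → x List.∈ xs → ¬ D x) ⊎ (∃ λ x → D x × (∀ y → y List.∈ xs → D y → g x ≲ g y))
minimum D? g [] = inj₁ (λ x ())
minimum D? g (x ∷ xs) with D? x | minimum D? g xs
... | no ¬d | inj₁ none = inj₁ λ { y (here refl) → ¬d ; y (there y∈) → none y y∈ }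
... | no ¬d | inj₂ (z , dz , z≤) = inj₂ (z , dz , λ { y (here refl) d → contradiction d ¬d ; y (there y∈) d → z≤ y y∈ d })
... | yes d | inj₁ none = inj₂ (x , d , λ { y (here refl) _ → ℚ.≤-refl ; y (there y∈) dy → contradiction dy (none y y∈) })
... | yes d | inj₂ (z , dz , z≤) with ℚ.≤-total (g x) (g z)
...   | inj₁ x≤z = inj₂ (x , d , λ { y (here refl) _ → ℚ.≤-refl ; y (there y∈) dy → ℚ.≤-trans x≤z (z≤ y y∈ dy) })
...   | inj₂ z≤x = inj₂ (z , dz , λ { y (here refl) _ → z≤x ; y (there y∈) dy → z≤ y y∈ dy })

-- An attained deviation is thus an admissible threshold s ≤ t for the tail bounds.
deviation≤t : ∀ {m t} k {𝒢 : Pred (Subset m) 0ℓ} (𝒢? : Decidable 𝒢) → suc k ≤ m → (Bs : Vec (Subset m) t) →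
  ℚ.∣ ι (count 𝒢? Bs) - mean k 𝒢? · ι t ∣ ≲ ι t
deviation≤t {m} {t} k 𝒢? l≤m Bs with ℚ.∣p∣≡p∨∣p∣≡-p (ι (count 𝒢? Bs) - mean k 𝒢? · ι t)
... | inj₁ e = subst (_≲ ι t) (sym e) (≤-by (ι t - c + a · ι t) (x≤y⇒0≤y-x (ι-mono (count≤ 𝒢? Bs)) ⊕ 0≤a ⊛ 0≤ι t)
                 (solve 3 (λ c a T → T := c :- a :* T :+ (T :- c :+ a :* T)) refl c a (ι t)))
  where
  c = ι (count 𝒢? Bs)
  a = mean k 𝒢?
  0≤a : 0ℚ ≲ a
  0≤a = Density.0≤α k (λ B → ⟦ 𝒢? B ⟧) (λ B → 0≤⟦⟧ (𝒢? B)) (λ B → ⟦⟧≤1 (𝒢? B)) ⊤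
... | inj₂ e = subst (_≲ ι t) (sym e) (≤-by (c + (1ℚ - a) · ι t) (0≤ι (count 𝒢? Bs) ⊕ x≤y⇒0≤y-x a≤1 ⊛ 0≤ι t)
                 (solve 3 (λ c a T → T := :- (c :- a :* T) :+ (c :+ (con 1ℚ :- a) :* T)) refl c a (ι t)))
  where
  c = ι (count 𝒢? Bs)
  a = mean k 𝒢?
  a≤1 : a ≲ 1ℚ
  a≤1 = Density.α≤1 k (λ B → ⟦ 𝒢? B ⟧) (λ B → 0≤⟦⟧ (𝒢? B)) (λ B → ⟦⟧≤1 (𝒢? B)) ⊤ (subst (suc k ≤_) (sym (∣⊤∣≡n m)) l≤m)

theorem12 : ∀ (m l t : ℕ) .{{_ : NonZero m}} .{{_ : NonZero l}} .{{_ : NonZero t}}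
    (tl≤m : t * l ≤ m)
    {𝒢 : Pred (Subset m) 0ℓ} (𝒢? : Decidable 𝒢) (𝒢-uniform : ∀ {s} → 𝒢 s → ∣ s ∣ ≡ l)
    (β : ℝ) → 0ᴿ <ᴿ β →
    let instance _ = binomial-nonZero {m} {l} {t} tl≤m
        instance _ = matchings-nonZero {m} {l} {t} tl≤m
        α = fromℚ (density l 𝒢?)
        η = λ (B : Vec (Subset m) t) → fromℕ (hits 𝒢? B)
    in
    ℙ[ (λ B → fromℕ 2 *ᴿ β *ᴿ √ t ≤ᴿ ∣ η B -ᴿ α *ᴿ fromℕ t ∣ᴿ) ∣ matchings m l t ]≤
      fromℕ 2 *ᴿ exp (-ᴿ (fromℚ ½ *ᴿ (β *ᴿ β)))
theorem12 m (suc k) t tl≤m 𝒢? 𝒢-uniform β (ε₀ , 0<ε₀ , N₀ , β>0) {D} D? D⊆E =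
  bound (minimum D? deviation (allVecs (subsets m) t))
  where
  instance
    _ : NonZero (m ℕ.C suc k)
    _ = binomial-nonZero {m} {suc k} {t} tl≤m
    _ : NonZero (length (matchings m (suc k) t))
    _ = matchings-nonZero {m} {suc k} {t} tl≤m
  Ω = matchings m (suc k) t
  a P : ℚ
  a = mean k 𝒢?
  P = ℙ Ω D?
  b x : ℕ → ℚ
  b = seq β
  x n = ½ · (b n · b n)
  0≤x : ∀ n → 0ℚ ≲ x n
  0≤x n = 0≤½ ⊛ 0≤sq (b n)
  deviation : Vec (Subset m) t → ℚ
  deviation Bs = ℚ.∣ ι (count 𝒢? Bs) - a · ι t ∣
  PΩ : P · ι (length Ω) ≡ ι (length (filter D? Ω))
  PΩ = /-cancel (length (filter D? Ω)) (length Ω)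
  0<Ω : 0ℚ < ι (length Ω)
  0<Ω = 0<ι (length Ω)
  0≤P : 0ℚ ≲ P
  0≤P = *-cancelˡ (ι (length Ω)) 0<Ω (subst₂ _≲_ (sym (ℚ.*-zeroʳ (ι (length Ω)))) (trans (sym PΩ) (ℚ.*-comm P (ι (length Ω)))) (0≤ι (length (filter D? Ω))))
  limit : ∀ σ → 0ℚ ≲ σ → (∀ n → ι (length (filter D? Ω)) · expSum n σ ≲ (pos 2 / 1) · ι (length Ω)) → Eventually≤ x σ →
    fromℚ P ≤ᴿ fromℕ 2 *ᴿ exp (-ᴿ (fromℚ ½ *ᴿ (β *ᴿ β)))
  limit σ 0≤σ tail x≤ ε 0<ε =
    -- The factor 2 of the bound is moved to the left: P / 2 is estimated with error ε / 2.
    let N , f = exp-neg-limit (P · ½) σ x (0≤P ⊛ 0≤½) 0≤σ tail′ 0≤x x≤ (ε · ½) (*-pos 0<ε 0<½)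
    in N , λ n N≤n → ℚ.≤-trans (ℚ.≤-reflexive (sym (½+½ P))) (ℚ.≤-trans (ℚ.+-mono-≤ (f n N≤n) (f n N≤n))
         (ℚ.≤-reflexive (solve 2 (λ e d → (e :+ d :* con ½) :+ (e :+ d :* con ½) := con (pos 2 / 1) :* e :+ d) refl (expSum n (- x n)) ε)))
    where
    tail′ : ∀ n → P · ½ · expSum n σ ≲ 1ℚ
    tail′ n = *-cancelˡ ((pos 2 / 1) · ι (length Ω)) (*-pos (ℚ.positive⁻¹ (pos 2 / 1)) 0<Ω)
      (subst₂ _≲_ (trans (cong (_· expSum n σ) (sym PΩ)) (solve 3 (λ p w e → p :* w :* e := con (pos 2 / 1) :* w :* (p :* con ½ :* e)) refl P (ι (length Ω)) (expSum n σ)))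
        (sym (ℚ.*-identityʳ ((pos 2 / 1) · ι (length Ω)))) (tail n))
  bound : _ → fromℚ P ≤ᴿ fromℕ 2 *ᴿ exp (-ᴿ (fromℚ ½ *ᴿ (β *ᴿ β)))
  bound (inj₁ none) =
    -- Here no outcome lies in D, so the tail condition holds for any σ, and it is enough to bound x
    -- eventually: a late term of this Cauchy sequence plus 1 does so.
    let N , f = cauchy (fromℚ ½ *ᴿ (β *ᴿ β)) 1ℚ 0<1
    in limit (x N + 1ℚ) (0≤x N ⊕ 0≤1)
      (λ n → ℚ.≤-trans (ℚ.≤-reflexive (trans (cong (λ k → ι k · expSum n (x N + 1ℚ)) empty)
          (trans (cong (_· expSum n (x N + 1ℚ)) (ι≡/1 0)) (ℚ.*-zeroˡ (expSum n (x N + 1ℚ))))))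
        (ℚ.nonNegative⁻¹ (pos 2 / 1) ⊛ 0≤ι (length Ω)))
      (λ δ 0<δ → N , λ n N≤n → ≤-by (1ℚ - (x n - x N) + δ)
        (x≤y⇒0≤y-x (ℚ.≤-trans (x≤∣x∣ (x n - x N)) (f n N N≤n ℕ.≤-refl)) ⊕ ℚ.<⇒≤ 0<δ)
        (solve 3 (λ y z d → z :+ con 1ℚ :+ d := y :+ (con 1ℚ :- (y :- z) :+ d)) refl (x n) (x N) δ))
    where
    empty : length (filter D? Ω) ≡ 0
    empty = cong length (filter-none D? (ListAll.universal (λ Bs → none Bs (∈-allVecs ∈-subsets Bs)) Ω))
  bound (inj₂ (Bs , d , least)) = limit (rate t s) (0≤s ⊛ 0≤s ⊛ ℚ.nonNegative⁻¹ (pos 1 / 8) ⊛ 0≤recip t)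
    (two-sided-tail tl≤m s 0≤s s≤t 𝒢? D? (λ Cs → least Cs (∈-allVecs ∈-subsets Cs)))
    (rate-limit t s 0≤s s≤t b (N₀ , λ n N≤n → ℚ.≤-trans (ℚ.<⇒≤ 0<ε₀) (ℚ.≤-trans (ℚ.≤-reflexive (sym (ℚ.+-identityˡ ε₀))) (β>0 n N≤n)))
      -- The minimizer `Bs` lies in the event itself, so 2β√t ≤ s as reals, that is, up to every δ
      -- from some index on.
      (λ δ 0<δ → let N , f = D⊆E d δ 0<δ in N , λ n N≤n → subst (λ z → (pos 2 / 1) · b n · √-seq t n ≲ z + δ) deviation≡ (f n N≤n)))
    where
    s : ℚ
    s = deviation Bs
    0≤s : 0ℚ ≲ s
    0≤s = ℚ.0≤∣p∣ _
    s≤t : s ≲ ι t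
    s≤t = deviation≤t k 𝒢? (ℕ.≤-trans (ℕ.m≤n*m (suc k) t) tl≤m) Bs
    deviation≡ : ℚ.∣ pos (count 𝒢? Bs) / 1 - density (suc k) 𝒢? · (pos t / 1) ∣ ≡ s
    deviation≡ = cong₂ (λ c d → ℚ.∣ c - d ∣) (sym (ι≡/1 (count 𝒢? Bs))) (cong₂ _·_ (density≡mean k 𝒢? 𝒢-uniform) (sym (ι≡/1 t)))
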